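{- Let $M$ be a term of the CCV $\lambda\mu$-calculus. Then $M$ is normalizable (i.e., $M\to^* M'$ for some $M'$ containing no redex of any reduction rule) if and only if its CPS translation $[\![M]\!]$ has a $\beta\eta$-normal form in the target calculus.
   Context: CCV $\lambda\mu$-calculus. Ordinary variables $x,y,z,\dots$ and continuation variables $k,l,\dots$ are disjoint. Terms $M ::= x \mid \lambda x.M \mid MM \mid (M\ \mathsf{where}\ x:=M) \mid \mu k.J$, jumps $J ::= [k]M \mid (J\ \mathsf{where}\ x:=M)$, where $(L\ \mathsf{where}\ x:=M)$ means $\mathsf{let}\ x=M\ \mathsf{in}\ L$ ($x$ bound in $L$ only); $\lambda x$, $\mu k$ bind as usual. Terms are identified up to $\alpha$-conversion and the congruence generated by (E1) $(L\ \mathsf{where}\ x:=(M\ \mathsf{where}\ y:=N))=((L\ \mathsf{where}\ x:=M)\ \mathsf{where}\ y:=N)$ if $y$ not free in $L$; (E2) $((\mu k.J)\ \mathsf{where}\ x:=M)=\mu k.(J\ \mathsf{where}\ x:=M)$ if $k$ not free in $M$; (E3) $[k](L\ \mathsf{where}\ x:=M)=([k]L\ \mathsf{where}\ x:=M)$. Values $V$: variables and $\lambda$-abstractions; $N$ denotes a non-value. Reduction rules ($z$ fresh): $NM\to(zM\ \mathsf{where}\ z:=N)$; $VN\to(Vz\ \mathsf{where}\ z:=N)$; $(\lambda x.M)V\to(M\ \mathsf{where}\ x:=V)$; $(M\ \mathsf{where}\ x:=V)\to M\{V/x\}$; $(M\ \mathsf{where}\ x:=\mu k.J)\to\mu k.J\{[k]\square\mapsto[k](M\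 \mathsf{where}\ x:=\square)\}$; $[l]\mu k.J\to J\{l/k\}$; $\lambda x.Vx\to V$ ($x$ not free in $V$); $(x\ \mathsf{where}\ x:=M)\to M$; $\mu k.[k]M\to M$ ($k$ not free in $M$). The context substitution replaces recursively each subjump $[k]Q$ with $k$ free by $[k](M\ \mathsf{where}\ x:=Q)$; $J\{l/k\}$ replaces each such $[k]Q$ by $[l]Q$. $\to$ is the compatible closure. Target calculus: sorted $\lambda$-calculus $T::=\lambda k.Q\mid WW$, $Q::=KW\mid TK$, $W::=x\mid\lambda x.T$, $K::=k\mid\lambda x.Q$ with $\beta\eta$-reduction. CPS translation: $\langle V\rangle[K]=KV^*$; $\langle V_1V_2\rangle[K]=V_1^*V_2^*K$; $\langle VN\rangle[K]=\langle N\rangle[\lambda y.V^*yK]$; $\langle NV\rangle[K]=\langle N\rangle[\lambda x.xV^*K]$; $\langle N_1N_2\rangle[K]=\langle N_1\rangle[\lambda x.\langle N_2\rangle[\lambda y.xyK]]$; $\langle (L\ \mathsf{where}\ x:=M)\rangle[K]=\langle M\rangle[\lambda x.\langle L\rangle[K]]$ (renaming $x$ if free in $K$); $\langle\mu k.J\rangle[K]=(\lambda k.\langle J\rangle)K$; $\langle[k]M\rangle=\langle M\rangle[k]$; $\langle (J\ \mathsf{where}\ x:=M)\rangle=\langle M\rangle[\lambda x.\langle J\rangle]$; $x^*=x$; $(\lambda x.M)^*=\lambda xk.\langle M\rangle[k]$; $[\![M]\!]=\lambda k.\langle M\rangle[k]$ (fresh bound variables). $[\![M]\!]$ is computed from any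 syntax-tree representative of $M$ (the result is determined up to $\beta$-equality). -}

module Defs where

open import Data.Fin using (Fin; zero; suc; lift; _≟_)
open import Data.Nat using (ℕ; suc)
open import Data.Product using (∃-syntax; _×_)
open import Function using (id; _∘_)
open import Relation.Nullary using (¬_; Dec; yes; no)

-- Well-scoped de Bruijn syntax, so α-equivalence is _≡_.  Ordinary variables
-- live in Fin n and continuation variables in Fin m; the two scopes are
-- independent.  In every binder the bound variable is index zero.

------------------------------------------------------------------------
-- The CCV λμ-calculus

infixl 8 _·_
infix  7 [_]_
infixl 6 _where≔_ _where≔ᴶ_

mutual
  data Term (n m : ℕ) : Set where
    `_      : Fin n → Term n m
    ƛ       : Term (suc n) m → Term n m
    _·_     : Term n m → Term n m → Term n m
    _where≔_ : Term (suc n) m → Term n m → Term n m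
    μ       : Jump n (suc m) → Term n m

  data Jump (n m : ℕ) : Set where
    [_]_     : Fin m → Term n m → Jump n m
    _where≔ᴶ_ : Jump (suc n) m → Term n m → Jump n m

data Value {n m : ℕ} : Term n m → Set where
  var : ∀ {x} → Value (` x)
  lam : ∀ {M} → Value (ƛ M)

value? : ∀ {n m} (M : Term n m) → Dec (Value M)
value? (` x)        = yes var
value? (ƛ M)        = yes lam
value? (M · N)      = no λ ()
value? (L where≔ M) = no λ ()
value? (μ J)        = no λ ()

mutual
  ren : ∀ {n n′ m m′} → (Fin n → Fin n′) → (Fin m → Fin m′) → Term n m → Term n′ m′
  ren ρ σ (` x)        = ` ρ x
  ren ρ σ (ƛ M)        = ƛ (ren (lift 1 ρ) σ M)
  ren ρ σ (M · N)      = ren ρ σ M · ren ρ σ N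
  ren ρ σ (L where≔ M) = ren (lift 1 ρ) σ L where≔ ren ρ σ M
  ren ρ σ (μ J)        = μ (renᴶ ρ (lift 1 σ) J)

  renᴶ : ∀ {n n′ m m′} → (Fin n → Fin n′) → (Fin m → Fin m′) → Jump n m → Jump n′ m′
  renᴶ ρ σ ([ k ] M)     = [ σ k ] ren ρ σ M
  renᴶ ρ σ (J where≔ᴶ M) = renᴶ (lift 1 ρ) σ J where≔ᴶ ren ρ σ M

wk : ∀ {n m} → Term n m → Term (suc n) m
wk = ren suc id

wkᵏ : ∀ {n m} → Term n m → Term n (suc m)
wkᵏ = ren id suc

exts : ∀ {n n′ m} → (Fin n → Term n′ m) → Fin (suc n) → Term (suc n′) m
exts τ zero    = ` zero
exts τ (suc x) = wk (τ x)

mutual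
  sub : ∀ {n n′ m} → (Fin n → Term n′ m) → Term n m → Term n′ m
  sub τ (` x)        = τ x
  sub τ (ƛ M)        = ƛ (sub (exts τ) M)
  sub τ (M · N)      = sub τ M · sub τ N
  sub τ (L where≔ M) = sub (exts τ) L where≔ sub τ M
  sub τ (μ J)        = μ (subᴶ (wkᵏ ∘ τ) J)

  subᴶ : ∀ {n n′ m} → (Fin n → Term n′ m) → Jump n m → Jump n′ m
  subᴶ τ ([ k ] M)     = [ k ] sub τ M
  subᴶ τ (J where≔ᴶ M) = subᴶ (exts τ) J where≔ᴶ sub τ M

_/0 : ∀ {n m} → Term n m → Fin (suc n) → Term n m
(V /0) zero    = V
(V /0) (suc x) = ` x

-- M{V/x}, x being index zero of M
_⟨_⟩ : ∀ {n m} → Term (suc n) m → Term n m → Term n m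
M ⟨ V ⟩ = sub (V /0) M

_/0ᵏ : ∀ {m} → Fin m → Fin (suc m) → Fin m
(l /0ᵏ) zero    = l
(l /0ᵏ) (suc k) = k

-- J{l/k}, k being index zero of J
_⟨_⟩ᵏ : ∀ {n m} → Jump n (suc m) → Fin m → Jump n m
J ⟨ l ⟩ᵏ = renᴶ id (l /0ᵏ) J

-- plug k P J is J{[k]□ ↦ [k](P where x := □)}, x being index zero of P.
mutual
  plug : ∀ {n m} → Fin m → Term (suc n) m → Term n m → Term n m
  plug k P (` x)        = ` x
  plug k P (ƛ M)        = ƛ (plug k (ren (lift 1 suc) id P) M)
  plug k P (M · N)      = plug k P M · plug k P N
  plug k P (L where≔ M) = plug k (ren (lift 1 suc) id P) L where≔ plug k P M
  plug k P (μ J)        = μ (plugᴶ (suc k) (wkᵏ P) J)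

  plugᴶ : ∀ {n m} → Fin m → Term (suc n) m → Jump n m → Jump n m
  plugᴶ k P ([ j ] Q) with k ≟ j
  ... | yes _ = [ j ] (P where≔ plug k P Q)
  ... | no  _ = [ j ] plug k P Q
  plugᴶ k P (J where≔ᴶ M) = plugᴶ k (ren (lift 1 suc) id P) J where≔ᴶ plug k P M

-- The congruence by which terms are identified.  In E1 the body L ranges over
-- terms and jumps.
infix 4 _≈_ _≈ᴶ_

mutual
  data _≈_ {n m : ℕ} : Term n m → Term n m → Set where
    E1 : ∀ (L M : Term (suc n) m) (N : Term n m) →
         (L where≔ (M where≔ N)) ≈ (ren (lift 1 suc) id L where≔ M where≔ N)
    E2 : ∀ (J : Jump (suc n) (suc m)) (M : Term n m) →
         (μ J where≔ M) ≈ μ (J where≔ᴶ wkᵏ M)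

    ≈-refl  : ∀ {M} → M ≈ M
    ≈-sym   : ∀ {M N} → M ≈ N → N ≈ M
    ≈-trans : ∀ {L M N} → L ≈ M → M ≈ N → L ≈ N

    ƛ-cong     : ∀ {M M′} → M ≈ M′ → ƛ M ≈ ƛ M′
    ·-cong     : ∀ {M M′ N N′} → M ≈ M′ → N ≈ N′ → M · N ≈ M′ · N′
    where-cong : ∀ {L L′ M M′} → L ≈ L′ → M ≈ M′ → (L where≔ M) ≈ (L′ where≔ M′)
    μ-cong     : ∀ {J J′} → J ≈ᴶ J′ → μ J ≈ μ J′

  data _≈ᴶ_ {n m : ℕ} : Jump n m → Jump n m → Set where
    E1ᴶ : ∀ (L : Jump (suc n) m) (M : Term (suc n) m) (N : Term n m) →
          (L where≔ᴶ (M where≔ N)) ≈ᴶ (renᴶ (lift 1 suc) id L where≔ᴶ M where≔ᴶ N)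
    E3  : ∀ (k : Fin m) (L : Term (suc n) m) (M : Term n m) →
          ([ k ] (L where≔ M)) ≈ᴶ (([ k ] L) where≔ᴶ M)

    ≈ᴶ-refl  : ∀ {J} → J ≈ᴶ J
    ≈ᴶ-sym   : ∀ {J K} → J ≈ᴶ K → K ≈ᴶ J
    ≈ᴶ-trans : ∀ {I J K} → I ≈ᴶ J → J ≈ᴶ K → I ≈ᴶ K

    []-cong     : ∀ {k M M′} → M ≈ M′ → ([ k ] M) ≈ᴶ ([ k ] M′)
    whereᴶ-cong : ∀ {J J′ M M′} → J ≈ᴶ J′ → M ≈ M′ → (J where≔ᴶ M) ≈ᴶ (J′ where≔ᴶ M′)

-- Compatible closure of the rules on syntax trees, before identifying by _≈_
infix 4 _↦_ _↦ᴶ_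

mutual
  data _↦_ {n m : ℕ} : Term n m → Term n m → Set where
    name-fun : ∀ {N M} → ¬ Value N → N · M ↦ ((` zero) · wk M where≔ N)
    name-arg : ∀ {V N} → Value V → ¬ Value N → V · N ↦ (wk V · (` zero) where≔ N)
    β-λ      : ∀ {M V} → Value V → ƛ M · V ↦ (M where≔ V)
    β-where  : ∀ {M V} → Value V → (M where≔ V) ↦ M ⟨ V ⟩
    β-μ      : ∀ {M J} → (M where≔ μ J) ↦ μ (plugᴶ zero (wkᵏ M) J)
    η-λ      : ∀ {V} → Value V → ƛ (wk V · (` zero)) ↦ V
    η-where  : ∀ {M} → ((` zero) where≔ M) ↦ M
    η-μ      : ∀ {M} → μ ([ zero ] wkᵏ M) ↦ M

    ξ-ƛ      : ∀ {M M′} → M ↦ M′ → ƛ M ↦ ƛ M′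
    ξ-·ˡ     : ∀ {M M′ N} → M ↦ M′ → M · N ↦ M′ · N
    ξ-·ʳ     : ∀ {M N N′} → N ↦ N′ → M · N ↦ M · N′
    ξ-whereˡ : ∀ {L L′ M} → L ↦ L′ → (L where≔ M) ↦ (L′ where≔ M)
    ξ-whereʳ : ∀ {L M M′} → M ↦ M′ → (L where≔ M) ↦ (L where≔ M′)
    ξ-μ      : ∀ {J J′} → J ↦ᴶ J′ → μ J ↦ μ J′

  data _↦ᴶ_ {n m : ℕ} : Jump n m → Jump n m → Set where
    β-jump    : ∀ {l J} → ([ l ] μ J) ↦ᴶ J ⟨ l ⟩ᵏ

    ξ-[]      : ∀ {k M M′} → M ↦ M′ → ([ k ] M) ↦ᴶ ([ k ] M′)
    ξ-whereᴶˡ : ∀ {J J′ M} → J ↦ᴶ J′ → (J where≔ᴶ M) ↦ᴶ (J′ where≔ᴶ M)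
    ξ-whereᴶʳ : ∀ {J M M′} → M ↦ M′ → (J where≔ᴶ M) ↦ᴶ (J where≔ᴶ M′)

-- Reduction of ≈-classes: a class reduces as soon as one of its syntax trees
-- does.  Hence a term is normal iff no syntax tree in its class has a redex.
infix 4 _⟶_

_⟶_ : ∀ {n m} → Term n m → Term n m → Set
M ⟶ M′ = ∃[ L ] ∃[ L′ ] M ≈ L × L ↦ L′ × L′ ≈ M′

------------------------------------------------------------------------
-- The target calculus

infixl 8 _·ᵀ_ _·ᑫ_ _·ᴷ_

mutual
  data T (n m : ℕ) : Set where
    ƛᵀ   : Q n (suc m) → T n m
    _·ᵀ_ : W n m → W n m → T n m

  data Q (n m : ℕ) : Set where
    _·ᴷ_ : K n m → W n m → Q n m
    _·ᑫ_ : T n m → K n m → Q n m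

  data W (n m : ℕ) : Set where
    varᵂ : Fin n → W n m
    ƛᵂ   : T (suc n) m → W n m

  data K (n m : ℕ) : Set where
    varᴷ : Fin m → K n m
    ƛᴷ   : Q (suc n) m → K n m

mutual
  renᵀ : ∀ {n n′ m m′} → (Fin n → Fin n′) → (Fin m → Fin m′) → T n m → T n′ m′
  renᵀ ρ σ (ƛᵀ q)   = ƛᵀ (renᑫ ρ (lift 1 σ) q)
  renᵀ ρ σ (v ·ᵀ w) = renᵂ ρ σ v ·ᵀ renᵂ ρ σ w

  renᑫ : ∀ {n n′ m m′} → (Fin n → Fin n′) → (Fin m → Fin m′) → Q n m → Q n′ m′
  renᑫ ρ σ (k ·ᴷ w) = renᴷ ρ σ k ·ᴷ renᵂ ρ σ w
  renᑫ ρ σ (t ·ᑫ k) = renᵀ ρ σ t ·ᑫ renᴷ ρ σ k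

  renᵂ : ∀ {n n′ m m′} → (Fin n → Fin n′) → (Fin m → Fin m′) → W n m → W n′ m′
  renᵂ ρ σ (varᵂ x) = varᵂ (ρ x)
  renᵂ ρ σ (ƛᵂ t)   = ƛᵂ (renᵀ (lift 1 ρ) σ t)

  renᴷ : ∀ {n n′ m m′} → (Fin n → Fin n′) → (Fin m → Fin m′) → K n m → K n′ m′
  renᴷ ρ σ (varᴷ k) = varᴷ (σ k)
  renᴷ ρ σ (ƛᴷ q)   = ƛᴷ (renᑫ (lift 1 ρ) σ q)

extsᵂ : ∀ {n n′ m} → (Fin n → W n′ m) → Fin (suc n) → W (suc n′) m
extsᵂ τ zero    = varᵂ zero
extsᵂ τ (suc x) = renᵂ suc id (τ x)

extsᴷ : ∀ {n m m′} → (Fin m → K n m′) → Fin (suc m) → K n (suc m′)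
extsᴷ κ zero    = varᴷ zero
extsᴷ κ (suc k) = renᴷ id suc (κ k)

mutual
  subᵀ : ∀ {n n′ m m′} → (Fin n → W n′ m′) → (Fin m → K n′ m′) → T n m → T n′ m′
  subᵀ τ κ (ƛᵀ q)   = ƛᵀ (subᑫ (renᵂ id suc ∘ τ) (extsᴷ κ) q)
  subᵀ τ κ (v ·ᵀ w) = subᵂ τ κ v ·ᵀ subᵂ τ κ w

  subᑫ : ∀ {n n′ m m′} → (Fin n → W n′ m′) → (Fin m → K n′ m′) → Q n m → Q n′ m′
  subᑫ τ κ (k ·ᴷ w) = subᴷ τ κ k ·ᴷ subᵂ τ κ w
  subᑫ τ κ (t ·ᑫ k) = subᵀ τ κ t ·ᑫ subᴷ τ κ k

  subᵂ : ∀ {n n′ m m′} → (Fin n → W n′ m′) → (Fin m → K n′ m′) → W n m → W n′ m′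
  subᵂ τ κ (varᵂ x) = τ x
  subᵂ τ κ (ƛᵂ t)   = ƛᵂ (subᵀ (extsᵂ τ) (renᴷ suc id ∘ κ) t)

  subᴷ : ∀ {n n′ m m′} → (Fin n → W n′ m′) → (Fin m → K n′ m′) → K n m → K n′ m′
  subᴷ τ κ (varᴷ k) = κ k
  subᴷ τ κ (ƛᴷ q)   = ƛᴷ (subᑫ (extsᵂ τ) (renᴷ suc id ∘ κ) q)

_/0ᵂ : ∀ {n m} → W n m → Fin (suc n) → W n m
(w /0ᵂ) zero    = w
(w /0ᵂ) (suc x) = varᵂ x

_/0ᴷ : ∀ {n m} → K n m → Fin (suc m) → K n m
(k /0ᴷ) zero    = k
(k /0ᴷ) (suc l) = varᴷ l

infix 4 _⟶ᵀ_ _⟶ᑫ_ _⟶ᵂ_ _⟶ᴷ_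

mutual
  data _⟶ᵀ_ {n m : ℕ} : T n m → T n m → Set where
    β   : ∀ {t w} → ƛᵂ t ·ᵀ w ⟶ᵀ subᵀ (w /0ᵂ) varᴷ t
    η   : ∀ {t} → ƛᵀ (renᵀ id suc t ·ᑫ varᴷ zero) ⟶ᵀ t
    ξ-ƛ : ∀ {q q′} → q ⟶ᑫ q′ → ƛᵀ q ⟶ᵀ ƛᵀ q′
    ξ-ˡ : ∀ {v v′ w} → v ⟶ᵂ v′ → v ·ᵀ w ⟶ᵀ v′ ·ᵀ w
    ξ-ʳ : ∀ {v w w′} → w ⟶ᵂ w′ → v ·ᵀ w ⟶ᵀ v ·ᵀ w′

  data _⟶ᑫ_ {n m : ℕ} : Q n m → Q n m → Set where
    βᵂ   : ∀ {q w} → ƛᴷ q ·ᴷ w ⟶ᑫ subᑫ (w /0ᵂ) varᴷ q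
    βᴷ   : ∀ {q k} → ƛᵀ q ·ᑫ k ⟶ᑫ subᑫ varᵂ (k /0ᴷ) q
    ξ-ᴷˡ : ∀ {k k′ w} → k ⟶ᴷ k′ → k ·ᴷ w ⟶ᑫ k′ ·ᴷ w
    ξ-ᴷʳ : ∀ {k w w′} → w ⟶ᵂ w′ → k ·ᴷ w ⟶ᑫ k ·ᴷ w′
    ξ-ᵀˡ : ∀ {t t′ k} → t ⟶ᵀ t′ → t ·ᑫ k ⟶ᑫ t′ ·ᑫ k
    ξ-ᵀʳ : ∀ {t k k′} → k ⟶ᴷ k′ → t ·ᑫ k ⟶ᑫ t ·ᑫ k′

  data _⟶ᵂ_ {n m : ℕ} : W n m → W n m → Set where
    η   : ∀ {w} → ƛᵂ (renᵂ suc id w ·ᵀ varᵂ zero) ⟶ᵂ w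
    ξ-ƛ : ∀ {t t′} → t ⟶ᵀ t′ → ƛᵂ t ⟶ᵂ ƛᵂ t′

  data _⟶ᴷ_ {n m : ℕ} : K n m → K n m → Set where
    η   : ∀ {k} → ƛᴷ (renᴷ suc id k ·ᴷ varᵂ zero) ⟶ᴷ k
    ξ-ƛ : ∀ {q q′} → q ⟶ᑫ q′ → ƛᴷ q ⟶ᴷ ƛᴷ q′

------------------------------------------------------------------------
-- CPS translation

-- cps ρ σ M k is ⟨M′⟩[k] for M′ = ren ρ σ M.  Carrying the renaming keeps the
-- recursion structural where the translation moves a subterm under a new
-- binder, as N₂ in ⟨N₁N₂⟩[k] = ⟨N₁⟩[λx.⟨N₂⟩[λy.xyk]].
mutual
  cps : ∀ {n n′ m m′} → (Fin n → Fin n′) → (Fin m → Fin m′) → Term n m → K n′ m′ → Q n′ m′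
  cps ρ σ (` x) k = k ·ᴷ star ρ σ (` x) var
  cps ρ σ (ƛ M) k = k ·ᴷ star ρ σ (ƛ M) lam
  cps ρ σ (M · N) k with value? M | value? N
  ... | yes v | yes w = star ρ σ M v ·ᵀ star ρ σ N w ·ᑫ k
  ... | yes v | no  _ =
        cps ρ σ N (ƛᴷ (star (suc ∘ ρ) σ M v ·ᵀ varᵂ zero ·ᑫ renᴷ suc id k))
  ... | no  _ | yes w =
        cps ρ σ M (ƛᴷ (varᵂ zero ·ᵀ star (suc ∘ ρ) σ N w ·ᑫ renᴷ suc id k))
  ... | no  _ | no  _ =
        cps ρ σ M (ƛᴷ (cps (suc ∘ ρ) σ N
          (ƛᴷ (varᵂ (suc zero) ·ᵀ varᵂ zero ·ᑫ renᴷ suc id (renᴷ suc id k)))))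
  cps ρ σ (L where≔ M) k = cps ρ σ M (ƛᴷ (cps (lift 1 ρ) σ L (renᴷ suc id k)))
  cps ρ σ (μ J) k = ƛᵀ (cpsᴶ ρ (lift 1 σ) J) ·ᑫ k

  cpsᴶ : ∀ {n n′ m m′} → (Fin n → Fin n′) → (Fin m → Fin m′) → Jump n m → Q n′ m′
  cpsᴶ ρ σ ([ k ] M)     = cps ρ σ M (varᴷ (σ k))
  cpsᴶ ρ σ (J where≔ᴶ M) = cps ρ σ M (ƛᴷ (cpsᴶ (lift 1 ρ) σ J))

  star : ∀ {n n′ m m′} → (Fin n → Fin n′) → (Fin m → Fin m′) → (V : Term n m) → Value V → W n′ m′
  star ρ σ (` x) var = varᵂ (ρ x)
  star ρ σ (ƛ M) lam = ƛᵂ (ƛᵀ (cps (lift 1 ρ) (suc ∘ σ) M (varᴷ zero)))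

⟦_⟧ : ∀ {n m} → Term n m → T n m
⟦ M ⟧ = ƛᵀ (cps id suc M (varᴷ zero))

{-# OPTIONS --safe #-}
module Submission where

-- Neither direction needs confluence: all simulations go forward.
--
-- (⇒) The CPS translation reduces to a variant ⟦M⟧ᶜ that contracts its
-- administrative redexes.  This variant is constant on ≈-classes and maps M ⟶ M′
-- to ⟦M⟧ᶜ ↠ ⟦M′⟧ᶜ.  By induction on syntax trees an irreducible M is ≈ to a
-- direct-style reading of some target normal form t, and then ⟦M⟧ᶜ ↠ t.
--
-- (⇐) Target terms are read back as source terms, reading λk.Q as μk.J but, where k
-- is only the tail of Q, possibly as the term jumping to k, so that no η-expansion
-- M ← μk.[k]M is ever needed.  M reduces by the naming rules to a reading of ⟦M⟧,
-- target steps are simulated on readings, and the reading of a target normal form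
-- becomes normal by η-μ steps only.

open import Defs
open import Data.Empty using (⊥; ⊥-elim)
open import Data.Fin using (Fin; zero; suc; lift; _≟_)
open import Data.Nat using (ℕ; suc)
open import Data.Product using (∃-syntax; _×_; _,_; proj₁; proj₂)
open import Data.Sum using (_⊎_; inj₁; inj₂)
open import Data.Unit using (⊤; tt)
open import Function using (id; _∘_)
open import Function.Bundles using (_⇔_; mk⇔)
open import Relation.Binary.Construct.Closure.ReflexiveTransitive using (Star; ε; _◅_; _◅◅_; gmap; return)
open import Relation.Binary.PropositionalEquality using (_≡_; refl; sym; trans; cong; cong₂; subst; subst₂)
open import Relation.Binary.Rewriting using (HasNormalForm; IsNormalForm)
open import Relation.Nullary using (¬_; Dec; yes; no)
open import Relation.Nullary.Decidable using (_×-dec_)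

-- Two obstacles shape the proof. First, `⟦_⟧` is determined on ≈-classes only up to β: E2 moves a
-- binding across the redex `(λk.⟨J⟩)K`. A forward simulation needs one target term per class, which
-- is what contracting that redex and every `(λx.Q)W` achieves. Second, a class is irreducible only
-- if none of its trees has a redex, and E1 to E3 can hide redexes: `(μk.[j]x where x := N)` shows
-- none of the form `(x where x := N)` until E2 and E3 bring the binding inside. So (⇒) refutes
-- irreducibility by exhibiting a rearranged tree, and (⇐) ends in a syntactic predicate `Nf` whose
-- side conditions look through the equations, so that it is invariant under ≈. A single reading
-- relation serves both halves: in (⇒) it is built from an irreducible term, in (⇐) it is carried
-- along the reduction of `⟦ M ⟧`.

variable
  n n′ n″ m m′ m″ m‴ : ℕ

-- Renaming and substitution in the target calculus

lift-∘ : ∀ {ρ : Fin n → Fin n′} {ρ′ : Fin n′ → Fin n″} {ρ″ : Fin n → Fin n″} →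
         (∀ x → ρ′ (ρ x) ≡ ρ″ x) → ∀ x → lift 1 ρ′ (lift 1 ρ x) ≡ lift 1 ρ″ x
lift-∘ e zero    = refl
lift-∘ e (suc x) = cong suc (e x)

lift-id : ∀ {ρ : Fin n → Fin n} → (∀ x → ρ x ≡ x) → ∀ x → lift 1 ρ x ≡ x
lift-id e zero    = refl
lift-id e (suc x) = cong suc (e x)

mutual
  renᵀ-renᵀ : ∀ {ρ : Fin n → Fin n′} {ρ′ : Fin n′ → Fin n″} {ρ″} {φ : Fin m → Fin m′} {φ′ : Fin m′ → Fin m″} {φ″} →
              (∀ x → ρ′ (ρ x) ≡ ρ″ x) → (∀ k → φ′ (φ k) ≡ φ″ k) →
              ∀ t → renᵀ ρ′ φ′ (renᵀ ρ φ t) ≡ renᵀ ρ″ φ″ t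
  renᵀ-renᵀ e f (ƛᵀ q)   = cong ƛᵀ (renᑫ-renᑫ e (lift-∘ f) q)
  renᵀ-renᵀ e f (v ·ᵀ w) = cong₂ _·ᵀ_ (renᵂ-renᵂ e f v) (renᵂ-renᵂ e f w)

  renᑫ-renᑫ : ∀ {ρ : Fin n → Fin n′} {ρ′ : Fin n′ → Fin n″} {ρ″} {φ : Fin m → Fin m′} {φ′ : Fin m′ → Fin m″} {φ″} →
              (∀ x → ρ′ (ρ x) ≡ ρ″ x) → (∀ k → φ′ (φ k) ≡ φ″ k) →
              ∀ q → renᑫ ρ′ φ′ (renᑫ ρ φ q) ≡ renᑫ ρ″ φ″ q
  renᑫ-renᑫ e f (k ·ᴷ w) = cong₂ _·ᴷ_ (renᴷ-renᴷ e f k) (renᵂ-renᵂ e f w)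
  renᑫ-renᑫ e f (t ·ᑫ k) = cong₂ _·ᑫ_ (renᵀ-renᵀ e f t) (renᴷ-renᴷ e f k)

  renᵂ-renᵂ : ∀ {ρ : Fin n → Fin n′} {ρ′ : Fin n′ → Fin n″} {ρ″} {φ : Fin m → Fin m′} {φ′ : Fin m′ → Fin m″} {φ″} →
              (∀ x → ρ′ (ρ x) ≡ ρ″ x) → (∀ k → φ′ (φ k) ≡ φ″ k) →
              ∀ w → renᵂ ρ′ φ′ (renᵂ ρ φ w) ≡ renᵂ ρ″ φ″ w
  renᵂ-renᵂ e f (varᵂ x) = cong varᵂ (e x)
  renᵂ-renᵂ e f (ƛᵂ t)   = cong ƛᵂ (renᵀ-renᵀ (lift-∘ e) f t)

  renᴷ-renᴷ : ∀ {ρ : Fin n → Fin n′} {ρ′ : Fin n′ → Fin n″} {ρ″} {φ : Fin m → Fin m′} {φ′ : Fin m′ → Fin m″} {φ″} →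
              (∀ x → ρ′ (ρ x) ≡ ρ″ x) → (∀ k → φ′ (φ k) ≡ φ″ k) →
              ∀ k → renᴷ ρ′ φ′ (renᴷ ρ φ k) ≡ renᴷ ρ″ φ″ k
  renᴷ-renᴷ e f (varᴷ k) = cong varᴷ (f k)
  renᴷ-renᴷ e f (ƛᴷ q)   = cong ƛᴷ (renᑫ-renᑫ (lift-∘ e) f q)

wkᵂ-renᵂ : ∀ (ρ : Fin n → Fin n′) (φ : Fin m → Fin m′) w →
           renᵂ (lift 1 ρ) φ (renᵂ suc id w) ≡ renᵂ suc id (renᵂ ρ φ w)
wkᵂ-renᵂ ρ φ w = trans (renᵂ-renᵂ (λ _ → refl) (λ _ → refl) w) (sym (renᵂ-renᵂ (λ _ → refl) (λ _ → refl) w))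

wkᴷ-renᴷ : ∀ (ρ : Fin n → Fin n′) (φ : Fin m → Fin m′) k →
           renᴷ (lift 1 ρ) φ (renᴷ suc id k) ≡ renᴷ suc id (renᴷ ρ φ k)
wkᴷ-renᴷ ρ φ k = trans (renᴷ-renᴷ (λ _ → refl) (λ _ → refl) k) (sym (renᴷ-renᴷ (λ _ → refl) (λ _ → refl) k))

wkᵏᵂ-renᵂ : ∀ (ρ : Fin n → Fin n′) (φ : Fin m → Fin m′) w →
            renᵂ ρ (lift 1 φ) (renᵂ id suc w) ≡ renᵂ id suc (renᵂ ρ φ w)
wkᵏᵂ-renᵂ ρ φ w = trans (renᵂ-renᵂ (λ _ → refl) (λ _ → refl) w) (sym (renᵂ-renᵂ (λ _ → refl) (λ _ → refl) w))

wkᵏᴷ-renᴷ : ∀ (ρ : Fin n → Fin n′) (φ : Fin m → Fin m′) k →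
            renᴷ ρ (lift 1 φ) (renᴷ id suc k) ≡ renᴷ id suc (renᴷ ρ φ k)
wkᵏᴷ-renᴷ ρ φ k = trans (renᴷ-renᴷ (λ _ → refl) (λ _ → refl) k) (sym (renᴷ-renᴷ (λ _ → refl) (λ _ → refl) k))

extsᵂ-ren : ∀ {s : Fin n′ → W n″ m} {ρ : Fin n → Fin n′} {s′} →
            (∀ x → s (ρ x) ≡ s′ x) → ∀ x → extsᵂ s (lift 1 ρ x) ≡ extsᵂ s′ x
extsᵂ-ren e zero    = refl
extsᵂ-ren e (suc x) = cong (renᵂ suc id) (e x)

extsᴷ-ren : ∀ {c : Fin m′ → K n m″} {φ : Fin m → Fin m′} {c′} →
            (∀ k → c (φ k) ≡ c′ k) → ∀ k → extsᴷ c (lift 1 φ k) ≡ extsᴷ c′ k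
extsᴷ-ren e zero    = refl
extsᴷ-ren e (suc x) = cong (renᴷ id suc) (e x)

mutual
  subᵀ-renᵀ : ∀ {ρ : Fin n → Fin n′} {φ : Fin m → Fin m′} {s : Fin n′ → W n″ m″} {c s′ c′} →
              (∀ x → s (ρ x) ≡ s′ x) → (∀ k → c (φ k) ≡ c′ k) →
              ∀ t → subᵀ s c (renᵀ ρ φ t) ≡ subᵀ s′ c′ t
  subᵀ-renᵀ e f (ƛᵀ q)   = cong ƛᵀ (subᑫ-renᑫ (cong (renᵂ id suc) ∘ e) (extsᴷ-ren f) q)
  subᵀ-renᵀ e f (v ·ᵀ w) = cong₂ _·ᵀ_ (subᵂ-renᵂ e f v) (subᵂ-renᵂ e f w)

  subᑫ-renᑫ : ∀ {ρ : Fin n → Fin n′} {φ : Fin m → Fin m′} {s : Fin n′ → W n″ m″} {c s′ c′} →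
              (∀ x → s (ρ x) ≡ s′ x) → (∀ k → c (φ k) ≡ c′ k) →
              ∀ q → subᑫ s c (renᑫ ρ φ q) ≡ subᑫ s′ c′ q
  subᑫ-renᑫ e f (k ·ᴷ w) = cong₂ _·ᴷ_ (subᴷ-renᴷ e f k) (subᵂ-renᵂ e f w)
  subᑫ-renᑫ e f (t ·ᑫ k) = cong₂ _·ᑫ_ (subᵀ-renᵀ e f t) (subᴷ-renᴷ e f k)

  subᵂ-renᵂ : ∀ {ρ : Fin n → Fin n′} {φ : Fin m → Fin m′} {s : Fin n′ → W n″ m″} {c s′ c′} →
              (∀ x → s (ρ x) ≡ s′ x) → (∀ k → c (φ k) ≡ c′ k) →
              ∀ w → subᵂ s c (renᵂ ρ φ w) ≡ subᵂ s′ c′ w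
  subᵂ-renᵂ e f (varᵂ x) = e x
  subᵂ-renᵂ e f (ƛᵂ t)   = cong ƛᵂ (subᵀ-renᵀ (extsᵂ-ren e) (cong (renᴷ suc id) ∘ f) t)

  subᴷ-renᴷ : ∀ {ρ : Fin n → Fin n′} {φ : Fin m → Fin m′} {s : Fin n′ → W n″ m″} {c s′ c′} →
              (∀ x → s (ρ x) ≡ s′ x) → (∀ k → c (φ k) ≡ c′ k) →
              ∀ k → subᴷ s c (renᴷ ρ φ k) ≡ subᴷ s′ c′ k
  subᴷ-renᴷ e f (varᴷ k) = f k
  subᴷ-renᴷ e f (ƛᴷ q)   = cong ƛᴷ (subᑫ-renᑫ (extsᵂ-ren e) (cong (renᴷ suc id) ∘ f) q)

ren-extsᵂ : ∀ {ρ : Fin n′ → Fin n″} {φ : Fin m → Fin m′} {s : Fin n → W n′ m} {s′} →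
            (∀ x → renᵂ ρ φ (s x) ≡ s′ x) → ∀ x → renᵂ (lift 1 ρ) φ (extsᵂ s x) ≡ extsᵂ s′ x
ren-extsᵂ e zero    = refl
ren-extsᵂ {s = s} e (suc x) = trans (wkᵂ-renᵂ _ _ (s x)) (cong (renᵂ suc id) (e x))

ren-extsᴷ : ∀ {ρ : Fin n → Fin n′} {φ : Fin m′ → Fin m″} {c : Fin m → K n m′} {c′} →
            (∀ k → renᴷ ρ φ (c k) ≡ c′ k) → ∀ k → renᴷ ρ (lift 1 φ) (extsᴷ c k) ≡ extsᴷ c′ k
ren-extsᴷ e zero    = refl
ren-extsᴷ {c = c} e (suc x) = trans (wkᵏᴷ-renᴷ _ _ (c x)) (cong (renᴷ id suc) (e x))

mutual
  renᵀ-subᵀ : ∀ {ρ : Fin n′ → Fin n″} {φ : Fin m′ → Fin m″} {s : Fin n → W n′ m′} {c : Fin m → K n′ m′} {s′ c′} →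
              (∀ x → renᵂ ρ φ (s x) ≡ s′ x) → (∀ k → renᴷ ρ φ (c k) ≡ c′ k) →
              ∀ t → renᵀ ρ φ (subᵀ s c t) ≡ subᵀ s′ c′ t
  renᵀ-subᵀ {s = s} e f (ƛᵀ q) =
    cong ƛᵀ (renᑫ-subᑫ (λ x → trans (wkᵏᵂ-renᵂ _ _ (s x)) (cong (renᵂ id suc) (e x))) (ren-extsᴷ f) q)
  renᵀ-subᵀ e f (v ·ᵀ w) = cong₂ _·ᵀ_ (renᵂ-subᵂ e f v) (renᵂ-subᵂ e f w)

  renᑫ-subᑫ : ∀ {ρ : Fin n′ → Fin n″} {φ : Fin m′ → Fin m″} {s : Fin n → W n′ m′} {c : Fin m → K n′ m′} {s′ c′} →
              (∀ x → renᵂ ρ φ (s x) ≡ s′ x) → (∀ k → renᴷ ρ φ (c k) ≡ c′ k) →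
              ∀ q → renᑫ ρ φ (subᑫ s c q) ≡ subᑫ s′ c′ q
  renᑫ-subᑫ e f (k ·ᴷ w) = cong₂ _·ᴷ_ (renᴷ-subᴷ e f k) (renᵂ-subᵂ e f w)
  renᑫ-subᑫ e f (t ·ᑫ k) = cong₂ _·ᑫ_ (renᵀ-subᵀ e f t) (renᴷ-subᴷ e f k)

  renᵂ-subᵂ : ∀ {ρ : Fin n′ → Fin n″} {φ : Fin m′ → Fin m″} {s : Fin n → W n′ m′} {c : Fin m → K n′ m′} {s′ c′} →
              (∀ x → renᵂ ρ φ (s x) ≡ s′ x) → (∀ k → renᴷ ρ φ (c k) ≡ c′ k) →
              ∀ w → renᵂ ρ φ (subᵂ s c w) ≡ subᵂ s′ c′ w
  renᵂ-subᵂ e f (varᵂ x) = e x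
  renᵂ-subᵂ {c = c} e f (ƛᵂ t) =
    cong ƛᵂ (renᵀ-subᵀ (ren-extsᵂ e) (λ k → trans (wkᴷ-renᴷ _ _ (c k)) (cong (renᴷ suc id) (f k))) t)

  renᴷ-subᴷ : ∀ {ρ : Fin n′ → Fin n″} {φ : Fin m′ → Fin m″} {s : Fin n → W n′ m′} {c : Fin m → K n′ m′} {s′ c′} →
              (∀ x → renᵂ ρ φ (s x) ≡ s′ x) → (∀ k → renᴷ ρ φ (c k) ≡ c′ k) →
              ∀ k → renᴷ ρ φ (subᴷ s c k) ≡ subᴷ s′ c′ k
  renᴷ-subᴷ e f (varᴷ k) = f k
  renᴷ-subᴷ {c = c} e f (ƛᴷ q) =
    cong ƛᴷ (renᑫ-subᑫ (ren-extsᵂ e) (λ k → trans (wkᴷ-renᴷ _ _ (c k)) (cong (renᴷ suc id) (f k))) q)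

wkᵂ-subᵂ : ∀ (s : Fin n → W n′ m′) (c : Fin m → K n′ m′) w →
           subᵂ (extsᵂ s) (renᴷ suc id ∘ c) (renᵂ suc id w) ≡ renᵂ suc id (subᵂ s c w)
wkᵂ-subᵂ s c w = trans (subᵂ-renᵂ (λ _ → refl) (λ _ → refl) w) (sym (renᵂ-subᵂ (λ _ → refl) (λ _ → refl) w))

wkᴷ-subᴷ : ∀ (s : Fin n → W n′ m′) (c : Fin m → K n′ m′) k →
           subᴷ (extsᵂ s) (renᴷ suc id ∘ c) (renᴷ suc id k) ≡ renᴷ suc id (subᴷ s c k)
wkᴷ-subᴷ s c k = trans (subᴷ-renᴷ (λ _ → refl) (λ _ → refl) k) (sym (renᴷ-subᴷ (λ _ → refl) (λ _ → refl) k))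

wkᵏᵂ-subᵂ : ∀ (s : Fin n → W n′ m′) (c : Fin m → K n′ m′) w →
            subᵂ (renᵂ id suc ∘ s) (extsᴷ c) (renᵂ id suc w) ≡ renᵂ id suc (subᵂ s c w)
wkᵏᵂ-subᵂ s c w = trans (subᵂ-renᵂ (λ _ → refl) (λ _ → refl) w) (sym (renᵂ-subᵂ (λ _ → refl) (λ _ → refl) w))

wkᵏᴷ-subᴷ : ∀ (s : Fin n → W n′ m′) (c : Fin m → K n′ m′) k →
            subᴷ (renᵂ id suc ∘ s) (extsᴷ c) (renᴷ id suc k) ≡ renᴷ id suc (subᴷ s c k)
wkᵏᴷ-subᴷ s c k = trans (subᴷ-renᴷ (λ _ → refl) (λ _ → refl) k) (sym (renᴷ-subᴷ (λ _ → refl) (λ _ → refl) k))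

wkᵏᵀ-subᵀ : ∀ (s : Fin n → W n′ m′) (c : Fin m → K n′ m′) t →
            subᵀ (renᵂ id suc ∘ s) (extsᴷ c) (renᵀ id suc t) ≡ renᵀ id suc (subᵀ s c t)
wkᵏᵀ-subᵀ s c t = trans (subᵀ-renᵀ (λ _ → refl) (λ _ → refl) t) (sym (renᵀ-subᵀ (λ _ → refl) (λ _ → refl) t))

sub-extsᵂ : ∀ {s : Fin n → W n′ m} {s′ : Fin n′ → W n″ m″} {c′ : Fin m → K n″ m″} {s″} →
            (∀ x → subᵂ s′ c′ (s x) ≡ s″ x) →
            ∀ x → subᵂ (extsᵂ s′) (renᴷ suc id ∘ c′) (extsᵂ s x) ≡ extsᵂ s″ x
sub-extsᵂ e zero    = refl
sub-extsᵂ {s = s} e (suc x) = trans (wkᵂ-subᵂ _ _ (s x)) (cong (renᵂ suc id) (e x))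

sub-extsᴷ : ∀ {c : Fin m → K n m′} {s′ : Fin n → W n″ m″} {c′ : Fin m′ → K n″ m″} {c″} →
            (∀ k → subᴷ s′ c′ (c k) ≡ c″ k) →
            ∀ k → subᴷ (renᵂ id suc ∘ s′) (extsᴷ c′) (extsᴷ c k) ≡ extsᴷ c″ k
sub-extsᴷ e zero    = refl
sub-extsᴷ {c = c} e (suc k) = trans (wkᵏᴷ-subᴷ _ _ (c k)) (cong (renᴷ id suc) (e k))

mutual
  subᵀ-subᵀ : ∀ {s : Fin n → W n′ m′} {c : Fin m → K n′ m′} {s′ : Fin n′ → W n″ m″} {c′ s″ c″} →
              (∀ x → subᵂ s′ c′ (s x) ≡ s″ x) → (∀ k → subᴷ s′ c′ (c k) ≡ c″ k) →
              ∀ t → subᵀ s′ c′ (subᵀ s c t) ≡ subᵀ s″ c″ t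
  subᵀ-subᵀ {s = s} e f (ƛᵀ q) =
    cong ƛᵀ (subᑫ-subᑫ (λ x → trans (wkᵏᵂ-subᵂ _ _ (s x)) (cong (renᵂ id suc) (e x))) (sub-extsᴷ f) q)
  subᵀ-subᵀ e f (v ·ᵀ w) = cong₂ _·ᵀ_ (subᵂ-subᵂ e f v) (subᵂ-subᵂ e f w)

  subᑫ-subᑫ : ∀ {s : Fin n → W n′ m′} {c : Fin m → K n′ m′} {s′ : Fin n′ → W n″ m″} {c′ s″ c″} →
              (∀ x → subᵂ s′ c′ (s x) ≡ s″ x) → (∀ k → subᴷ s′ c′ (c k) ≡ c″ k) →
              ∀ q → subᑫ s′ c′ (subᑫ s c q) ≡ subᑫ s″ c″ q
  subᑫ-subᑫ e f (k ·ᴷ w) = cong₂ _·ᴷ_ (subᴷ-subᴷ e f k) (subᵂ-subᵂ e f w)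
  subᑫ-subᑫ e f (t ·ᑫ k) = cong₂ _·ᑫ_ (subᵀ-subᵀ e f t) (subᴷ-subᴷ e f k)

  subᵂ-subᵂ : ∀ {s : Fin n → W n′ m′} {c : Fin m → K n′ m′} {s′ : Fin n′ → W n″ m″} {c′ s″ c″} →
              (∀ x → subᵂ s′ c′ (s x) ≡ s″ x) → (∀ k → subᴷ s′ c′ (c k) ≡ c″ k) →
              ∀ w → subᵂ s′ c′ (subᵂ s c w) ≡ subᵂ s″ c″ w
  subᵂ-subᵂ e f (varᵂ x) = e x
  subᵂ-subᵂ {c = c} e f (ƛᵂ t) =
    cong ƛᵂ (subᵀ-subᵀ (sub-extsᵂ e) (λ k → trans (wkᴷ-subᴷ _ _ (c k)) (cong (renᴷ suc id) (f k))) t)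

  subᴷ-subᴷ : ∀ {s : Fin n → W n′ m′} {c : Fin m → K n′ m′} {s′ : Fin n′ → W n″ m″} {c′ s″ c″} →
              (∀ x → subᵂ s′ c′ (s x) ≡ s″ x) → (∀ k → subᴷ s′ c′ (c k) ≡ c″ k) →
              ∀ k → subᴷ s′ c′ (subᴷ s c k) ≡ subᴷ s″ c″ k
  subᴷ-subᴷ e f (varᴷ k) = f k
  subᴷ-subᴷ {c = c} e f (ƛᴷ q) =
    cong ƛᴷ (subᑫ-subᑫ (sub-extsᵂ e) (λ k → trans (wkᴷ-subᴷ _ _ (c k)) (cong (renᴷ suc id) (f k))) q)

extsᵂ-var : ∀ {s : Fin n → W n′ m} {ρ} → (∀ x → s x ≡ varᵂ (ρ x)) → ∀ x → extsᵂ s x ≡ varᵂ (lift 1 ρ x)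
extsᵂ-var e zero    = refl
extsᵂ-var e (suc x) = cong (renᵂ suc id) (e x)

extsᴷ-var : ∀ {c : Fin m → K n m′} {φ} → (∀ k → c k ≡ varᴷ (φ k)) → ∀ k → extsᴷ c k ≡ varᴷ (lift 1 φ k)
extsᴷ-var e zero    = refl
extsᴷ-var e (suc x) = cong (renᴷ id suc) (e x)

mutual
  subᵀ-var : ∀ {s : Fin n → W n′ m′} {c : Fin m → K n′ m′} {ρ φ} →
             (∀ x → s x ≡ varᵂ (ρ x)) → (∀ k → c k ≡ varᴷ (φ k)) → ∀ t → subᵀ s c t ≡ renᵀ ρ φ t
  subᵀ-var e f (ƛᵀ q)   = cong ƛᵀ (subᑫ-var (cong (renᵂ id suc) ∘ e) (extsᴷ-var f) q)
  subᵀ-var e f (v ·ᵀ w) = cong₂ _·ᵀ_ (subᵂ-var e f v) (subᵂ-var e f w)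

  subᑫ-var : ∀ {s : Fin n → W n′ m′} {c : Fin m → K n′ m′} {ρ φ} →
             (∀ x → s x ≡ varᵂ (ρ x)) → (∀ k → c k ≡ varᴷ (φ k)) → ∀ q → subᑫ s c q ≡ renᑫ ρ φ q
  subᑫ-var e f (k ·ᴷ w) = cong₂ _·ᴷ_ (subᴷ-var e f k) (subᵂ-var e f w)
  subᑫ-var e f (t ·ᑫ k) = cong₂ _·ᑫ_ (subᵀ-var e f t) (subᴷ-var e f k)

  subᵂ-var : ∀ {s : Fin n → W n′ m′} {c : Fin m → K n′ m′} {ρ φ} →
             (∀ x → s x ≡ varᵂ (ρ x)) → (∀ k → c k ≡ varᴷ (φ k)) → ∀ w → subᵂ s c w ≡ renᵂ ρ φ w
  subᵂ-var e f (varᵂ x) = e x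
  subᵂ-var e f (ƛᵂ t)   = cong ƛᵂ (subᵀ-var (extsᵂ-var e) (cong (renᴷ suc id) ∘ f) t)

  subᴷ-var : ∀ {s : Fin n → W n′ m′} {c : Fin m → K n′ m′} {ρ φ} →
             (∀ x → s x ≡ varᵂ (ρ x)) → (∀ k → c k ≡ varᴷ (φ k)) → ∀ k → subᴷ s c k ≡ renᴷ ρ φ k
  subᴷ-var e f (varᴷ k) = f k
  subᴷ-var e f (ƛᴷ q)   = cong ƛᴷ (subᑫ-var (extsᵂ-var e) (cong (renᴷ suc id) ∘ f) q)

mutual
  renᵀ-id : ∀ {ρ : Fin n → Fin n} {φ : Fin m → Fin m} → (∀ x → ρ x ≡ x) → (∀ k → φ k ≡ k) → ∀ t → renᵀ ρ φ t ≡ t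
  renᵀ-id e f (ƛᵀ q)   = cong ƛᵀ (renᑫ-id e (lift-id f) q)
  renᵀ-id e f (v ·ᵀ w) = cong₂ _·ᵀ_ (renᵂ-id e f v) (renᵂ-id e f w)

  renᑫ-id : ∀ {ρ : Fin n → Fin n} {φ : Fin m → Fin m} → (∀ x → ρ x ≡ x) → (∀ k → φ k ≡ k) → ∀ q → renᑫ ρ φ q ≡ q
  renᑫ-id e f (k ·ᴷ w) = cong₂ _·ᴷ_ (renᴷ-id e f k) (renᵂ-id e f w)
  renᑫ-id e f (t ·ᑫ k) = cong₂ _·ᑫ_ (renᵀ-id e f t) (renᴷ-id e f k)

  renᵂ-id : ∀ {ρ : Fin n → Fin n} {φ : Fin m → Fin m} → (∀ x → ρ x ≡ x) → (∀ k → φ k ≡ k) → ∀ w → renᵂ ρ φ w ≡ w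
  renᵂ-id e f (varᵂ x) = cong varᵂ (e x)
  renᵂ-id e f (ƛᵂ t)   = cong ƛᵂ (renᵀ-id (lift-id e) f t)

  renᴷ-id : ∀ {ρ : Fin n → Fin n} {φ : Fin m → Fin m} → (∀ x → ρ x ≡ x) → (∀ k → φ k ≡ k) → ∀ k → renᴷ ρ φ k ≡ k
  renᴷ-id e f (varᴷ k) = cong varᴷ (f k)
  renᴷ-id e f (ƛᴷ q)   = cong ƛᴷ (renᑫ-id (lift-id e) f q)

subᑫ-renᑫ-id : ∀ {ρ : Fin n → Fin n′} {φ : Fin m → Fin m′} {s c} →
               (∀ x → s (ρ x) ≡ varᵂ x) → (∀ k → c (φ k) ≡ varᴷ k) → ∀ q → subᑫ s c (renᑫ ρ φ q) ≡ q
subᑫ-renᑫ-id e f q = trans (subᑫ-renᑫ e f q) (trans (subᑫ-var {ρ = id} {φ = id} (λ _ → refl) (λ _ → refl) q) (renᑫ-id (λ _ → refl) (λ _ → refl) q))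

subᵂ-renᵂ-id : ∀ {ρ : Fin n → Fin n′} {φ : Fin m → Fin m′} {s c} →
               (∀ x → s (ρ x) ≡ varᵂ x) → (∀ k → c (φ k) ≡ varᴷ k) → ∀ w → subᵂ s c (renᵂ ρ φ w) ≡ w
subᵂ-renᵂ-id e f w = trans (subᵂ-renᵂ e f w) (trans (subᵂ-var {ρ = id} {φ = id} (λ _ → refl) (λ _ → refl) w) (renᵂ-id (λ _ → refl) (λ _ → refl) w))

subᴷ-renᴷ-id : ∀ {ρ : Fin n → Fin n′} {φ : Fin m → Fin m′} {s c} →
               (∀ x → s (ρ x) ≡ varᵂ x) → (∀ k → c (φ k) ≡ varᴷ k) → ∀ k → subᴷ s c (renᴷ ρ φ k) ≡ k
subᴷ-renᴷ-id e f k = trans (subᴷ-renᴷ e f k) (trans (subᴷ-var {ρ = id} {φ = id} (λ _ → refl) (λ _ → refl) k) (renᴷ-id (λ _ → refl) (λ _ → refl) k))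

-- Reduction in the target calculus

infix 4 _↠ᵀ_ _↠ᑫ_ _↠ᵂ_ _↠ᴷ_

_↠ᵀ_ : T n m → T n m → Set
_↠ᵀ_ = Star _⟶ᵀ_

_↠ᑫ_ : Q n m → Q n m → Set
_↠ᑫ_ = Star _⟶ᑫ_

_↠ᵂ_ : W n m → W n m → Set
_↠ᵂ_ = Star _⟶ᵂ_

_↠ᴷ_ : K n m → K n m → Set
_↠ᴷ_ = Star _⟶ᴷ_

≡⇒↠ᑫ : ∀ {q q′ : Q n m} → q ≡ q′ → q ↠ᑫ q′
≡⇒↠ᑫ refl = ε

·ᵀ-↠ : ∀ {v v′ w w′ : W n m} → v ↠ᵂ v′ → w ↠ᵂ w′ → v ·ᵀ w ↠ᵀ v′ ·ᵀ w′
·ᵀ-↠ p q = gmap (_·ᵀ _) ξ-ˡ p ◅◅ gmap (_ ·ᵀ_) ξ-ʳ q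

·ᴷ-↠ : ∀ {k k′ : K n m} {w w′} → k ↠ᴷ k′ → w ↠ᵂ w′ → k ·ᴷ w ↠ᑫ k′ ·ᴷ w′
·ᴷ-↠ p q = gmap (_·ᴷ _) ξ-ᴷˡ p ◅◅ gmap (_ ·ᴷ_) ξ-ᴷʳ q

·ᑫ-↠ : ∀ {t t′ : T n m} {k k′} → t ↠ᵀ t′ → k ↠ᴷ k′ → t ·ᑫ k ↠ᑫ t′ ·ᑫ k′
·ᑫ-↠ p q = gmap (_·ᑫ _) ξ-ᵀˡ p ◅◅ gmap (_ ·ᑫ_) ξ-ᵀʳ q

ƛᵀ-↠ : ∀ {q q′ : Q n (suc m)} → q ↠ᑫ q′ → ƛᵀ q ↠ᵀ ƛᵀ q′
ƛᵀ-↠ = gmap ƛᵀ ξ-ƛ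

ƛᵂ-↠ : ∀ {t t′ : T (suc n) m} → t ↠ᵀ t′ → ƛᵂ t ↠ᵂ ƛᵂ t′
ƛᵂ-↠ = gmap ƛᵂ ξ-ƛ

ƛᴷ-↠ : ∀ {q q′ : Q (suc n) m} → q ↠ᑫ q′ → ƛᴷ q ↠ᴷ ƛᴷ q′
ƛᴷ-↠ = gmap ƛᴷ ξ-ƛ

β≡ : ∀ {t : T (suc n) m} {w t′} → subᵀ (w /0ᵂ) varᴷ t ≡ t′ → ƛᵂ t ·ᵀ w ⟶ᵀ t′
β≡ refl = β

βᵂ≡ : ∀ {q : Q (suc n) m} {w q′} → subᑫ (w /0ᵂ) varᴷ q ≡ q′ → ƛᴷ q ·ᴷ w ⟶ᑫ q′
βᵂ≡ refl = βᵂ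

βᴷ≡ : ∀ {q : Q n (suc m)} {k q′} → subᑫ varᵂ (k /0ᴷ) q ≡ q′ → ƛᵀ q ·ᑫ k ⟶ᑫ q′
βᴷ≡ refl = βᴷ

ηᵀ≡ : ∀ {t : T n m} {u} → u ≡ renᵀ id suc t → ƛᵀ (u ·ᑫ varᴷ zero) ⟶ᵀ t
ηᵀ≡ refl = η

ηᵂ≡ : ∀ {w : W n m} {v} → v ≡ renᵂ suc id w → ƛᵂ (v ·ᵀ varᵂ zero) ⟶ᵂ w
ηᵂ≡ refl = η

ηᴷ≡ : ∀ {k : K n m} {l} → l ≡ renᴷ suc id k → ƛᴷ (l ·ᴷ varᵂ zero) ⟶ᴷ k
ηᴷ≡ refl = η

/0ᵂ-∘ : ∀ (s : Fin n → W n′ m′) (c : Fin m → K n′ m′) w x →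
        subᵂ s c ((w /0ᵂ) x) ≡ subᵂ (subᵂ s c w /0ᵂ) varᴷ (extsᵂ s x)
/0ᵂ-∘ s c w zero    = refl
/0ᵂ-∘ s c w (suc x) = sym (subᵂ-renᵂ-id (λ _ → refl) (λ _ → refl) (s x))

/0ᴷ-∘ : ∀ (s : Fin n → W n′ m′) (c : Fin m → K n′ m′) k l →
        subᴷ s c ((k /0ᴷ) l) ≡ subᴷ varᵂ (subᴷ s c k /0ᴷ) (extsᴷ c l)
/0ᴷ-∘ s c k zero    = refl
/0ᴷ-∘ s c k (suc l) = sym (subᴷ-renᴷ-id (λ _ → refl) (λ _ → refl) (c l))

subᑫ-/0ᵂ : ∀ (s : Fin n → W n′ m′) (c : Fin m → K n′ m′) w q →
           subᑫ (subᵂ s c w /0ᵂ) varᴷ (subᑫ (extsᵂ s) (renᴷ suc id ∘ c) q) ≡ subᑫ s c (subᑫ (w /0ᵂ) varᴷ q)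
subᑫ-/0ᵂ s c w q = trans
  (subᑫ-subᑫ (λ x → sym (/0ᵂ-∘ s c w x)) (λ k → subᴷ-renᴷ-id (λ _ → refl) (λ _ → refl) (c k)) q)
  (sym (subᑫ-subᑫ (λ _ → refl) (λ _ → refl) q))

subᵀ-/0ᵂ : ∀ (s : Fin n → W n′ m′) (c : Fin m → K n′ m′) w t →
           subᵀ (subᵂ s c w /0ᵂ) varᴷ (subᵀ (extsᵂ s) (renᴷ suc id ∘ c) t) ≡ subᵀ s c (subᵀ (w /0ᵂ) varᴷ t)
subᵀ-/0ᵂ s c w t = trans
  (subᵀ-subᵀ (λ x → sym (/0ᵂ-∘ s c w x)) (λ k → subᴷ-renᴷ-id (λ _ → refl) (λ _ → refl) (c k)) t)
  (sym (subᵀ-subᵀ (λ _ → refl) (λ _ → refl) t))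

subᑫ-/0ᴷ : ∀ (s : Fin n → W n′ m′) (c : Fin m → K n′ m′) k q →
           subᑫ varᵂ (subᴷ s c k /0ᴷ) (subᑫ (renᵂ id suc ∘ s) (extsᴷ c) q) ≡ subᑫ s c (subᑫ varᵂ (k /0ᴷ) q)
subᑫ-/0ᴷ s c k q = trans
  (subᑫ-subᑫ (λ x → subᵂ-renᵂ-id (λ _ → refl) (λ _ → refl) (s x)) (λ l → sym (/0ᴷ-∘ s c k l)) q)
  (sym (subᑫ-subᑫ (λ _ → refl) (λ _ → refl) q))

mutual
  subᵀ-step : ∀ (s : Fin n → W n′ m′) (c : Fin m → K n′ m′) {t t′} → t ⟶ᵀ t′ → subᵀ s c t ⟶ᵀ subᵀ s c t′
  subᵀ-step s c (β {t} {w}) = β≡ (subᵀ-/0ᵂ s c w t)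
  subᵀ-step s c (η {t})     = ηᵀ≡ (wkᵏᵀ-subᵀ s c t)
  subᵀ-step s c (ξ-ƛ r)     = ξ-ƛ (subᑫ-step _ _ r)
  subᵀ-step s c (ξ-ˡ r)     = ξ-ˡ (subᵂ-step s c r)
  subᵀ-step s c (ξ-ʳ r)     = ξ-ʳ (subᵂ-step s c r)

  subᑫ-step : ∀ (s : Fin n → W n′ m′) (c : Fin m → K n′ m′) {q q′} → q ⟶ᑫ q′ → subᑫ s c q ⟶ᑫ subᑫ s c q′
  subᑫ-step s c (βᵂ {q} {w}) = βᵂ≡ (subᑫ-/0ᵂ s c w q)
  subᑫ-step s c (βᴷ {q} {k}) = βᴷ≡ (subᑫ-/0ᴷ s c k q)
  subᑫ-step s c (ξ-ᴷˡ r)     = ξ-ᴷˡ (subᴷ-step s c r)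
  subᑫ-step s c (ξ-ᴷʳ r)     = ξ-ᴷʳ (subᵂ-step s c r)
  subᑫ-step s c (ξ-ᵀˡ r)     = ξ-ᵀˡ (subᵀ-step s c r)
  subᑫ-step s c (ξ-ᵀʳ r)     = ξ-ᵀʳ (subᴷ-step s c r)

  subᵂ-step : ∀ (s : Fin n → W n′ m′) (c : Fin m → K n′ m′) {w w′} → w ⟶ᵂ w′ → subᵂ s c w ⟶ᵂ subᵂ s c w′
  subᵂ-step s c (η {w}) = ηᵂ≡ (wkᵂ-subᵂ s c w)
  subᵂ-step s c (ξ-ƛ r) = ξ-ƛ (subᵀ-step _ _ r)

  subᴷ-step : ∀ (s : Fin n → W n′ m′) (c : Fin m → K n′ m′) {k k′} → k ⟶ᴷ k′ → subᴷ s c k ⟶ᴷ subᴷ s c k′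
  subᴷ-step s c (η {k}) = ηᴷ≡ (wkᴷ-subᴷ s c k)
  subᴷ-step s c (ξ-ƛ r) = ξ-ƛ (subᑫ-step _ _ r)

renᵀ-step : ∀ (ρ : Fin n → Fin n′) (φ : Fin m → Fin m′) {t t′} → t ⟶ᵀ t′ → renᵀ ρ φ t ⟶ᵀ renᵀ ρ φ t′
renᵀ-step ρ φ {t} {t′} r = subst₂ _⟶ᵀ_ (subᵀ-var (λ _ → refl) (λ _ → refl) t) (subᵀ-var (λ _ → refl) (λ _ → refl) t′)
                                     (subᵀ-step (varᵂ ∘ ρ) (varᴷ ∘ φ) r)

renᵂ-step : ∀ (ρ : Fin n → Fin n′) (φ : Fin m → Fin m′) {w w′} → w ⟶ᵂ w′ → renᵂ ρ φ w ⟶ᵂ renᵂ ρ φ w′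
renᵂ-step ρ φ {w} {w′} r = subst₂ _⟶ᵂ_ (subᵂ-var (λ _ → refl) (λ _ → refl) w) (subᵂ-var (λ _ → refl) (λ _ → refl) w′)
                                     (subᵂ-step (varᵂ ∘ ρ) (varᴷ ∘ φ) r)

renᴷ-step : ∀ (ρ : Fin n → Fin n′) (φ : Fin m → Fin m′) {k k′} → k ⟶ᴷ k′ → renᴷ ρ φ k ⟶ᴷ renᴷ ρ φ k′
renᴷ-step ρ φ {k} {k′} r = subst₂ _⟶ᴷ_ (subᴷ-var (λ _ → refl) (λ _ → refl) k) (subᴷ-var (λ _ → refl) (λ _ → refl) k′)
                                     (subᴷ-step (varᵂ ∘ ρ) (varᴷ ∘ φ) r)

extsᵂ-↠ : ∀ {s s′ : Fin n → W n′ m} → (∀ x → s x ↠ᵂ s′ x) → ∀ x → extsᵂ s x ↠ᵂ extsᵂ s′ x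
extsᵂ-↠ r zero    = ε
extsᵂ-↠ r (suc x) = gmap (renᵂ suc id) (renᵂ-step suc id) (r x)

extsᴷ-↠ : ∀ {c c′ : Fin m → K n m′} → (∀ k → c k ↠ᴷ c′ k) → ∀ k → extsᴷ c k ↠ᴷ extsᴷ c′ k
extsᴷ-↠ r zero    = ε
extsᴷ-↠ r (suc k) = gmap (renᴷ id suc) (renᴷ-step id suc) (r k)

mutual
  subᵀ-↠ : ∀ {s s′ : Fin n → W n′ m′} {c c′ : Fin m → K n′ m′} →
           (∀ x → s x ↠ᵂ s′ x) → (∀ k → c k ↠ᴷ c′ k) → ∀ t → subᵀ s c t ↠ᵀ subᵀ s′ c′ t
  subᵀ-↠ r u (ƛᵀ q)   = ƛᵀ-↠ (subᑫ-↠ (λ x → gmap (renᵂ id suc) (renᵂ-step id suc) (r x)) (extsᴷ-↠ u) q)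
  subᵀ-↠ r u (v ·ᵀ w) = ·ᵀ-↠ (subᵂ-↠ r u v) (subᵂ-↠ r u w)

  subᑫ-↠ : ∀ {s s′ : Fin n → W n′ m′} {c c′ : Fin m → K n′ m′} →
           (∀ x → s x ↠ᵂ s′ x) → (∀ k → c k ↠ᴷ c′ k) → ∀ q → subᑫ s c q ↠ᑫ subᑫ s′ c′ q
  subᑫ-↠ r u (k ·ᴷ w) = ·ᴷ-↠ (subᴷ-↠ r u k) (subᵂ-↠ r u w)
  subᑫ-↠ r u (t ·ᑫ k) = ·ᑫ-↠ (subᵀ-↠ r u t) (subᴷ-↠ r u k)

  subᵂ-↠ : ∀ {s s′ : Fin n → W n′ m′} {c c′ : Fin m → K n′ m′} →
           (∀ x → s x ↠ᵂ s′ x) → (∀ k → c k ↠ᴷ c′ k) → ∀ w → subᵂ s c w ↠ᵂ subᵂ s′ c′ w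
  subᵂ-↠ r u (varᵂ x) = r x
  subᵂ-↠ r u (ƛᵂ t)   = ƛᵂ-↠ (subᵀ-↠ (extsᵂ-↠ r) (λ k → gmap (renᴷ suc id) (renᴷ-step suc id) (u k)) t)

  subᴷ-↠ : ∀ {s s′ : Fin n → W n′ m′} {c c′ : Fin m → K n′ m′} →
           (∀ x → s x ↠ᵂ s′ x) → (∀ k → c k ↠ᴷ c′ k) → ∀ k → subᴷ s c k ↠ᴷ subᴷ s′ c′ k
  subᴷ-↠ r u (varᴷ k) = u k
  subᴷ-↠ r u (ƛᴷ q)   = ƛᴷ-↠ (subᑫ-↠ (extsᵂ-↠ r) (λ k → gmap (renᴷ suc id) (renᴷ-step suc id) (u k)) q)

-- The contracted CPS translation

infixl 8 _∙_
infixl 5 _,ᴷ_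

_∙_ : K n m → W n m → Q n m
varᴷ k ∙ w = varᴷ k ·ᴷ w
ƛᴷ q   ∙ w = subᑫ (w /0ᵂ) varᴷ q

_,ᴷ_ : (Fin m → K n m′) → K n m′ → Fin (suc m) → K n m′
(κ ,ᴷ k) zero    = k
(κ ,ᴷ k) (suc l) = κ l

lamᵂ : (Fin n → W n′ m′) → Fin (suc n) → W (suc n′) (suc m′)
lamᵂ τ = renᵂ id suc ∘ extsᵂ τ

lamᴷ : (Fin m → K n′ m′) → Fin m → K (suc n′) (suc m′)
lamᴷ κ = renᴷ id suc ∘ renᴷ suc id ∘ κ

-- A variant of the CPS translation that interprets variables in environments
-- and contracts every redex λx.Q applied to a value, as well as (λk.⟨J⟩)K.
mutual
  ev : (Fin n → W n′ m′) → (Fin m → K n′ m′) → Term n m → K n′ m′ → Q n′ m′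
  ev τ κ (` x) k        = k ∙ evᵂ τ κ (` x) var
  ev τ κ (ƛ M) k        = k ∙ evᵂ τ κ (ƛ M) lam
  ev τ κ (M · N) k      = ev τ κ M (ƛᴷ (ev (renᵂ suc id ∘ τ) (renᴷ suc id ∘ κ) N
                            (ƛᴷ (varᵂ (suc zero) ·ᵀ varᵂ zero ·ᑫ renᴷ suc id (renᴷ suc id k)))))
  ev τ κ (L where≔ M) k = ev τ κ M (ƛᴷ (ev (extsᵂ τ) (renᴷ suc id ∘ κ) L (renᴷ suc id k)))
  ev τ κ (μ J) k        = evᴶ τ (κ ,ᴷ k) J

  evᴶ : (Fin n → W n′ m′) → (Fin m → K n′ m′) → Jump n m → Q n′ m′
  evᴶ τ κ ([ k ] M)     = ev τ κ M (κ k)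
  evᴶ τ κ (J where≔ᴶ M) = ev τ κ M (ƛᴷ (evᴶ (extsᵂ τ) (renᴷ suc id ∘ κ) J))

  evᵂ : (Fin n → W n′ m′) → (Fin m → K n′ m′) → (V : Term n m) → Value V → W n′ m′
  evᵂ τ κ (` x) var = τ x
  evᵂ τ κ (ƛ M) lam = ƛᵂ (ƛᵀ (ev (lamᵂ τ) (lamᴷ κ) M (varᴷ zero)))

⟦_⟧ᶜ : Term n m → T n m
⟦ M ⟧ᶜ = ƛᵀ (ev varᵂ (varᴷ ∘ suc) M (varᴷ zero))

ev-value : ∀ (τ : Fin n → W n′ m′) (κ : Fin m → K n′ m′) {V} (v : Value V) k → ev τ κ V k ≡ k ∙ evᵂ τ κ V v
ev-value τ κ var k = refl
ev-value τ κ lam k = refl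

-- `c` may only rename: an abstraction put for the head of `varᴷ k ·ᴷ w` would leave a redex on the
-- left that `_∙_` has contracted on the right.
∙-sub : ∀ {s : Fin n → W n′ m′} {c : Fin m → K n′ m′} {φ : Fin m → Fin m′} → (∀ k → c k ≡ varᴷ (φ k)) →
        ∀ k w → subᑫ s c (k ∙ w) ≡ subᴷ s c k ∙ subᵂ s c w
∙-sub f (varᴷ k) w rewrite f k = refl
∙-sub {s = s} {c} f (ƛᴷ q) w = sym (subᑫ-/0ᵂ s c w q)

mutual
  ev-sub : ∀ {s : Fin n′ → W n″ m″} {c : Fin m′ → K n″ m″} {φ : Fin m′ → Fin m″} {τ : Fin n → W n′ m′} {κ : Fin m → K n′ m′} {τ′ κ′ k k′} →
           (∀ l → c l ≡ varᴷ (φ l)) → (∀ x → subᵂ s c (τ x) ≡ τ′ x) → (∀ l → subᴷ s c (κ l) ≡ κ′ l) →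
           subᴷ s c k ≡ k′ → ∀ M → subᑫ s c (ev τ κ M k) ≡ ev τ′ κ′ M k′
  ev-sub {s = s} {c} {τ = τ} {k = k} f e g refl (` x) = trans (∙-sub f k (τ x)) (cong (subᴷ s c k ∙_) (e x))
  ev-sub {s = s} {c} {τ = τ} {κ} {k = k} f e g refl (ƛ M) =
    trans (∙-sub f k _) (cong (subᴷ s c k ∙_) (evᵂ-sub {τ = τ} {κ} f e g (lam {M = M})))
  ev-sub {s = s} {c} {τ = τ} {κ} {k = k} f e g refl (M · N) =
    ev-sub f e g (cong ƛᴷ (ev-sub (cong (renᴷ suc id) ∘ f)
      (λ x → trans (wkᵂ-subᵂ s c (τ x)) (cong (renᵂ suc id) (e x)))
      (λ l → trans (wkᴷ-subᴷ s c (κ l)) (cong (renᴷ suc id) (g l)))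
      (cong (λ z → ƛᴷ (varᵂ (suc zero) ·ᵀ varᵂ zero ·ᑫ z))
        (trans (wkᴷ-subᴷ _ _ (renᴷ suc id k)) (cong (renᴷ suc id) (wkᴷ-subᴷ s c k)))) N)) M
  ev-sub {s = s} {c} {τ = τ} {κ} {k = k} f e g refl (L where≔ M) =
    ev-sub f e g (cong ƛᴷ (ev-sub (cong (renᴷ suc id) ∘ f) (sub-extsᵂ e)
      (λ l → trans (wkᴷ-subᴷ s c (κ l)) (cong (renᴷ suc id) (g l))) (wkᴷ-subᴷ s c k) L)) M
  ev-sub f e g refl (μ J) = evᴶ-sub f e (λ { zero → refl ; (suc l) → g l }) J

  evᴶ-sub : ∀ {s : Fin n′ → W n″ m″} {c : Fin m′ → K n″ m″} {φ : Fin m′ → Fin m″} {τ : Fin n → W n′ m′} {κ : Fin m → K n′ m′} {τ′ κ′} →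
            (∀ l → c l ≡ varᴷ (φ l)) → (∀ x → subᵂ s c (τ x) ≡ τ′ x) → (∀ l → subᴷ s c (κ l) ≡ κ′ l) →
            ∀ J → subᑫ s c (evᴶ τ κ J) ≡ evᴶ τ′ κ′ J
  evᴶ-sub f e g ([ k ] M) = ev-sub f e g (g k) M
  evᴶ-sub {s = s} {c} {κ = κ} f e g (J where≔ᴶ M) =
    ev-sub f e g (cong ƛᴷ (evᴶ-sub (cong (renᴷ suc id) ∘ f) (sub-extsᵂ e)
      (λ l → trans (wkᴷ-subᴷ s c (κ l)) (cong (renᴷ suc id) (g l))) J)) M

  evᵂ-sub : ∀ {s : Fin n′ → W n″ m″} {c : Fin m′ → K n″ m″} {φ : Fin m′ → Fin m″} {τ : Fin n → W n′ m′} {κ : Fin m → K n′ m′} {τ′ κ′} →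
            (∀ l → c l ≡ varᴷ (φ l)) → (∀ x → subᵂ s c (τ x) ≡ τ′ x) → (∀ l → subᴷ s c (κ l) ≡ κ′ l) →
            ∀ {V} (v : Value V) → subᵂ s c (evᵂ τ κ V v) ≡ evᵂ τ′ κ′ V v
  evᵂ-sub f e g (var {x}) = e x
  evᵂ-sub {s = s} {c} {τ = τ} {κ} f e g (lam {M}) =
    cong (λ q → ƛᵂ (ƛᵀ q)) (ev-sub (extsᴷ-var (cong (renᴷ suc id) ∘ f))
      (λ x → trans (wkᵏᵂ-subᵂ _ _ (extsᵂ τ x)) (cong (renᵂ id suc) (sub-extsᵂ e x)))
      (λ l → trans (wkᵏᴷ-subᴷ _ _ (renᴷ suc id (κ l)))
                   (cong (renᴷ id suc) (trans (wkᴷ-subᴷ s c (κ l)) (cong (renᴷ suc id) (g l)))))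
      refl M)

subᑫ-id : (q : Q n m) → subᑫ varᵂ varᴷ q ≡ q
subᑫ-id q = trans (subᑫ-var {ρ = id} {φ = id} (λ _ → refl) (λ _ → refl) q) (renᑫ-id (λ _ → refl) (λ _ → refl) q)

subᵂ-id : (w : W n m) → subᵂ varᵂ varᴷ w ≡ w
subᵂ-id w = trans (subᵂ-var {ρ = id} {φ = id} (λ _ → refl) (λ _ → refl) w) (renᵂ-id (λ _ → refl) (λ _ → refl) w)

subᴷ-id : (k : K n m) → subᴷ varᵂ varᴷ k ≡ k
subᴷ-id k = trans (subᴷ-var {ρ = id} {φ = id} (λ _ → refl) (λ _ → refl) k) (renᴷ-id (λ _ → refl) (λ _ → refl) k)

-- Environments are functions, so pointwise equal ones are not interchangeable by `cong`. The
-- hypotheses of `ev-sub` are pointwise, and at the identity substitution it gives the exchange.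
ev-cong : ∀ {τ τ′ : Fin n → W n′ m′} {κ κ′ : Fin m → K n′ m′} {k k′} →
          (∀ x → τ x ≡ τ′ x) → (∀ l → κ l ≡ κ′ l) → k ≡ k′ → ∀ M → ev τ κ M k ≡ ev τ′ κ′ M k′
ev-cong {τ = τ} {κ = κ} {k = k} e g h M = trans (sym (subᑫ-id (ev τ κ M k)))
  (ev-sub {φ = id} (λ _ → refl) (λ x → trans (subᵂ-id (τ x)) (e x)) (λ l → trans (subᴷ-id (κ l)) (g l))
    (trans (subᴷ-id k) h) M)

evᴶ-cong : ∀ {τ τ′ : Fin n → W n′ m′} {κ κ′ : Fin m → K n′ m′} →
           (∀ x → τ x ≡ τ′ x) → (∀ l → κ l ≡ κ′ l) → ∀ J → evᴶ τ κ J ≡ evᴶ τ′ κ′ J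
evᴶ-cong {τ = τ} {κ = κ} e g J = trans (sym (subᑫ-id (evᴶ τ κ J)))
  (evᴶ-sub {φ = id} (λ _ → refl) (λ x → trans (subᵂ-id (τ x)) (e x)) (λ l → trans (subᴷ-id (κ l)) (g l)) J)

ren-ev : ∀ (ρ : Fin n′ → Fin n″) (φ : Fin m′ → Fin m″) (τ : Fin n → W n′ m′) (κ : Fin m → K n′ m′) M k →
         renᑫ ρ φ (ev τ κ M k) ≡ ev (renᵂ ρ φ ∘ τ) (renᴷ ρ φ ∘ κ) M (renᴷ ρ φ k)
ren-ev ρ φ τ κ M k = trans (sym (subᑫ-var (λ _ → refl) (λ _ → refl) (ev τ κ M k)))
  (ev-sub {s = varᵂ ∘ ρ} {c = varᴷ ∘ φ} (λ _ → refl)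
    (λ x → subᵂ-var (λ _ → refl) (λ _ → refl) (τ x)) (λ l → subᴷ-var (λ _ → refl) (λ _ → refl) (κ l))
    (subᴷ-var (λ _ → refl) (λ _ → refl) k) M)

ren-evᴶ : ∀ (ρ : Fin n′ → Fin n″) (φ : Fin m′ → Fin m″) (τ : Fin n → W n′ m′) (κ : Fin m → K n′ m′) J →
          renᑫ ρ φ (evᴶ τ κ J) ≡ evᴶ (renᵂ ρ φ ∘ τ) (renᴷ ρ φ ∘ κ) J
ren-evᴶ ρ φ τ κ J = trans (sym (subᑫ-var (λ _ → refl) (λ _ → refl) (evᴶ τ κ J)))
  (evᴶ-sub {s = varᵂ ∘ ρ} {c = varᴷ ∘ φ} (λ _ → refl)
    (λ x → subᵂ-var (λ _ → refl) (λ _ → refl) (τ x)) (λ l → subᴷ-var (λ _ → refl) (λ _ → refl) (κ l)) J)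

ren-evᵂ : ∀ (ρ : Fin n′ → Fin n″) (φ : Fin m′ → Fin m″) (τ : Fin n → W n′ m′) (κ : Fin m → K n′ m′) {V} (v : Value V) →
          renᵂ ρ φ (evᵂ τ κ V v) ≡ evᵂ (renᵂ ρ φ ∘ τ) (renᴷ ρ φ ∘ κ) V v
ren-evᵂ ρ φ τ κ v = trans (sym (subᵂ-var (λ _ → refl) (λ _ → refl) (evᵂ τ κ _ v)))
  (evᵂ-sub {s = varᵂ ∘ ρ} {c = varᴷ ∘ φ} (λ _ → refl)
    (λ x → subᵂ-var (λ _ → refl) (λ _ → refl) (τ x)) (λ l → subᴷ-var (λ _ → refl) (λ _ → refl) (κ l)) v)

renV : ∀ {ρ : Fin n → Fin n′} {θ : Fin m → Fin m′} {V} → Value V → Value (ren ρ θ V)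
renV var = var
renV lam = lam

mutual
  ev-ren : ∀ {ρ : Fin n → Fin n′} {θ : Fin m → Fin m′} {τ : Fin n′ → W n″ m″} {κ : Fin m′ → K n″ m″} {τ′ κ′} →
           (∀ x → τ (ρ x) ≡ τ′ x) → (∀ l → κ (θ l) ≡ κ′ l) →
           ∀ M k → ev τ κ (ren ρ θ M) k ≡ ev τ′ κ′ M k
  ev-ren e g (` x) k        = cong (k ∙_) (e x)
  ev-ren {τ = τ} {κ} e g (ƛ M) k = cong (k ∙_) (evᵂ-ren {τ = τ} {κ} e g (lam {M = M}))
  ev-ren e g (M · N) k      = trans (ev-ren e g M _)
    (ev-cong (λ _ → refl) (λ _ → refl) (cong ƛᴷ (ev-ren (cong (renᵂ suc id) ∘ e) (cong (renᴷ suc id) ∘ g) N _)) M)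
  ev-ren e g (L where≔ M) k = trans (ev-ren e g M _)
    (ev-cong (λ _ → refl) (λ _ → refl) (cong ƛᴷ (ev-ren (extsᵂ-ren e) (cong (renᴷ suc id) ∘ g) L _)) M)
  ev-ren e g (μ J) k        = evᴶ-ren e (λ { zero → refl ; (suc l) → g l }) J

  evᴶ-ren : ∀ {ρ : Fin n → Fin n′} {θ : Fin m → Fin m′} {τ : Fin n′ → W n″ m″} {κ : Fin m′ → K n″ m″} {τ′ κ′} →
            (∀ x → τ (ρ x) ≡ τ′ x) → (∀ l → κ (θ l) ≡ κ′ l) →
            ∀ J → evᴶ τ κ (renᴶ ρ θ J) ≡ evᴶ τ′ κ′ J
  evᴶ-ren e g ([ k ] M)     = trans (ev-ren e g M _) (ev-cong (λ _ → refl) (λ _ → refl) (g k) M)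
  evᴶ-ren e g (J where≔ᴶ M) = trans (ev-ren e g M _)
    (ev-cong (λ _ → refl) (λ _ → refl) (cong ƛᴷ (evᴶ-ren (extsᵂ-ren e) (cong (renᴷ suc id) ∘ g) J)) M)

  evᵂ-ren : ∀ {ρ : Fin n → Fin n′} {θ : Fin m → Fin m′} {τ : Fin n′ → W n″ m″} {κ : Fin m′ → K n″ m″} {τ′ κ′} →
            (∀ x → τ (ρ x) ≡ τ′ x) → (∀ l → κ (θ l) ≡ κ′ l) →
            ∀ {V} (v : Value V) → evᵂ τ κ (ren ρ θ V) (renV v) ≡ evᵂ τ′ κ′ V v
  evᵂ-ren e g (var {x}) = e x
  evᵂ-ren e g (lam {M}) = cong (λ q → ƛᵂ (ƛᵀ q))
    (ev-ren (cong (renᵂ id suc) ∘ extsᵂ-ren e) (cong (renᴷ id suc ∘ renᴷ suc id) ∘ g) M (varᴷ zero))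

extsV : ∀ {s : Fin n → Term n′ m} → (∀ x → Value (s x)) → ∀ x → Value (exts s x)
extsV v zero    = var
extsV v (suc x) = renV (v x)

mutual
  -- The substituted terms are values, hence have a translation `evᵂ` that an environment can hold.
  -- Substitution in the source thus becomes a change of environment, which makes `β-where` an
  -- identity for `ev`.
  ev-subst : ∀ {s : Fin n → Term n′ m} (v : ∀ x → Value (s x)) {τ : Fin n′ → W n″ m″} {κ : Fin m → K n″ m″} {τ′} →
             (∀ x → evᵂ τ κ (s x) (v x) ≡ τ′ x) → ∀ M k → ev τ κ (sub s M) k ≡ ev τ′ κ M k
  ev-subst v e (` x) k = trans (ev-value _ _ (v x) k) (cong (k ∙_) (e x))
  ev-subst v {τ} {κ} {τ′} e (ƛ M) k = cong (λ q → k ∙ ƛᵂ (ƛᵀ q))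
    (ev-subst (extsV v) (λ x → trans (h x) (cong (renᵂ id suc) (evᵂ-exts v e x))) M (varᴷ zero))
    where
    h : ∀ x → evᵂ (lamᵂ τ) (lamᴷ κ) _ (extsV v x) ≡ renᵂ id suc (evᵂ (extsᵂ τ) (renᴷ suc id ∘ κ) _ (extsV v x))
    h x = sym (ren-evᵂ id suc (extsᵂ τ) (renᴷ suc id ∘ κ) (extsV v x))
  ev-subst v {τ} {κ} e (M · N) k = trans (ev-subst v e M _)
    (ev-cong (λ _ → refl) (λ _ → refl) (cong ƛᴷ (ev-subst v
      (λ x → trans (sym (ren-evᵂ suc id τ κ (v x))) (cong (renᵂ suc id) (e x))) N _)) M)
  ev-subst v e (L where≔ M) k = trans (ev-subst v e M _)
    (ev-cong (λ _ → refl) (λ _ → refl) (cong ƛᴷ (ev-subst (extsV v) (evᵂ-exts v e) L _)) M)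
  ev-subst v e (μ J) k = evᴶ-subst (renV ∘ v) (λ x → trans (evᵂ-ren (λ _ → refl) (λ _ → refl) (v x)) (e x)) J

  evᴶ-subst : ∀ {s : Fin n → Term n′ m} (v : ∀ x → Value (s x)) {τ : Fin n′ → W n″ m″} {κ : Fin m → K n″ m″} {τ′} →
              (∀ x → evᵂ τ κ (s x) (v x) ≡ τ′ x) → ∀ J → evᴶ τ κ (subᴶ s J) ≡ evᴶ τ′ κ J
  evᴶ-subst v e ([ k ] M)     = ev-subst v e M _
  evᴶ-subst v e (J where≔ᴶ M) = trans (ev-subst v e M _)
    (ev-cong (λ _ → refl) (λ _ → refl) (cong ƛᴷ (evᴶ-subst (extsV v) (evᵂ-exts v e) J)) M)

  evᵂ-exts : ∀ {s : Fin n → Term n′ m} (v : ∀ x → Value (s x)) {τ : Fin n′ → W n″ m″} {κ : Fin m → K n″ m″} {τ′} →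
             (∀ x → evᵂ τ κ (s x) (v x) ≡ τ′ x) →
             ∀ x → evᵂ (extsᵂ τ) (renᴷ suc id ∘ κ) (exts s x) (extsV v x) ≡ extsᵂ τ′ x
  evᵂ-exts v e zero = refl
  evᵂ-exts v {τ} {κ} e (suc x) = trans (evᵂ-ren (λ _ → refl) (λ _ → refl) (v x))
    (trans (sym (ren-evᵂ suc id τ κ (v x))) (cong (renᵂ suc id) (e x)))

·⇒∙ : ∀ (k : K n m) w → k ·ᴷ w ↠ᑫ k ∙ w
·⇒∙ (varᴷ k) w = ε
·⇒∙ (ƛᴷ q)   w = return βᵂ

∙-stepˡ : ∀ {k k′ : K n m} w → k ⟶ᴷ k′ → k ∙ w ↠ᑫ k′ ∙ w
∙-stepˡ w (η {k}) = ≡⇒↠ᑫ (cong (_·ᴷ w) (subᴷ-renᴷ-id (λ _ → refl) (λ _ → refl) k)) ◅◅ ·⇒∙ k w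
∙-stepˡ w (ξ-ƛ r) = return (subᑫ-step _ _ r)

∙-↠ˡ : ∀ {k k′ : K n m} w → k ↠ᴷ k′ → k ∙ w ↠ᑫ k′ ∙ w
∙-↠ˡ w ε       = ε
∙-↠ˡ w (r ◅ s) = ∙-stepˡ w r ◅◅ ∙-↠ˡ w s

∙-↠ʳ : ∀ (k : K n m) {w w′} → w ↠ᵂ w′ → k ∙ w ↠ᑫ k ∙ w′
∙-↠ʳ (varᴷ k) r = ·ᴷ-↠ ε r
∙-↠ʳ (ƛᴷ q)   r = subᑫ-↠ (λ { zero → r ; (suc x) → ε }) (λ _ → ε) q

∙-↠ : ∀ {k k′ : K n m} {w w′} → k ↠ᴷ k′ → w ↠ᵂ w′ → k ∙ w ↠ᑫ k′ ∙ w′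
∙-↠ {k′ = k′} {w = w} r s = ∙-↠ˡ w r ◅◅ ∙-↠ʳ k′ s

sub-∙-↠ : ∀ (s : Fin n → W n′ m′) (c : Fin m → K n′ m′) k w → subᑫ s c (k ∙ w) ↠ᑫ subᴷ s c k ∙ subᵂ s c w
sub-∙-↠ s c (varᴷ k) w = ·⇒∙ (c k) (subᵂ s c w)
sub-∙-↠ s c (ƛᴷ q)   w = ≡⇒↠ᑫ (sym (subᑫ-/0ᵂ s c w q))

wk-↠ᴷ : ∀ {s : Fin n → W n′ m′} {c : Fin m → K n′ m′} k {k′} → subᴷ s c k ↠ᴷ k′ →
        subᴷ (extsᵂ s) (renᴷ suc id ∘ c) (renᴷ suc id k) ↠ᴷ renᴷ suc id k′
wk-↠ᴷ {s = s} {c} k r = subst (_↠ᴷ _) (sym (wkᴷ-subᴷ s c k)) (gmap (renᴷ suc id) (renᴷ-step suc id) r)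

wkᵏ-↠ᴷ : ∀ {s : Fin n → W n′ m′} {c : Fin m → K n′ m′} k {k′} → subᴷ s c k ↠ᴷ k′ →
         subᴷ (renᵂ id suc ∘ s) (extsᴷ c) (renᴷ id suc k) ↠ᴷ renᴷ id suc k′
wkᵏ-↠ᴷ {s = s} {c} k r = subst (_↠ᴷ _) (sym (wkᵏᴷ-subᴷ s c k)) (gmap (renᴷ id suc) (renᴷ-step id suc) r)

-- Substituting λ-abstractions for continuation variables creates redexes that
-- ev would have contracted, so here ev commutes with substitution only up to ↠ᑫ.
mutual
  ev-sub-↠ : ∀ {s : Fin n′ → W n″ m″} {c : Fin m′ → K n″ m″} {τ : Fin n → W n′ m′} {κ : Fin m → K n′ m′} {τ′ κ′ k k′} →
             (∀ x → subᵂ s c (τ x) ≡ τ′ x) → (∀ l → subᴷ s c (κ l) ↠ᴷ κ′ l) →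
             subᴷ s c k ↠ᴷ k′ → ∀ M → subᑫ s c (ev τ κ M k) ↠ᑫ ev τ′ κ′ M k′
  ev-sub-↠ {s = s} {c} {τ} {k = k} e g h (` x) =
    sub-∙-↠ s c k (τ x) ◅◅ ≡⇒↠ᑫ (cong (subᴷ s c k ∙_) (e x)) ◅◅ ∙-↠ h ε
  ev-sub-↠ {s = s} {c} {τ} {κ} {k = k} e g h (ƛ M) =
    sub-∙-↠ s c k _ ◅◅ ∙-↠ h (ƛᵂ-↠ (ƛᵀ-↠ (ev-sub-↠
      (λ x → trans (wkᵏᵂ-subᵂ _ _ (extsᵂ τ x)) (cong (renᵂ id suc) (sub-extsᵂ e x)))
      (λ l → wkᵏ-↠ᴷ (renᴷ suc id (κ l)) (wk-↠ᴷ (κ l) (g l))) ε M)))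
  ev-sub-↠ {s = s} {c} {τ} {κ} {k = k} e g h (M · N) =
    ev-sub-↠ e g (ƛᴷ-↠ (ev-sub-↠
      (λ x → trans (wkᵂ-subᵂ s c (τ x)) (cong (renᵂ suc id) (e x)))
      (λ l → wk-↠ᴷ (κ l) (g l)) (ƛᴷ-↠ (·ᑫ-↠ ε (wk-↠ᴷ (renᴷ suc id k) (wk-↠ᴷ k h)))) N)) M
  ev-sub-↠ {κ = κ} {k = k} e g h (L where≔ M) =
    ev-sub-↠ e g (ƛᴷ-↠ (ev-sub-↠ (sub-extsᵂ e) (λ l → wk-↠ᴷ (κ l) (g l)) (wk-↠ᴷ k h) L)) M
  ev-sub-↠ e g h (μ J) = evᴶ-sub-↠ e (λ { zero → h ; (suc l) → g l }) J

  evᴶ-sub-↠ : ∀ {s : Fin n′ → W n″ m″} {c : Fin m′ → K n″ m″} {τ : Fin n → W n′ m′} {κ : Fin m → K n′ m′} {τ′ κ′} →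
              (∀ x → subᵂ s c (τ x) ≡ τ′ x) → (∀ l → subᴷ s c (κ l) ↠ᴷ κ′ l) →
              ∀ J → subᑫ s c (evᴶ τ κ J) ↠ᑫ evᴶ τ′ κ′ J
  evᴶ-sub-↠ e g ([ k ] M) = ev-sub-↠ e g (g k) M
  evᴶ-sub-↠ {κ = κ} e g (J where≔ᴶ M) =
    ev-sub-↠ e g (ƛᴷ-↠ (evᴶ-sub-↠ (sub-extsᵂ e) (λ l → wk-↠ᴷ (κ l) (g l)) J)) M

-- Through μ a term may use its continuation any number of times, so one step of `k` can become
-- several or none. `ev-sub-↠` already asks only for reductions between continuations; the identity
-- substitution suffices.
ev-↠ : ∀ (τ : Fin n → W n′ m′) (κ : Fin m → K n′ m′) M {k k′} → k ↠ᴷ k′ → ev τ κ M k ↠ᑫ ev τ κ M k′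
ev-↠ τ κ M {k} {k′} r = subst (_↠ᑫ ev τ κ M k′) (subᑫ-id (ev τ κ M k))
  (ev-sub-↠ (subᵂ-id ∘ τ) (λ l → subst (_↠ᴷ κ l) (sym (subᴷ-id (κ l))) ε) (subst (_↠ᴷ _) (sym (subᴷ-id k)) r) M)

_,ᵂ_ : (Fin n → W n′ m′) → W n′ m′ → Fin (suc n) → W n′ m′
(τ ,ᵂ w) zero    = w
(τ ,ᵂ w) (suc x) = τ x

-- `ev` has a single clause for application. This lemma and `ev-·ᵛ` recover from it the special
-- clauses of `cps` in which one or both subterms are values.
ev-·ˡ : ∀ (τ : Fin n → W n′ m′) (κ : Fin m → K n′ m′) {V} (v : Value V) N k →
        ev τ κ (V · N) k ≡ ev τ κ N (ƛᴷ (renᵂ suc id (evᵂ τ κ V v) ·ᵀ varᵂ zero ·ᑫ renᴷ suc id k))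
ev-·ˡ τ κ v N k = trans (ev-value τ κ v _)
  (ev-sub {φ = id} (λ _ → refl) (λ x → subᵂ-renᵂ-id (λ _ → refl) (λ _ → refl) (τ x))
    (λ l → subᴷ-renᴷ-id (λ _ → refl) (λ _ → refl) (κ l))
    (cong (λ z → ƛᴷ (_ ·ᵀ _ ·ᑫ z)) (trans (wkᴷ-subᴷ _ _ (renᴷ suc id k))
      (cong (renᴷ suc id) (subᴷ-renᴷ-id (λ _ → refl) (λ _ → refl) k)))) N)

ev-·ᵛ : ∀ (τ : Fin n → W n′ m′) (κ : Fin m → K n′ m′) {V U} (v : Value V) (u : Value U) k →
        ev τ κ (V · U) k ≡ evᵂ τ κ V v ·ᵀ evᵂ τ κ U u ·ᑫ k
ev-·ᵛ τ κ {U = U} v u k = trans (ev-·ˡ τ κ v U k) (trans (ev-value τ κ u _)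
  (cong₂ (λ a b → a ·ᵀ _ ·ᑫ b) (subᵂ-renᵂ-id (λ _ → refl) (λ _ → refl) (evᵂ τ κ _ v))
                                (subᴷ-renᴷ-id (λ _ → refl) (λ _ → refl) k)))

ev-where : ∀ (τ : Fin n → W n′ m′) (κ : Fin m → K n′ m′) L {V} (v : Value V) k →
           ev τ κ (L where≔ V) k ≡ ev (τ ,ᵂ evᵂ τ κ V v) κ L k
ev-where τ κ L v k = trans (ev-value τ κ v _)
  (ev-sub {φ = id} (λ _ → refl) (λ { zero → refl ; (suc x) → subᵂ-renᵂ-id (λ _ → refl) (λ _ → refl) (τ x) })
    (λ l → subᴷ-renᴷ-id (λ _ → refl) (λ _ → refl) (κ l)) (subᴷ-renᴷ-id (λ _ → refl) (λ _ → refl) k) L)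

-- `κ′` differs from `κ` only at `k`, where the context `(P where x := □)` is put in front of the
-- old continuation. Context substitution is thus a change of environment too, and `β-μ` becomes an
-- identity.
record PlugEnv (k : Fin m) (P : Term (suc n) m) (τ : Fin n → W n′ m′) (κ κ′ : Fin m → K n′ m′) : Set where
  constructor plugEnv
  field
    at-k      : κ′ k ≡ ƛᴷ (ev (extsᵂ τ) (renᴷ suc id ∘ κ) P (renᴷ suc id (κ k)))
    elsewhere : ∀ j → ¬ k ≡ j → κ′ j ≡ κ j

PlugEnv-renᵗ : ∀ (ρ : Fin n′ → Fin n″) (φ : Fin m′ → Fin m″) {k : Fin m} {P : Term (suc n) m} {τ κ κ′} →
               PlugEnv k P τ κ κ′ → PlugEnv k P (renᵂ ρ φ ∘ τ) (renᴷ ρ φ ∘ κ) (renᴷ ρ φ ∘ κ′)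
PlugEnv-renᵗ ρ φ {k} {P} {τ} {κ} (plugEnv a b) = plugEnv
  (trans (cong (renᴷ ρ φ) a) (cong ƛᴷ (trans (ren-ev (lift 1 ρ) φ _ _ P _)
    (ev-cong (ren-extsᵂ (λ _ → refl)) (λ l → wkᴷ-renᴷ ρ φ (κ l)) (wkᴷ-renᴷ ρ φ (κ k)) P))))
  (λ j p → cong (renᴷ ρ φ) (b j p))

PlugEnv-exts : ∀ {k : Fin m} {P : Term (suc n) m} {τ : Fin n → W n′ m′} {κ κ′} → PlugEnv k P τ κ κ′ →
               PlugEnv k (ren (lift 1 suc) id P) (extsᵂ τ) (renᴷ suc id ∘ κ) (renᴷ suc id ∘ κ′)
PlugEnv-exts {P = P} {τ} e with PlugEnv-renᵗ suc id e
... | plugEnv a b = plugEnv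
  (trans a (cong ƛᴷ (sym (ev-ren {τ = extsᵂ (extsᵂ τ)} (extsᵂ-ren {s = extsᵂ τ} {ρ = suc} (λ _ → refl)) (λ _ → refl) P _)))) b

mutual
  ev-plug : ∀ {k : Fin m} {P : Term (suc n) m} {τ : Fin n → W n′ m′} {κ κ′} → PlugEnv k P τ κ κ′ →
            ∀ M l → ev τ κ (plug k P M) l ≡ ev τ κ′ M l
  ev-plug e (` x) l = refl
  ev-plug e (ƛ M) l = cong (λ q → l ∙ ƛᵂ (ƛᵀ q)) (ev-plug (PlugEnv-renᵗ id suc (PlugEnv-exts e)) M (varᴷ zero))
  ev-plug e (M · N) l = trans (ev-plug e M _)
    (ev-cong (λ _ → refl) (λ _ → refl) (cong ƛᴷ (ev-plug (PlugEnv-renᵗ suc id e) N _)) M)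
  ev-plug e (L where≔ M) l = trans (ev-plug e M _)
    (ev-cong (λ _ → refl) (λ _ → refl) (cong ƛᴷ (ev-plug (PlugEnv-exts e) L _)) M)
  ev-plug {P = P} (plugEnv a b) (μ J) l = evᴶ-plug (plugEnv
    (trans a (cong ƛᴷ (sym (ev-ren (λ { zero → refl ; (suc _) → refl }) (λ _ → refl) P _))))
    (λ { zero _ → refl ; (suc j) p → b j (p ∘ cong suc) })) J

  evᴶ-plug : ∀ {k : Fin m} {P : Term (suc n) m} {τ : Fin n → W n′ m′} {κ κ′} → PlugEnv k P τ κ κ′ →
             ∀ J → evᴶ τ κ (plugᴶ k P J) ≡ evᴶ τ κ′ J
  evᴶ-plug {k = k} e ([ j ] M) with k ≟ j
  ... | yes refl = trans (ev-plug e M _) (ev-cong (λ _ → refl) (λ _ → refl) (sym (PlugEnv.at-k e)) M)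
  ... | no  k≢j  = trans (ev-plug e M _) (ev-cong (λ _ → refl) (λ _ → refl) (sym (PlugEnv.elsewhere e j k≢j)) M)
  evᴶ-plug e (J where≔ᴶ M) = trans (ev-plug e M _)
    (ev-cong (λ _ → refl) (λ _ → refl) (cong ƛᴷ (evᴶ-plug (PlugEnv-exts e) J)) M)

-- Invariance of the contracted translation under ≈ and simulation of source steps.

mutual
  -- The equations only rearrange bindings, and a binding is translated by nesting continuations,
  -- which is the same nesting on both sides. For E2 this relies on `k` being stored in the
  -- environment instead of forming `(λk.⟨J⟩)K`.
  ev-≈ : ∀ (τ : Fin n → W n′ m′) (κ : Fin m → K n′ m′) {M M′} → M ≈ M′ → ∀ k → ev τ κ M k ≡ ev τ κ M′ k
  ev-≈ τ κ (E1 L M N) k = ev-cong (λ _ → refl) (λ _ → refl) (cong ƛᴷ (ev-cong (λ _ → refl) (λ _ → refl)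
    (cong ƛᴷ (trans (ren-ev (lift 1 suc) id (extsᵂ τ) (renᴷ suc id ∘ κ) L (renᴷ suc id k))
      (trans (ev-cong {τ′ = λ x → extsᵂ (extsᵂ τ) (lift 1 suc x)} (λ { zero → refl ; (suc x) → wkᵂ-renᵂ suc id (τ x) })
                (λ l → wkᴷ-renᴷ suc id (κ l)) (wkᴷ-renᴷ suc id k) L)
             (sym (ev-ren (λ _ → refl) (λ _ → refl) L _))))) M)) N
  ev-≈ τ κ (E2 J M) k = sym (trans (ev-ren (λ _ → refl) (λ _ → refl) M _)
    (ev-cong (λ _ → refl) (λ _ → refl) (cong ƛᴷ (evᴶ-cong (λ _ → refl) (λ { zero → refl ; (suc l) → refl }) J)) M))
  ev-≈ τ κ ≈-refl k = refl
  ev-≈ τ κ (≈-sym e) k = sym (ev-≈ τ κ e k)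
  ev-≈ τ κ (≈-trans e f) k = trans (ev-≈ τ κ e k) (ev-≈ τ κ f k)
  ev-≈ τ κ (ƛ-cong e) k = cong (λ q → k ∙ ƛᵂ (ƛᵀ q)) (ev-≈ _ _ e _)
  ev-≈ τ κ (·-cong {M} {N = N} e f) k =
    trans (ev-cong (λ _ → refl) (λ _ → refl) (cong ƛᴷ (ev-≈ _ _ f _)) M) (ev-≈ τ κ e _)
  ev-≈ τ κ (where-cong {M = M} e f) k =
    trans (ev-cong (λ _ → refl) (λ _ → refl) (cong ƛᴷ (ev-≈ _ _ e _)) M) (ev-≈ τ κ f _)
  ev-≈ τ κ (μ-cong e) k = evᴶ-≈ τ _ e

  evᴶ-≈ : ∀ (τ : Fin n → W n′ m′) (κ : Fin m → K n′ m′) {J J′} → J ≈ᴶ J′ → evᴶ τ κ J ≡ evᴶ τ κ J′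
  evᴶ-≈ τ κ (E1ᴶ L M N) = ev-cong (λ _ → refl) (λ _ → refl) (cong ƛᴷ (ev-cong (λ _ → refl) (λ _ → refl)
    (cong ƛᴷ (trans (ren-evᴶ (lift 1 suc) id (extsᵂ τ) (renᴷ suc id ∘ κ) L)
      (trans (evᴶ-cong {τ′ = λ x → extsᵂ (extsᵂ τ) (lift 1 suc x)} (λ { zero → refl ; (suc x) → wkᵂ-renᵂ suc id (τ x) })
                (λ l → wkᴷ-renᴷ suc id (κ l)) L)
             (sym (evᴶ-ren (λ _ → refl) (λ _ → refl) L))))) M)) N
  evᴶ-≈ τ κ (E3 k L M) = refl
  evᴶ-≈ τ κ ≈ᴶ-refl = refl
  evᴶ-≈ τ κ (≈ᴶ-sym e) = sym (evᴶ-≈ τ κ e)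
  evᴶ-≈ τ κ (≈ᴶ-trans e f) = trans (evᴶ-≈ τ κ e) (evᴶ-≈ τ κ f)
  evᴶ-≈ τ κ ([]-cong e) = ev-≈ τ κ e _
  evᴶ-≈ τ κ (whereᴶ-cong {M = M} e f) =
    trans (ev-cong (λ _ → refl) (λ _ → refl) (cong ƛᴷ (evᴶ-≈ _ _ e)) M) (ev-≈ τ κ f _)

evᵂ-wk : ∀ (τ : Fin n → W n′ m′) (κ : Fin m → K n′ m′) {V} (v : Value V) →
         evᵂ (extsᵂ τ) (renᴷ suc id ∘ κ) (wk V) (renV v) ≡ renᵂ suc id (evᵂ τ κ V v)
evᵂ-wk τ κ v = trans (evᵂ-ren (λ _ → refl) (λ _ → refl) v) (sym (ren-evᵂ suc id τ κ v))

-- If `k` is an abstraction, `_∙_` has contracted its application to the bound variable, and the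
-- left side is already `k`; only a continuation variable calls for η.
ηᴷ-∙ : ∀ (k : K n m) → ƛᴷ (renᴷ suc id k ∙ varᵂ zero) ↠ᴷ k
ηᴷ-∙ (varᴷ k) = return η
ηᴷ-∙ (ƛᴷ q)   = subst (λ z → ƛᴷ z ↠ᴷ ƛᴷ q)
  (sym (subᑫ-renᑫ-id (λ { zero → refl ; (suc x) → refl }) (λ _ → refl) q)) ε

mutual
  -- At the root only three rules can cost target steps. `β-λ` takes `β` and `βᴷ`, after which
  -- `ev-sub-↠` removes the administrative redexes made by the arriving `k`. `η-λ` takes η for the
  -- continuation and then for the argument. `η-where` takes η on the continuation. All other rules
  -- are identities.
  ev-step : ∀ (τ : Fin n → W n′ m′) (κ : Fin m → K n′ m′) {M M′} → M ↦ M′ → ∀ k → ev τ κ M k ↠ᑫ ev τ κ M′ k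
  ev-step τ κ (name-fun {N} {M} ¬v) k = ≡⇒↠ᑫ (ev-cong (λ _ → refl) (λ _ → refl) (cong ƛᴷ (sym
    (trans (ev-·ˡ (extsᵂ τ) (renᴷ suc id ∘ κ) (var {x = zero}) (wk M) (renᴷ suc id k)) (ev-ren (λ _ → refl) (λ _ → refl) M _)))) N)
  ev-step τ κ (name-arg {V} {N} v ¬v) k = ≡⇒↠ᑫ (trans (ev-·ˡ τ κ v N k)
    (ev-cong (λ _ → refl) (λ _ → refl) (cong ƛᴷ (sym (trans (ev-·ᵛ (extsᵂ τ) (renᴷ suc id ∘ κ) (renV v) (var {x = zero}) (renᴷ suc id k))
      (cong (λ z → z ·ᵀ varᵂ zero ·ᑫ renᴷ suc id k) (evᵂ-wk τ κ v))))) N))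
  ev-step τ κ (β-λ {M} {V} v) k =
    subst₂ _↠ᑫ_ (sym (ev-·ᵛ τ κ (lam {M = M}) v k)) (sym (ev-where τ κ M v k))
      (ξ-ᵀˡ (β≡ (cong ƛᵀ (ev-sub {φ = id} (λ { zero → refl ; (suc l) → refl })
        (λ { zero → refl
           ; (suc x) → trans (wkᵏᵂ-subᵂ _ _ (renᵂ suc id (τ x)))
                         (cong (renᵂ id suc) (subᵂ-renᵂ-id (λ _ → refl) (λ _ → refl) (τ x))) })
        (λ l → trans (wkᵏᴷ-subᴷ _ _ (renᴷ suc id (κ l)))
                         (cong (renᴷ id suc) (subᴷ-renᴷ-id (λ _ → refl) (λ _ → refl) (κ l))))
        refl M)))
      ◅ βᴷ ◅ ev-sub-↠ {τ = renᵂ id suc ∘ (τ ,ᵂ evᵂ τ κ V v)} {κ = renᴷ id suc ∘ κ}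
          (λ x → subᵂ-renᵂ-id (λ _ → refl) (λ _ → refl) ((τ ,ᵂ evᵂ τ κ V v) x))
          (λ l → subst (_↠ᴷ κ l) (sym (subᴷ-renᴷ-id (λ _ → refl) (λ _ → refl) (κ l))) ε) ε M)
  ev-step τ κ (β-where {M} {V} v) k = ≡⇒↠ᑫ (trans (ev-where τ κ M v k)
    (sym (ev-subst {s = V /0} (λ { zero → v ; (suc x) → var }) (λ { zero → refl ; (suc x) → refl }) M k)))
  ev-step τ κ (β-μ {M} {J}) k = ≡⇒↠ᑫ (sym (evᴶ-plug (plugEnv
    (cong ƛᴷ (sym (ev-ren (λ { zero → refl ; (suc _) → refl }) (λ _ → refl) M _)))
    (λ { zero p → ⊥-elim (p refl) ; (suc j) p → refl })) J))
  ev-step τ κ (η-λ {V} v) k = ∙-↠ {k = k} ε (ƛᵂ-↠ (return (subst (λ z → ƛᵀ z ⟶ᵀ renᵂ suc id (evᵂ τ κ V v) ·ᵀ varᵂ zero)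
      (sym (trans (ev-·ᵛ (lamᵂ τ) (lamᴷ κ) (renV v) (var {x = zero}) (varᴷ zero)) (cong (λ z → z ·ᵀ varᵂ zero ·ᑫ varᴷ zero)
        (trans (sym (ren-evᵂ id suc (extsᵂ τ) (renᴷ suc id ∘ κ) (renV v))) (cong (renᵂ id suc) (evᵂ-wk τ κ v)))))) η))
      ◅◅ return η) ◅◅ ≡⇒↠ᑫ (sym (ev-value τ κ v k))
  ev-step τ κ (η-where {M}) k = ev-↠ τ κ M (ηᴷ-∙ k)
  ev-step τ κ (η-μ {M}) k = ≡⇒↠ᑫ (ev-ren (λ _ → refl) (λ _ → refl) M k)
  ev-step τ κ (ξ-ƛ r) k = ∙-↠ {k = k} ε (ƛᵂ-↠ (ƛᵀ-↠ (ev-step _ _ r _)))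
  ev-step τ κ (ξ-·ˡ r) k = ev-step τ κ r _
  ev-step τ κ (ξ-·ʳ {M} r) k = ev-↠ τ κ M (ƛᴷ-↠ (ev-step _ _ r _))
  ev-step τ κ (ξ-whereˡ {M = M} r) k = ev-↠ τ κ M (ƛᴷ-↠ (ev-step _ _ r _))
  ev-step τ κ (ξ-whereʳ r) k = ev-step τ κ r _
  ev-step τ κ (ξ-μ r) k = evᴶ-step τ _ r

  evᴶ-step : ∀ (τ : Fin n → W n′ m′) (κ : Fin m → K n′ m′) {J J′} → J ↦ᴶ J′ → evᴶ τ κ J ↠ᑫ evᴶ τ κ J′
  evᴶ-step τ κ (β-jump {J = J}) = ≡⇒↠ᑫ (sym (evᴶ-ren (λ _ → refl) (λ { zero → refl ; (suc l) → refl }) J))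
  evᴶ-step τ κ (ξ-[] r) = ev-step τ κ r _
  evᴶ-step τ κ (ξ-whereᴶˡ {M = M} r) = ev-↠ τ κ M (ƛᴷ-↠ (evᴶ-step _ _ r))
  evᴶ-step τ κ (ξ-whereᴶʳ r) = ev-step τ κ r _

⟦⟧ᶜ-step : ∀ {M M′ : Term n m} → M ⟶ M′ → ⟦ M ⟧ᶜ ↠ᵀ ⟦ M′ ⟧ᶜ
⟦⟧ᶜ-step (L , L′ , M≈L , r , L′≈M′) =
  ƛᵀ-↠ (subst₂ _↠ᑫ_ (sym (ev-≈ _ _ M≈L _)) (ev-≈ _ _ L′≈M′ _) (ev-step _ _ r _))

-- Reduction of the CPS translation to its contracted variant.

wk-↠ : ∀ {k k′ : K n m} → k ↠ᴷ k′ → renᴷ suc id k ↠ᴷ renᴷ suc id k′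
wk-↠ = gmap (renᴷ suc id) (renᴷ-step suc id)

mutual
  -- The continuation reduces along with the term because in the clauses for application and `where`
  -- it contains the translation of the other subterm.
  cps-ev : ∀ {ρ : Fin n → Fin n′} {σ : Fin m → Fin m′} {τ κ} → (∀ x → τ x ≡ varᵂ (ρ x)) → (∀ l → κ l ≡ varᴷ (σ l)) →
           ∀ M {k k′} → k ↠ᴷ k′ → cps ρ σ M k ↠ᑫ ev τ κ M k′
  cps-ev e g (` x) {k} r = ·⇒∙ k _ ◅◅ ∙-↠ r (star-ev e g var)
  cps-ev {τ = τ} {κ} e g (ƛ M) {k} r = ·⇒∙ k _ ◅◅ ∙-↠ r (star-ev {τ = τ} {κ} e g (lam {M = M}))
  cps-ev {τ = τ} {κ} e g (M · N) {k} {k′} r with value? M | value? N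
  ... | yes v | yes w = ·ᑫ-↠ (·ᵀ-↠ (star-ev e g v) (star-ev e g w)) r ◅◅ ≡⇒↠ᑫ (sym (ev-·ᵛ τ κ v w k′))
  ... | yes v | no  _ = cps-ev e g N (ƛᴷ-↠ (·ᑫ-↠ (·ᵀ-↠
      (star-ev {τ = renᵂ suc id ∘ τ} {κ = renᴷ suc id ∘ κ} (cong (renᵂ suc id) ∘ e) (cong (renᴷ suc id) ∘ g) v) ε) (wk-↠ r)))
    ◅◅ ≡⇒↠ᑫ (trans (ev-cong (λ _ → refl) (λ _ → refl)
      (cong (λ z → ƛᴷ (z ·ᵀ _ ·ᑫ _)) (sym (ren-evᵂ suc id τ κ v))) N) (sym (ev-·ˡ τ κ v N k′)))
  ... | no  _ | yes w = cps-ev e g M (ƛᴷ-↠ (·ᑫ-↠ (·ᵀ-↠ ε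
      (star-ev {τ = renᵂ suc id ∘ τ} {κ = renᴷ suc id ∘ κ} (cong (renᵂ suc id) ∘ e) (cong (renᴷ suc id) ∘ g) w)) (wk-↠ r)))
    ◅◅ ≡⇒↠ᑫ (ev-cong (λ _ → refl) (λ _ → refl) (cong ƛᴷ (sym (trans (ev-value _ _ w _)
      (cong (λ z → _ ·ᵀ _ ·ᑫ z) (subᴷ-renᴷ-id (λ _ → refl) (λ _ → refl) (renᴷ suc id k′)))))) M)
  ... | no  _ | no  _ = cps-ev e g M (ƛᴷ-↠ (cps-ev (cong (renᵂ suc id) ∘ e) (cong (renᴷ suc id) ∘ g) N
      (ƛᴷ-↠ (·ᑫ-↠ ε (wk-↠ (wk-↠ r))))))
  cps-ev e g (L where≔ M) r = cps-ev e g M (ƛᴷ-↠ (cps-ev (extsᵂ-var e) (cong (renᴷ suc id) ∘ g) L (wk-↠ r)))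
  cps-ev {τ = τ} {κ} e g (μ J) {k} {k′} r =
    ·ᑫ-↠ (ƛᵀ-↠ (cpsᴶ-ev {τ = renᵂ id suc ∘ τ} {κ = extsᴷ κ} (cong (renᵂ id suc) ∘ e) (extsᴷ-var g) J)) r
    ◅◅ βᴷ ◅ evᴶ-sub-↠ (λ x → subᵂ-renᵂ-id (λ _ → refl) (λ _ → refl) (τ x))
         (λ { zero → ε ; (suc l) → subst (_↠ᴷ κ l) (sym (subᴷ-renᴷ-id (λ _ → refl) (λ _ → refl) (κ l))) ε }) J

  cpsᴶ-ev : ∀ {ρ : Fin n → Fin n′} {σ : Fin m → Fin m′} {τ κ} → (∀ x → τ x ≡ varᵂ (ρ x)) → (∀ l → κ l ≡ varᴷ (σ l)) →
            ∀ J → cpsᴶ ρ σ J ↠ᑫ evᴶ τ κ J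
  cpsᴶ-ev e g ([ k ] M) = cps-ev e g M (subst (_ ↠ᴷ_) (sym (g k)) ε)
  cpsᴶ-ev e g (J where≔ᴶ M) = cps-ev e g M (ƛᴷ-↠ (cpsᴶ-ev (extsᵂ-var e) (cong (renᴷ suc id) ∘ g) J))

  star-ev : ∀ {ρ : Fin n → Fin n′} {σ : Fin m → Fin m′} {τ κ} → (∀ x → τ x ≡ varᵂ (ρ x)) → (∀ l → κ l ≡ varᴷ (σ l)) →
            ∀ {V} (v : Value V) → star ρ σ V v ↠ᵂ evᵂ τ κ V v
  star-ev e g (var {x}) = subst (_ ↠ᵂ_) (sym (e x)) ε
  star-ev e g (lam {M}) = ƛᵂ-↠ (ƛᵀ-↠ (cps-ev (cong (renᵂ id suc) ∘ extsᵂ-var e) (cong (renᴷ id suc ∘ renᴷ suc id) ∘ g) M ε))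

⟦⟧-↠ : ∀ (M : Term n m) → ⟦ M ⟧ ↠ᵀ ⟦ M ⟧ᶜ
⟦⟧-↠ M = ƛᵀ-↠ (cps-ev (λ _ → refl) (λ _ → refl) M ε)

-- Reading target terms in direct style

mutual
  ren-id : ∀ {ρ : Fin n → Fin n} {θ : Fin m → Fin m} → (∀ x → ρ x ≡ x) → (∀ k → θ k ≡ k) → ∀ M → ren ρ θ M ≡ M
  ren-id e f (` x)        = cong `_ (e x)
  ren-id e f (ƛ M)        = cong ƛ (ren-id (lift-id e) f M)
  ren-id e f (M · N)      = cong₂ _·_ (ren-id e f M) (ren-id e f N)
  ren-id e f (L where≔ M) = cong₂ _where≔_ (ren-id (lift-id e) f L) (ren-id e f M)
  ren-id e f (μ J)        = cong μ (renᴶ-id e (lift-id f) J)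

  renᴶ-id : ∀ {ρ : Fin n → Fin n} {θ : Fin m → Fin m} → (∀ x → ρ x ≡ x) → (∀ k → θ k ≡ k) → ∀ J → renᴶ ρ θ J ≡ J
  renᴶ-id e f ([ k ] M)     = cong₂ [_]_ (f k) (ren-id e f M)
  renᴶ-id e f (J where≔ᴶ M) = cong₂ _where≔ᴶ_ (renᴶ-id (lift-id e) f J) (ren-id e f M)

mutual
  ren-ren : ∀ {ρ : Fin n → Fin n′} {ρ′ : Fin n′ → Fin n″} {ρ″} {θ : Fin m → Fin m′} {θ′ : Fin m′ → Fin m″} {θ″} →
            (∀ x → ρ′ (ρ x) ≡ ρ″ x) → (∀ k → θ′ (θ k) ≡ θ″ k) → ∀ M → ren ρ′ θ′ (ren ρ θ M) ≡ ren ρ″ θ″ M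
  ren-ren e f (` x)        = cong `_ (e x)
  ren-ren e f (ƛ M)        = cong ƛ (ren-ren (lift-∘ e) f M)
  ren-ren e f (M · N)      = cong₂ _·_ (ren-ren e f M) (ren-ren e f N)
  ren-ren e f (L where≔ M) = cong₂ _where≔_ (ren-ren (lift-∘ e) f L) (ren-ren e f M)
  ren-ren e f (μ J)        = cong μ (renᴶ-renᴶ e (lift-∘ f) J)

  renᴶ-renᴶ : ∀ {ρ : Fin n → Fin n′} {ρ′ : Fin n′ → Fin n″} {ρ″} {θ : Fin m → Fin m′} {θ′ : Fin m′ → Fin m″} {θ″} →
              (∀ x → ρ′ (ρ x) ≡ ρ″ x) → (∀ k → θ′ (θ k) ≡ θ″ k) → ∀ J → renᴶ ρ′ θ′ (renᴶ ρ θ J) ≡ renᴶ ρ″ θ″ J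
  renᴶ-renᴶ e f ([ k ] M)     = cong₂ [_]_ (f k) (ren-ren e f M)
  renᴶ-renᴶ e f (J where≔ᴶ M) = cong₂ _where≔ᴶ_ (renᴶ-renᴶ (lift-∘ e) f J) (ren-ren e f M)

exts-inv : ∀ {ρ : Fin n → Fin n′} {s : Fin n′ → Term n m} → (∀ x → s (ρ x) ≡ ` x) → ∀ x → exts s (lift 1 ρ x) ≡ ` x
exts-inv e zero    = refl
exts-inv e (suc x) = cong wk (e x)

mutual
  sub-ren-id : ∀ {ρ : Fin n → Fin n′} {θ : Fin m → Fin m} {s : Fin n′ → Term n m} →
               (∀ x → s (ρ x) ≡ ` x) → (∀ k → θ k ≡ k) → ∀ M → sub s (ren ρ θ M) ≡ M
  sub-ren-id e f (` x)        = e x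
  sub-ren-id e f (ƛ M)        = cong ƛ (sub-ren-id (exts-inv e) f M)
  sub-ren-id e f (M · N)      = cong₂ _·_ (sub-ren-id e f M) (sub-ren-id e f N)
  sub-ren-id e f (L where≔ M) = cong₂ _where≔_ (sub-ren-id (exts-inv e) f L) (sub-ren-id e f M)
  sub-ren-id e f (μ J)        = cong μ (subᴶ-ren-id (cong wkᵏ ∘ e) (lift-id f) J)

  subᴶ-ren-id : ∀ {ρ : Fin n → Fin n′} {θ : Fin m → Fin m} {s : Fin n′ → Term n m} →
                (∀ x → s (ρ x) ≡ ` x) → (∀ k → θ k ≡ k) → ∀ J → subᴶ s (renᴶ ρ θ J) ≡ J
  subᴶ-ren-id e f ([ k ] M)     = cong₂ [_]_ (f k) (sub-ren-id e f M)
  subᴶ-ren-id e f (J where≔ᴶ M) = cong₂ _where≔ᴶ_ (subᴶ-ren-id (exts-inv e) f J) (sub-ren-id e f M)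

-- t related to M along σ means that t is a CPS form of M whose continuation
-- variables are renamed by σ.  A computation q is moreover related at its tail
-- continuation k, i.e. it stands for the jump [k]M.  An abstraction λk.q may
-- be read back either as μk.[j]M or, if k is linear in tail position, as M
-- itself (eta); the latter saves the expansion M ← μk.[k]M.
mutual
  data Rᵀ {n m m′} (σ : Fin m → Fin m′) : T n m′ → Term n m → Set where
    app : ∀ {v w V U} → Rᵂ σ v V → Rᵂ σ w U → Rᵀ σ (v ·ᵀ w) (V · U)
    eta : ∀ {q M} → Rᑫ (suc ∘ σ) zero q M → Rᵀ σ (ƛᵀ q) M
    mu  : ∀ {q M} j → Rᑫ (lift 1 σ) (lift 1 σ j) q M → Rᵀ σ (ƛᵀ q) (μ ([ j ] M))

  data Rᑫ {n m m′} (σ : Fin m → Fin m′) (k : Fin m′) : Q n m′ → Term n m → Set where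
    ret  : ∀ {w V} → Rᵂ σ w V → Rᑫ σ k (varᴷ k ·ᴷ w) V
    bind : ∀ {q L w V} → Rᑫ σ k q L → Rᵂ σ w V → Rᑫ σ k (ƛᴷ q ·ᴷ w) (L where≔ V)
    tail : ∀ {t M} → Rᵀ σ t M → Rᑫ σ k (t ·ᑫ varᴷ k) M
    call : ∀ {q L t M} → Rᑫ σ k q L → Rᵀ σ t M → Rᑫ σ k (t ·ᑫ ƛᴷ q) (L where≔ M)

  data Rᵂ {n m m′} (σ : Fin m → Fin m′) : W n m′ → Term n m → Set where
    var : ∀ {x} → Rᵂ σ (varᵂ x) (` x)
    lam : ∀ {t M} → Rᵀ σ t M → Rᵂ σ (ƛᵂ t) (ƛ M)

-- Readings under renaming and substitution.

Rᵂ-Value : ∀ {σ : Fin m → Fin m′} {w : W n m′} {V} → Rᵂ σ w V → Value V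
Rᵂ-Value var     = var
Rᵂ-Value (lam _) = lam

lift-square : ∀ {θ : Fin m → Fin m′} {σ′ : Fin m′ → Fin m‴} {σ : Fin m → Fin m″} {φ : Fin m″ → Fin m‴} →
              (∀ j → σ′ (θ j) ≡ φ (σ j)) → ∀ j → lift 1 σ′ (lift 1 θ j) ≡ lift 1 φ (lift 1 σ j)
lift-square e zero    = refl
lift-square e (suc j) = cong suc (e j)

mutual
  Rᵀ-ren : ∀ {ρ : Fin n → Fin n′} {θ : Fin m → Fin m′} {φ : Fin m″ → Fin m‴} {σ σ′ t M} →
           (∀ j → σ′ (θ j) ≡ φ (σ j)) → Rᵀ σ t M → Rᵀ σ′ (renᵀ ρ φ t) (ren ρ θ M)
  Rᵀ-ren e (app r s) = app (Rᵂ-ren e r) (Rᵂ-ren e s)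
  Rᵀ-ren e (eta r)   = eta (Rᑫ-ren (cong suc ∘ e) refl r)
  Rᵀ-ren e (mu j r)  = mu _ (Rᑫ-ren (lift-square e) (lift-square e j) r)

  Rᑫ-ren : ∀ {ρ : Fin n → Fin n′} {θ : Fin m → Fin m′} {φ : Fin m″ → Fin m‴} {σ σ′ k k′ q M} →
           (∀ j → σ′ (θ j) ≡ φ (σ j)) → k′ ≡ φ k → Rᑫ σ k q M → Rᑫ σ′ k′ (renᑫ ρ φ q) (ren ρ θ M)
  Rᑫ-ren e refl (ret r)    = ret (Rᵂ-ren e r)
  Rᑫ-ren e refl (bind r s) = bind (Rᑫ-ren e refl r) (Rᵂ-ren e s)
  Rᑫ-ren e refl (tail r)   = tail (Rᵀ-ren e r)
  Rᑫ-ren e refl (call r s) = call (Rᑫ-ren e refl r) (Rᵀ-ren e s)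

  Rᵂ-ren : ∀ {ρ : Fin n → Fin n′} {θ : Fin m → Fin m′} {φ : Fin m″ → Fin m‴} {σ σ′ w V} →
           (∀ j → σ′ (θ j) ≡ φ (σ j)) → Rᵂ σ w V → Rᵂ σ′ (renᵂ ρ φ w) (ren ρ θ V)
  Rᵂ-ren e var     = var
  Rᵂ-ren e (lam r) = lam (Rᵀ-ren e r)

Rᵀ-renˢ : ∀ {θ : Fin m → Fin m′} {σ σ′} {t : T n m″} {M} → (∀ j → σ′ (θ j) ≡ σ j) → Rᵀ σ t M → Rᵀ σ′ t (ren id θ M)
Rᵀ-renˢ {t = t} e r = subst (λ z → Rᵀ _ z _) (renᵀ-id (λ _ → refl) (λ _ → refl) t) (Rᵀ-ren e r)

Rᑫ-renˢ : ∀ {θ : Fin m → Fin m′} {σ σ′ k} {q : Q n m″} {M} →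
          (∀ j → σ′ (θ j) ≡ σ j) → Rᑫ σ k q M → Rᑫ σ′ k q (ren id θ M)
Rᑫ-renˢ {q = q} e r = subst (λ z → Rᑫ _ _ z _) (renᑫ-id (λ _ → refl) (λ _ → refl) q) (Rᑫ-ren e refl r)

Rᵂ-renˢ : ∀ {θ : Fin m → Fin m′} {σ σ′} {w : W n m″} {V} → (∀ j → σ′ (θ j) ≡ σ j) → Rᵂ σ w V → Rᵂ σ′ w (ren id θ V)
Rᵂ-renˢ {w = w} e r = subst (λ z → Rᵂ _ z _) (renᵂ-id (λ _ → refl) (λ _ → refl) w) (Rᵂ-ren e r)

Rᵂ-renᵗ : ∀ {φ : Fin m′ → Fin m″} {σ : Fin m → Fin m′} {w : W n m′} {V} → Rᵂ σ w V → Rᵂ (φ ∘ σ) (renᵂ id φ w) V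
Rᵂ-renᵗ {V = V} r = subst (Rᵂ _ _) (ren-id (λ _ → refl) (λ _ → refl) V) (Rᵂ-ren (λ _ → refl) r)

Rᑫ-≗ : ∀ {σ σ′ : Fin m → Fin m′} {k k′} {q : Q n m′} {M} → (∀ j → σ′ j ≡ σ j) → k′ ≡ k → Rᑫ σ k q M → Rᑫ σ′ k′ q M
Rᑫ-≗ {M = M} e refl r = subst (Rᑫ _ _ _) (ren-id (λ _ → refl) (λ _ → refl) M) (Rᑫ-renˢ {θ = id} e r)

Rᵂ-exts : ∀ {σ : Fin m → Fin m′} {s : Fin n → W n′ m′} {τ} → (∀ x → Rᵂ σ (s x) (τ x)) → ∀ x → Rᵂ σ (extsᵂ s x) (exts τ x)
Rᵂ-exts r zero    = var
Rᵂ-exts r (suc x) = Rᵂ-ren (λ _ → refl) (r x)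

extsᵂ-id : ∀ {s : Fin n → W n m} → (∀ x → s x ≡ varᵂ x) → ∀ x → extsᵂ s x ≡ varᵂ x
extsᵂ-id e zero    = refl
extsᵂ-id e (suc x) = cong (renᵂ suc id) (e x)

extsᴷ-id : ∀ {c : Fin m → K n m} → (∀ k → c k ≡ varᴷ k) → ∀ k → extsᴷ c k ≡ varᴷ k
extsᴷ-id e zero    = refl
extsᴷ-id e (suc k) = cong (renᴷ id suc) (e k)

mutual
  Rᵀ-sub : ∀ {σ : Fin m → Fin m′} {s : Fin n → W n′ m′} {c τ t M} → (∀ k → c k ≡ varᴷ k) → (∀ x → Rᵂ σ (s x) (τ x)) →
           Rᵀ σ t M → Rᵀ σ (subᵀ s c t) (sub τ M)
  Rᵀ-sub e p (app r s) = app (Rᵂ-sub e p r) (Rᵂ-sub e p s)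
  Rᵀ-sub e p (eta r)   = eta (Rᑫ-sub (extsᴷ-id e) (Rᵂ-renᵗ ∘ p) r)
  Rᵀ-sub e p (mu j r)  = mu j (Rᑫ-sub (extsᴷ-id e) (λ x → Rᵂ-ren (λ _ → refl) (p x)) r)

  Rᑫ-sub : ∀ {σ : Fin m → Fin m′} {s : Fin n → W n′ m′} {c τ k q M} → (∀ k → c k ≡ varᴷ k) → (∀ x → Rᵂ σ (s x) (τ x)) →
           Rᑫ σ k q M → Rᑫ σ k (subᑫ s c q) (sub τ M)
  Rᑫ-sub {k = k} e p (ret r)  rewrite e k = ret (Rᵂ-sub e p r)
  Rᑫ-sub e p (bind r s)                   = bind (Rᑫ-sub (cong (renᴷ suc id) ∘ e) (Rᵂ-exts p) r) (Rᵂ-sub e p s)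
  Rᑫ-sub {k = k} e p (tail r) rewrite e k = tail (Rᵀ-sub e p r)
  Rᑫ-sub e p (call r s)                   = call (Rᑫ-sub (cong (renᴷ suc id) ∘ e) (Rᵂ-exts p) r) (Rᵀ-sub e p s)

  Rᵂ-sub : ∀ {σ : Fin m → Fin m′} {s : Fin n → W n′ m′} {c τ w V} → (∀ k → c k ≡ varᴷ k) → (∀ x → Rᵂ σ (s x) (τ x)) →
           Rᵂ σ w V → Rᵂ σ (subᵂ s c w) (sub τ V)
  Rᵂ-sub e p (var {x}) = p x
  Rᵂ-sub e p (lam r)   = lam (Rᵀ-sub (cong (renᴷ suc id) ∘ e) (Rᵂ-exts p) r)

Rᵂ-/0 : ∀ {σ : Fin m → Fin m′} {w : W n m′} {V} → Rᵂ σ w V → ∀ x → Rᵂ σ ((w /0ᵂ) x) ((V /0) x)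
Rᵂ-/0 r zero    = r
Rᵂ-/0 r (suc x) = var

-- The contexts K[□] denoted by a continuation: □ or (L where x := □).
data Ctx (n m : ℕ) : Set where
  hole : Ctx n m
  body : Term (suc n) m → Ctx n m

fill : Ctx n m → Term n m → Term n m
fill hole     M = M
fill (body L) M = L where≔ M

renᶜ : (Fin n → Fin n′) → (Fin m → Fin m′) → Ctx n m → Ctx n′ m′
renᶜ ρ θ hole     = hole
renᶜ ρ θ (body L) = body (ren (lift 1 ρ) θ L)

data Rᴷ {n m m′} (σ : Fin m → Fin m′) (k : Fin m′) : K n m′ → Ctx n m → Set where
  hole : Rᴷ σ k (varᴷ k) hole
  body : ∀ {q L} → Rᑫ σ k q L → Rᴷ σ k (ƛᴷ q) (body L)

ret-fill : ∀ {σ : Fin m → Fin m′} {k κ C} {w : W n m′} {V} → Rᴷ σ k κ C → Rᵂ σ w V → Rᑫ σ k (κ ·ᴷ w) (fill C V)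
ret-fill hole     s = ret s
ret-fill (body r) s = bind r s

call-fill : ∀ {σ : Fin m → Fin m′} {k κ C} {t : T n m′} {M} → Rᴷ σ k κ C → Rᵀ σ t M → Rᑫ σ k (t ·ᑫ κ) (fill C M)
call-fill hole     s = tail s
call-fill (body r) s = call r s

Rᴷ-ren : ∀ {ρ : Fin n → Fin n′} {θ : Fin m → Fin m′} {φ : Fin m″ → Fin m‴} {σ σ′ k k′ κ C} →
         (∀ j → σ′ (θ j) ≡ φ (σ j)) → k′ ≡ φ k → Rᴷ σ k κ C → Rᴷ σ′ k′ (renᴷ ρ φ κ) (renᶜ ρ θ C)
Rᴷ-ren e refl hole     = hole
Rᴷ-ren e refl (body r) = body (Rᑫ-ren e refl r)

Rᴷ-wk : ∀ {σ : Fin m → Fin m′} {k} {κ : K n m′} {C} → Rᴷ σ k κ C → Rᴷ σ k (renᴷ suc id κ) (renᶜ suc id C)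
Rᴷ-wk = Rᴷ-ren (λ _ → refl) refl

fill-where : ∀ (C : Ctx n m) L M → fill C (L where≔ M) ≈ (fill (renᶜ suc id C) L where≔ M)
fill-where hole     L M = ≈-refl
fill-where (body P) L M = E1 P L M

fill-≈ : ∀ (C : Ctx n m) {M M′} → M ≈ M′ → fill C M ≈ fill C M′
fill-≈ hole     e = e
fill-≈ (body L) e = where-cong ≈-refl e

-- Substitution of a continuation for a variable that does not occur in M
-- except possibly as the tail.
mutual
  Rᵀ-tail : ∀ {σ : Fin m → Fin m′} {σ′ : Fin m → Fin m″} {s : Fin n → W n m″} {c t M} →
            (∀ x → s x ≡ varᵂ x) → (∀ j → c (σ j) ≡ varᴷ (σ′ j)) →
            Rᵀ σ t M → ∃[ M′ ] M ≈ M′ × Rᵀ σ′ (subᵀ s c t) M′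
  Rᵀ-tail e f (app r s) with Rᵂ-tail e f r | Rᵂ-tail e f s
  ... | V , v , r′ | U , u , s′ = V · U , ·-cong v u , app r′ s′
  Rᵀ-tail e f (eta r) with Rᑫ-tail (cong (renᵂ id suc) ∘ e) (cong (renᴷ id suc) ∘ f) hole r
  ... | M′ , eq , r′ = M′ , eq , eta r′
  Rᵀ-tail {σ = σ} {σ′} {c = c} e f (mu j r) with Rᑫ-tail (cong (renᵂ id suc) ∘ e) g (subst (λ z → Rᴷ _ _ z hole) (sym (g j)) hole) r
    where
    g : ∀ j → extsᴷ c (lift 1 σ j) ≡ varᴷ (lift 1 σ′ j)
    g zero    = refl
    g (suc j) = cong (renᴷ id suc) (f j)
  ... | M′ , eq , r′ = μ ([ j ] M′) , μ-cong ([]-cong eq) , mu j r′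

  Rᑫ-tail : ∀ {σ : Fin m → Fin m′} {σ′ : Fin m → Fin m″} {s : Fin n → W n m″} {c k k′ C q M} →
            (∀ x → s x ≡ varᵂ x) → (∀ j → c (σ j) ≡ varᴷ (σ′ j)) → Rᴷ σ′ k′ (c k) C →
            Rᑫ σ k q M → ∃[ M′ ] fill C M ≈ M′ × Rᑫ σ′ k′ (subᑫ s c q) M′
  Rᑫ-tail {C = C} e f h (ret r) with Rᵂ-tail e f r
  ... | V , v , r′ = fill C V , fill-≈ C v , ret-fill h r′
  Rᑫ-tail {C = C} e f h (bind r s) with Rᑫ-tail (extsᵂ-id e) (cong (renᴷ suc id) ∘ f) (Rᴷ-wk h) r | Rᵂ-tail e f s
  ... | L , l , r′ | V , v , s′ = (L where≔ V) , ≈-trans (fill-where C _ _) (where-cong l v) , bind r′ s′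
  Rᑫ-tail {C = C} e f h (tail r) with Rᵀ-tail e f r
  ... | M , eq , r′ = fill C M , fill-≈ C eq , call-fill h r′
  Rᑫ-tail {C = C} e f h (call r s) with Rᑫ-tail (extsᵂ-id e) (cong (renᴷ suc id) ∘ f) (Rᴷ-wk h) r | Rᵀ-tail e f s
  ... | L , l , r′ | M , eq , s′ = (L where≔ M) , ≈-trans (fill-where C _ _) (where-cong l eq) , call r′ s′

  Rᵂ-tail : ∀ {σ : Fin m → Fin m′} {σ′ : Fin m → Fin m″} {s : Fin n → W n m″} {c w V} →
            (∀ x → s x ≡ varᵂ x) → (∀ j → c (σ j) ≡ varᴷ (σ′ j)) →
            Rᵂ σ w V → ∃[ V′ ] V ≈ V′ × Rᵂ σ′ (subᵂ s c w) V′
  Rᵂ-tail e f (var {x}) rewrite e x = ` x , ≈-refl , var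
  Rᵂ-tail e f (lam r) with Rᵀ-tail (extsᵂ-id e) (cong (renᴷ suc id) ∘ f) r
  ... | M , eq , r′ = ƛ M , ƛ-cong eq , lam r′

ren-lift-id : ∀ {θ : Fin m → Fin m′} (M : Term (suc n) m) → ren (lift 1 id) θ M ≡ ren id θ M
ren-lift-id {θ = θ} M = trans (cong (ren (lift 1 id) θ) (sym (ren-id (λ _ → refl) (λ _ → refl) M)))
  (ren-ren (lift-id (λ _ → refl)) (λ _ → refl) M)

-- The substitution `c` puts an abstraction for the target name of `i` and a variable for the name
-- of every other `j`. In particular no other source variable shares its target name with `i`.
record PlugRel (i : Fin m) (P : Term (suc n) m) (σ : Fin m → Fin m′) (σ′ : Fin m → Fin m″) (c : Fin m′ → K n m″) : Set where
  constructor plugRel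
  field
    at-i      : Rᴷ σ′ (σ′ i) (c (σ i)) (body P)
    elsewhere : ∀ j → ¬ i ≡ j → Rᴷ σ′ (σ′ j) (c (σ j)) hole

PlugRel-wk : ∀ {i : Fin m} {P : Term (suc n) m} {σ : Fin m → Fin m′} {σ′ : Fin m → Fin m″} {c} → PlugRel i P σ σ′ c →
             PlugRel i (ren (lift 1 suc) id P) σ σ′ (renᴷ suc id ∘ c)
PlugRel-wk (plugRel a b) = plugRel (Rᴷ-wk a) (λ j p → Rᴷ-wk (b j p))

PlugRel-eta : ∀ {i : Fin m} {P : Term (suc n) m} {σ : Fin m → Fin m′} {σ′ : Fin m → Fin m″} {c} → PlugRel i P σ σ′ c →
              PlugRel i P (suc ∘ σ) (suc ∘ σ′) (extsᴷ c)
PlugRel-eta {P = P} (plugRel a b) = plugRel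
  (subst (λ z → Rᴷ _ _ _ (body z)) (trans (ren-lift-id P) (ren-id (λ _ → refl) (λ _ → refl) P)) (Rᴷ-ren {θ = id} (λ _ → refl) refl a))
  (λ j p → Rᴷ-ren {θ = id} (λ _ → refl) refl (b j p))

PlugRel-mu : ∀ {i : Fin m} {P : Term (suc n) m} {σ : Fin m → Fin m′} {σ′ : Fin m → Fin m″} {c} → PlugRel i P σ σ′ c →
             PlugRel (suc i) (wkᵏ P) (lift 1 σ) (lift 1 σ′) (extsᴷ c)
PlugRel-mu {P = P} (plugRel a b) = plugRel
  (subst (λ z → Rᴷ _ _ _ (body z)) (ren-lift-id P) (Rᴷ-ren (λ _ → refl) refl a))
  (λ { zero _ → hole ; (suc j) p → Rᴷ-ren {θ = suc} (λ _ → refl) refl (b j (p ∘ cong suc)) })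

mutual
  -- `plug` wraps whole jump arguments in `P`, whereas target substitution places the continuation
  -- at the tail, beneath all bindings of the argument. E1, in the form of `fill-where`, bridges the
  -- two, so the result is reached only up to ≈.
  Rᵀ-plug : ∀ {i : Fin m} {P : Term (suc n) m} {σ : Fin m → Fin m′} {σ′ : Fin m → Fin m″} {s c t M} →
            (∀ x → s x ≡ varᵂ x) → PlugRel i P σ σ′ c →
            Rᵀ σ t M → ∃[ M′ ] plug i P M ≈ M′ × Rᵀ σ′ (subᵀ s c t) M′
  Rᵀ-plug e f (app r s) with Rᵂ-plug e f r | Rᵂ-plug e f s
  ... | V , v , r′ | U , u , s′ = V · U , ·-cong v u , app r′ s′
  Rᵀ-plug e f (eta r) with Rᑫ-plug (cong (renᵂ id suc) ∘ e) (PlugRel-eta f) hole r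
  ... | M′ , eq , r′ = M′ , eq , eta r′
  Rᵀ-plug {i = i} e f (mu j r) with suc i ≟ j
  ... | yes refl with Rᑫ-plug (cong (renᵂ id suc) ∘ e) (PlugRel-mu f) (PlugRel.at-i (PlugRel-mu f)) r
  ...   | M′ , eq , r′ = μ ([ j ] M′) , μ-cong ([]-cong eq) , mu j r′
  Rᵀ-plug {i = i} e f (mu j r) | no ¬p with Rᑫ-plug (cong (renᵂ id suc) ∘ e) (PlugRel-mu f) (PlugRel.elsewhere (PlugRel-mu f) j ¬p) r
  ...   | M′ , eq , r′ = μ ([ j ] M′) , μ-cong ([]-cong eq) , mu j r′

  Rᑫ-plug : ∀ {i : Fin m} {P : Term (suc n) m} {σ : Fin m → Fin m′} {σ′ : Fin m → Fin m″} {s c k k′ C q M} →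
            (∀ x → s x ≡ varᵂ x) → PlugRel i P σ σ′ c → Rᴷ σ′ k′ (c k) C →
            Rᑫ σ k q M → ∃[ M′ ] fill C (plug i P M) ≈ M′ × Rᑫ σ′ k′ (subᑫ s c q) M′
  Rᑫ-plug {C = C} e f h (ret r) with Rᵂ-plug e f r
  ... | V , v , r′ = fill C V , fill-≈ C v , ret-fill h r′
  Rᑫ-plug {C = C} e f h (bind r s) with Rᑫ-plug (extsᵂ-id e) (PlugRel-wk f) (Rᴷ-wk h) r | Rᵂ-plug e f s
  ... | L , l , r′ | V , v , s′ = (L where≔ V) , ≈-trans (fill-where C _ _) (where-cong l v) , bind r′ s′
  Rᑫ-plug {C = C} e f h (tail r) with Rᵀ-plug e f r
  ... | M , eq , r′ = fill C M , fill-≈ C eq , call-fill h r′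
  Rᑫ-plug {C = C} e f h (call r s) with Rᑫ-plug (extsᵂ-id e) (PlugRel-wk f) (Rᴷ-wk h) r | Rᵀ-plug e f s
  ... | L , l , r′ | M , eq , s′ = (L where≔ M) , ≈-trans (fill-where C _ _) (where-cong l eq) , call r′ s′

  Rᵂ-plug : ∀ {i : Fin m} {P : Term (suc n) m} {σ : Fin m → Fin m′} {σ′ : Fin m → Fin m″} {s c w V} →
            (∀ x → s x ≡ varᵂ x) → PlugRel i P σ σ′ c →
            Rᵂ σ w V → ∃[ V′ ] plug i P V ≈ V′ × Rᵂ σ′ (subᵂ s c w) V′
  Rᵂ-plug e f (var {x}) rewrite e x = ` x , ≈-refl , var
  Rᵂ-plug e f (lam r) with Rᵀ-plug (extsᵂ-id e) (PlugRel-wk f) r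
  ... | M , eq , r′ = ƛ M , ƛ-cong eq , lam r′

-- The existence half of a pullback square. A source variable whose target name lies in the image of
-- `φ` must come through `θ`; with both equal to `suc`, a term whose reading avoids the newest
-- target name avoids the newest source name.
Pullback : (σ : Fin m → Fin m″) (σ′ : Fin m′ → Fin m‴) (θ : Fin m → Fin m′) (φ : Fin m″ → Fin m‴) → Set
Pullback σ σ′ θ φ = ∀ i j → σ′ j ≡ φ i → ∃[ l ] j ≡ θ l × i ≡ σ l

suc-injective : ∀ {i j : Fin n} → _≡_ {A = Fin (suc n)} (suc i) (suc j) → i ≡ j
suc-injective refl = refl

Pullback-eta : ∀ {σ : Fin m → Fin m″} {σ′ : Fin m′ → Fin m‴} {θ φ} →
               Pullback σ σ′ θ φ → Pullback (suc ∘ σ) (suc ∘ σ′) θ (lift 1 φ)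
Pullback-eta p (suc i) j e with p i j (suc-injective e)
... | l , e₁ , e₂ = l , e₁ , cong suc e₂

Pullback-mu : ∀ {σ : Fin m → Fin m″} {σ′ : Fin m′ → Fin m‴} {θ φ} →
              Pullback σ σ′ θ φ → Pullback (lift 1 σ) (lift 1 σ′) (lift 1 θ) (lift 1 φ)
Pullback-mu p zero    zero    e = zero , refl , refl
Pullback-mu p (suc i) (suc j) e with p i j (suc-injective e)
... | l , e₁ , e₂ = suc l , cong suc e₁ , cong suc e₂

mutual
  -- This makes η-steps readable: the freshness condition of a target η-redex is a weakening of the
  -- target term, and it has to yield the weakening of the source term that `η-λ` and `η-μ` ask for.
  Rᵀ-unrenᵗ : ∀ {ρ : Fin n → Fin n′} {θ : Fin m → Fin m′} {φ : Fin m″ → Fin m‴} {σ σ′} → Pullback σ σ′ θ φ →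
              ∀ t {M} → Rᵀ σ′ (renᵀ ρ φ t) M → ∃[ M₀ ] M ≡ ren ρ θ M₀ × Rᵀ σ t M₀
  Rᵀ-unrenᵗ p (v ·ᵀ w) (app r s) with Rᵂ-unrenᵗ p v r | Rᵂ-unrenᵗ p w s
  ... | V , refl , r′ | U , refl , s′ = V · U , refl , app r′ s′
  Rᵀ-unrenᵗ p (ƛᵀ q) (eta r) with Rᑫ-unrenᵗ (Pullback-eta p) q r
  ... | zero , M , refl , refl , r′ = M , refl , eta r′
  Rᵀ-unrenᵗ p (ƛᵀ q) (mu j r) with Rᑫ-unrenᵗ (Pullback-mu p) q r
  ... | k , M , e , refl , r′ with Pullback-mu p k j e
  ...   | l , refl , refl = μ ([ l ] M) , refl , mu l r′

  Rᑫ-unrenᵗ : ∀ {ρ : Fin n → Fin n′} {θ : Fin m → Fin m′} {φ : Fin m″ → Fin m‴} {σ σ′} → Pullback σ σ′ θ φ →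
              ∀ q {k′ M} → Rᑫ σ′ k′ (renᑫ ρ φ q) M → ∃[ k ] ∃[ M₀ ] k′ ≡ φ k × M ≡ ren ρ θ M₀ × Rᑫ σ k q M₀
  Rᑫ-unrenᵗ p (varᴷ k ·ᴷ w) (ret r) with Rᵂ-unrenᵗ p w r
  ... | V , refl , r′ = k , V , refl , refl , ret r′
  Rᑫ-unrenᵗ p (ƛᴷ q ·ᴷ w) (bind r s) with Rᑫ-unrenᵗ p q r | Rᵂ-unrenᵗ p w s
  ... | k , L , e , refl , r′ | V , refl , s′ = k , (L where≔ V) , e , refl , bind r′ s′
  Rᑫ-unrenᵗ p (t ·ᑫ varᴷ k) (tail r) with Rᵀ-unrenᵗ p t r
  ... | M , refl , r′ = k , M , refl , refl , tail r′
  Rᑫ-unrenᵗ p (t ·ᑫ ƛᴷ q) (call r s) with Rᑫ-unrenᵗ p q r | Rᵀ-unrenᵗ p t s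
  ... | k , L , e , refl , r′ | M , refl , s′ = k , (L where≔ M) , e , refl , call r′ s′

  Rᵂ-unrenᵗ : ∀ {ρ : Fin n → Fin n′} {θ : Fin m → Fin m′} {φ : Fin m″ → Fin m‴} {σ σ′} → Pullback σ σ′ θ φ →
              ∀ w {V} → Rᵂ σ′ (renᵂ ρ φ w) V → ∃[ V₀ ] V ≡ ren ρ θ V₀ × Rᵂ σ w V₀
  Rᵂ-unrenᵗ p (varᵂ x) var = ` x , refl , var
  Rᵂ-unrenᵗ p (ƛᵂ t) (lam r) with Rᵀ-unrenᵗ p t r
  ... | M , refl , r′ = ƛ M , refl , lam r′

mutual
  -- The free names of a reading all come from the source term, apart from the tail, so a commuting
  -- square suffices in this direction. The equation on `M` is an argument so that the constructors
  -- of the relation can be matched before `ren ρ θ M₀` is analysed.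
  Rᵀ-unrenˢ : ∀ {ρ : Fin n → Fin n′} {θ : Fin m → Fin m′} (φ : Fin m″ → Fin m‴) (σ : Fin m → Fin m″) {σ′} → (∀ j → σ′ (θ j) ≡ φ (σ j)) →
              ∀ M₀ {t M} → Rᵀ σ′ t M → M ≡ ren ρ θ M₀ → ∃[ t₀ ] t ≡ renᵀ ρ φ t₀ × Rᵀ σ t₀ M₀
  Rᵀ-unrenˢ φ σ e (V · U) (app r s) refl with Rᵂ-unrenˢ φ σ e V r refl | Rᵂ-unrenˢ φ σ e U s refl
  ... | v , refl , r′ | w , refl , s′ = v ·ᵀ w , refl , app r′ s′
  Rᵀ-unrenˢ φ σ e M (eta r) refl with Rᑫ-unrenˢ (lift 1 φ) (suc ∘ σ) {k = zero} (cong suc ∘ e) refl M r refl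
  ... | q , refl , r′ = ƛᵀ q , refl , eta r′
  Rᵀ-unrenˢ φ σ e (μ ([ j ] M)) (mu _ r) refl with Rᑫ-unrenˢ (lift 1 φ) (lift 1 σ) (lift-square e) (lift-square e j) M r refl
  ... | q , refl , r′ = ƛᵀ q , refl , mu j r′

  Rᑫ-unrenˢ : ∀ {ρ : Fin n → Fin n′} {θ : Fin m → Fin m′} (φ : Fin m″ → Fin m‴) (σ : Fin m → Fin m″) {σ′ k k′} →
              (∀ j → σ′ (θ j) ≡ φ (σ j)) → k′ ≡ φ k →
              ∀ M₀ {q M} → Rᑫ σ′ k′ q M → M ≡ ren ρ θ M₀ → ∃[ q₀ ] q ≡ renᑫ ρ φ q₀ × Rᑫ σ k q₀ M₀
  Rᑫ-unrenˢ φ σ {k = k} e refl V (ret r) refl with Rᵂ-unrenˢ φ σ e V r refl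
  ... | w , refl , r′ = varᴷ k ·ᴷ w , refl , ret r′
  Rᑫ-unrenˢ φ σ e f (L where≔ V) (bind r s) refl with Rᑫ-unrenˢ φ σ e f L r refl | Rᵂ-unrenˢ φ σ e V s refl
  ... | q , refl , r′ | w , refl , s′ = ƛᴷ q ·ᴷ w , refl , bind r′ s′
  Rᑫ-unrenˢ φ σ {k = k} e refl M (tail r) refl with Rᵀ-unrenˢ φ σ e M r refl
  ... | t , refl , r′ = t ·ᑫ varᴷ k , refl , tail r′
  Rᑫ-unrenˢ φ σ e f (L where≔ M) (call r s) refl with Rᑫ-unrenˢ φ σ e f L r refl | Rᵀ-unrenˢ φ σ e M s refl
  ... | q , refl , r′ | t , refl , s′ = t ·ᑫ ƛᴷ q , refl , call r′ s′

  Rᵂ-unrenˢ : ∀ {ρ : Fin n → Fin n′} {θ : Fin m → Fin m′} (φ : Fin m″ → Fin m‴) (σ : Fin m → Fin m″) {σ′} → (∀ j → σ′ (θ j) ≡ φ (σ j)) →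
              ∀ V₀ {w V} → Rᵂ σ′ w V → V ≡ ren ρ θ V₀ → ∃[ w₀ ] w ≡ renᵂ ρ φ w₀ × Rᵂ σ w₀ V₀
  Rᵂ-unrenˢ φ σ e (` x) var refl = varᵂ x , refl , var
  Rᵂ-unrenˢ φ σ e (ƛ M) (lam r) refl with Rᵀ-unrenˢ φ σ e M r refl
  ... | t , refl , r′ = ƛᵂ t , refl , lam r′

-- Simulation of target reduction

infix 4 _⇛_ _⇛ᴶ_

-- An equation alone is not a `_⟶_` step, yet readings often change by equations alone. Mixing both
-- kinds of step defers their separation to `⇛⇒⟶*`.
_⇛_ : Term n m → Term n m → Set
_⇛_ = Star (λ M N → M ≈ N ⊎ M ↦ N)

_⇛ᴶ_ : Jump n m → Jump n m → Set
_⇛ᴶ_ = Star (λ J I → J ≈ᴶ I ⊎ J ↦ᴶ I)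

≈⇒⇛ : ∀ {M N : Term n m} → M ≈ N → M ⇛ N
≈⇒⇛ e = return (inj₁ e)

↦⇒⇛ : ∀ {M N : Term n m} → M ↦ N → M ⇛ N
↦⇒⇛ r = return (inj₂ r)

≡⇒⇛ : ∀ {M N : Term n m} → M ≡ N → M ⇛ N
≡⇒⇛ refl = ε

ƛ-⇛ : ∀ {M M′ : Term (suc n) m} → M ⇛ M′ → ƛ M ⇛ ƛ M′
ƛ-⇛ = gmap ƛ λ { (inj₁ e) → inj₁ (ƛ-cong e) ; (inj₂ r) → inj₂ (ξ-ƛ r) }

·-⇛ : ∀ {M M′ N N′ : Term n m} → M ⇛ M′ → N ⇛ N′ → M · N ⇛ M′ · N′
·-⇛ r s = gmap (_· _) (λ { (inj₁ e) → inj₁ (·-cong e ≈-refl) ; (inj₂ r) → inj₂ (ξ-·ˡ r) }) r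
       ◅◅ gmap (_ ·_) (λ { (inj₁ e) → inj₁ (·-cong ≈-refl e) ; (inj₂ r) → inj₂ (ξ-·ʳ r) }) s

where-⇛ : ∀ {L L′ : Term (suc n) m} {M M′} → L ⇛ L′ → M ⇛ M′ → (L where≔ M) ⇛ (L′ where≔ M′)
where-⇛ r s = gmap (_where≔ _) (λ { (inj₁ e) → inj₁ (where-cong e ≈-refl) ; (inj₂ r) → inj₂ (ξ-whereˡ r) }) r
           ◅◅ gmap (_ where≔_) (λ { (inj₁ e) → inj₁ (where-cong ≈-refl e) ; (inj₂ r) → inj₂ (ξ-whereʳ r) }) s

μ-⇛ : ∀ {J J′ : Jump n (suc m)} → J ⇛ᴶ J′ → μ J ⇛ μ J′
μ-⇛ = gmap μ λ { (inj₁ e) → inj₁ (μ-cong e) ; (inj₂ r) → inj₂ (ξ-μ r) }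

[]-⇛ : ∀ {k} {M M′ : Term n m} → M ⇛ M′ → ([ k ] M) ⇛ᴶ ([ k ] M′)
[]-⇛ = gmap [ _ ]_ λ { (inj₁ e) → inj₁ ([]-cong e) ; (inj₂ r) → inj₂ (ξ-[] r) }

whereᴶ-⇛ : ∀ {J J′ : Jump (suc n) m} {M} → J ⇛ᴶ J′ → (J where≔ᴶ M) ⇛ᴶ (J′ where≔ᴶ M)
whereᴶ-⇛ = gmap (_where≔ᴶ _) λ { (inj₁ e) → inj₁ (whereᴶ-cong e ≈-refl) ; (inj₂ r) → inj₂ (ξ-whereᴶˡ r) }

fill-⇛ : ∀ (C : Ctx n m) {M M′} → M ⇛ M′ → fill C M ⇛ fill C M′
fill-⇛ hole     r = r
fill-⇛ (body L) r = where-⇛ ε r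

renV⁻ : ∀ {ρ : Fin n → Fin n′} {θ : Fin m → Fin m′} M → Value (ren ρ θ M) → Value M
renV⁻ (` x) v = var
renV⁻ (ƛ M) v = lam

wk-ren : ∀ {ρ : Fin n → Fin n′} {θ : Fin m → Fin m′} M → wk (ren ρ θ M) ≡ ren (suc ∘ ρ) θ M
wk-ren = ren-ren (λ _ → refl) (λ _ → refl)

-- Naming reductions from a term to a reading of its translation.

mutual
  -- The continuation `κ` is accompanied by the context `C` it denotes. A naming rule creates a
  -- binding inside `C`; `fill-where` pulls the binding out, and what remains under it is the
  -- context of the continuation with which the named subterm is translated.
  cps-R : ∀ {ρ : Fin n → Fin n′} {θ : Fin m → Fin m′} {σ : Fin m′ → Fin m″} {ζ} → (∀ l → ζ l ≡ σ (θ l)) →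
          ∀ M {κ k C} → Rᴷ σ k κ C → ∃[ M₀ ] fill C (ren ρ θ M) ⇛ M₀ × Rᑫ σ k (cps ρ ζ M κ) M₀
  cps-R e (` x) {C = C} h = fill C _ , ε , ret-fill h var
  cps-R {ρ = ρ} e (ƛ M) {C = C} h with star-R {ρ = ρ} e (lam {M = M})
  ... | V , v , r = fill C V , fill-⇛ C v , ret-fill h r
  cps-R {ρ = ρ} {θ} e (M · N) {C = C} h with value? M | value? N
  ... | yes v | yes w with star-R {ρ = ρ} e v | star-R {ρ = ρ} e w
  ...   | V , a , r | U , b , s = fill C (V · U) , fill-⇛ C (·-⇛ a b) , call-fill h (app r s)
  cps-R {ρ = ρ} {θ} e (M · N) {C = C} h | yes v | no ¬w with star-R {ρ = suc ∘ ρ} {θ} e v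
  ...   | V , a , r with cps-R {ρ = ρ} e N (body (call-fill (Rᴷ-wk h) (app r var)))
  ...     | M₀ , b , s = M₀ ,
    fill-⇛ C (↦⇒⇛ (name-arg (renV v) (¬w ∘ renV⁻ N))) ◅◅ ≈⇒⇛ (fill-where C _ _)
      ◅◅ where-⇛ (fill-⇛ (renᶜ suc id C) (·-⇛ (≡⇒⇛ (wk-ren M) ◅◅ a) ε)) ε ◅◅ b , s
  cps-R {ρ = ρ} {θ} e (M · N) {C = C} h | no ¬v | yes w with star-R {ρ = suc ∘ ρ} {θ} e w
  ...   | U , a , r with cps-R {ρ = ρ} e M (body (call-fill (Rᴷ-wk h) (app var r)))
  ...     | M₀ , b , s = M₀ ,
    fill-⇛ C (↦⇒⇛ (name-fun (¬v ∘ renV⁻ M))) ◅◅ ≈⇒⇛ (fill-where C _ _)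
      ◅◅ where-⇛ (fill-⇛ (renᶜ suc id C) (·-⇛ ε (≡⇒⇛ (wk-ren N) ◅◅ a))) ε ◅◅ b , s
  cps-R {ρ = ρ} {θ} e (M · N) {C = C} h | no ¬v | no ¬w
    with cps-R {ρ = suc ∘ ρ} {θ} e N (body (call-fill (Rᴷ-wk (Rᴷ-wk h)) (app var var)))
  ...   | N₀ , a , r with cps-R {ρ = ρ} e M (body r)
  ...     | M₀ , b , s = M₀ ,
    fill-⇛ C (↦⇒⇛ (name-fun (¬v ∘ renV⁻ M))) ◅◅ ≈⇒⇛ (fill-where C _ _)
      ◅◅ where-⇛ (fill-⇛ (renᶜ suc id C) (·-⇛ ε (≡⇒⇛ (wk-ren N)) ◅◅ ↦⇒⇛ (name-arg var (¬w ∘ renV⁻ N)))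
                  ◅◅ ≈⇒⇛ (fill-where (renᶜ suc id C) _ _) ◅◅ a) ε ◅◅ b , s
  cps-R {ρ = ρ} e (L where≔ M) {C = C} h with cps-R {ρ = lift 1 ρ} e L (Rᴷ-wk h)
  ... | L₀ , a , r with cps-R {ρ = ρ} e M (body r)
  ...   | M₀ , b , s = M₀ , ≈⇒⇛ (fill-where C _ _) ◅◅ where-⇛ a ε ◅◅ b , s
  cps-R {ρ = ρ} e (μ J) {C = C} h with cpsᴶ-R {ρ = ρ} (λ { zero → refl ; (suc l) → cong suc (e l) }) J
  ... | j , N , a , r = fill C (μ ([ j ] N)) , fill-⇛ C (μ-⇛ a) , call-fill h (mu j r)

  -- Readings of μ have the single shape `μ ([ j ] M)`, so E3 is used from right to left to move
  -- every binding of a jump into its argument.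
  cpsᴶ-R : ∀ {ρ : Fin n → Fin n′} {θ : Fin m → Fin m′} {σ : Fin m′ → Fin m″} {ζ} → (∀ l → ζ l ≡ σ (θ l)) →
           ∀ J → ∃[ j ] ∃[ N ] (renᴶ ρ θ J) ⇛ᴶ ([ j ] N) × Rᑫ σ (σ j) (cpsᴶ ρ ζ J) N
  cpsᴶ-R {ρ = ρ} {θ} {σ} e ([ k ] M) rewrite e k with cps-R {ρ = ρ} {θ} {σ} e M hole
  ... | M₀ , a , r = θ k , M₀ , []-⇛ a , r
  cpsᴶ-R {ρ = ρ} e (J where≔ᴶ M) with cpsᴶ-R {ρ = lift 1 ρ} e J
  ... | j , L , a , r with cps-R {ρ = ρ} e M (body r)
  ...   | M₀ , b , s = j , M₀ , whereᴶ-⇛ a ◅◅ return (inj₁ (≈ᴶ-sym (E3 j L _))) ◅◅ []-⇛ b , s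

  star-R : ∀ {ρ : Fin n → Fin n′} {θ : Fin m → Fin m′} {σ : Fin m′ → Fin m″} {ζ} → (∀ l → ζ l ≡ σ (θ l)) →
           ∀ {V} (v : Value V) → ∃[ V₀ ] ren ρ θ V ⇛ V₀ × Rᵂ σ (star ρ ζ V v) V₀
  star-R e var = _ , ε , var
  star-R {ρ = ρ} e (lam {M}) with cps-R {ρ = lift 1 ρ} (cong suc ∘ e) M hole
  ... | M₀ , a , r = ƛ M₀ , ƛ-⇛ a , lam (eta r)

⟦⟧-R : ∀ (M : Term n m) → ∃[ M₀ ] M ⇛ M₀ × Rᵀ id ⟦ M ⟧ M₀
⟦⟧-R M with cps-R {ρ = id} {θ = id} {σ = suc} (λ _ → refl) M hole
... | M₀ , a , r = M₀ , ≡⇒⇛ (sym (ren-id (λ _ → refl) (λ _ → refl) M)) ◅◅ a , eta r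

infixl 5 _▹_

-- Reads a newly μ-bound variable as the existing name `k`. This can identify two source variables,
-- which is why readings go along arbitrary functions and not only injections.
_▹_ : (Fin m → Fin m′) → Fin m′ → Fin (suc m) → Fin m′
(σ ▹ k) zero    = k
(σ ▹ k) (suc j) = σ j

-- A step of q either is simulated under the tail [k]□ or contracts the jump
-- [k]μ[j]N, which is delayed because [k] is not part of the term related to q.
data Simᑫ {n m m′} (σ : Fin m → Fin m′) (k : Fin m′) (q : Q n m′) (M : Term n m) : Set where
  stay : ∀ {M′} → M ⇛ M′ → Rᑫ σ k q M′ → Simᑫ σ k q M
  jump : ∀ {N} j → M ⇛ μ ([ j ] N) → Rᑫ (σ ▹ k) ((σ ▹ k) j) q N → Simᑫ σ k q M

Simᑫ-call : ∀ {σ : Fin m → Fin m′} {k} {q : Q (suc n) m′} {t L M} → Simᑫ σ k q L → Rᵀ σ t M → Simᑫ σ k (t ·ᑫ ƛᴷ q) (L where≔ M)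
Simᑫ-call (stay a r) s = stay (where-⇛ a ε) (call r s)
Simᑫ-call (jump j a r) s = jump j
  (where-⇛ a ε ◅◅ ≈⇒⇛ (≈-trans (E2 _ _) (μ-cong (≈ᴶ-sym (E3 _ _ _))))) (call r (Rᵀ-renˢ (λ _ → refl) s))

Simᑫ-bind : ∀ {σ : Fin m → Fin m′} {k} {q : Q (suc n) m′} {w L V} → Simᑫ σ k q L → Rᵂ σ w V → Simᑫ σ k (ƛᴷ q ·ᴷ w) (L where≔ V)
Simᑫ-bind (stay a r) s = stay (where-⇛ a ε) (bind r s)
Simᑫ-bind (jump j a r) s = jump j
  (where-⇛ a ε ◅◅ ≈⇒⇛ (≈-trans (E2 _ _) (μ-cong (≈ᴶ-sym (E3 _ _ _))))) (bind r (Rᵂ-renˢ (λ _ → refl) s))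

-- The enclosing `[ j ]` is the jump that `Simᑫ` was waiting for: `β-jump` performs the delayed
-- contraction here.
Simᑫ-μ : ∀ {σ : Fin m → Fin m′} {q : Q n (suc m′)} {M} j →
         Simᑫ (lift 1 σ) (lift 1 σ j) q M → ∃[ M′ ] μ ([ j ] M) ⇛ M′ × Rᵀ σ (ƛᵀ q) M′
Simᑫ-μ j (stay a r) = _ , μ-⇛ ([]-⇛ a) , mu j r
Simᑫ-μ {σ = σ} j (jump i a r) = _ , μ-⇛ ([]-⇛ a) ◅◅ ↦⇒⇛ (ξ-μ β-jump) ,
  mu _ (subst (λ z → Rᑫ (lift 1 σ) z _ _) (sym (e i)) (Rᑫ-renˢ e r))
  where
  e : ∀ i → lift 1 σ ((j /0ᵏ) i) ≡ (lift 1 σ ▹ lift 1 σ j) i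
  e zero    = refl
  e (suc i) = refl

-- A variable continuation gives `(x where x := A)`, an `η-where` redex. For `λy.q` the body is
-- `(L where y := x)`, and `β-where` with the variable `x` as value does the work of η.
ηᴷ-R : ∀ {σ : Fin m → Fin m′} {k} (κ : K n m′) {L} → Rᑫ σ k (renᴷ suc id κ ·ᴷ varᵂ zero) L →
       ∃[ C ] (∀ A → (L where≔ A) ⇛ fill C A) × Rᴷ σ k κ C
ηᴷ-R (varᴷ l) (ret var) = hole , (λ A → ↦⇒⇛ η-where) , hole
ηᴷ-R (ƛᴷ q) (bind r var) with Rᑫ-unrenᵗ {θ = id} {σ = _} (λ i j e → j , refl , sym e) q r
... | _ , L , refl , refl , r′ = body L ,
  (λ A → where-⇛ (↦⇒⇛ (β-where var) ◅◅ ≡⇒⇛ (sub-ren-id (λ { zero → refl ; (suc x) → refl }) (λ _ → refl) L)) ε) , body r′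

mutual
  Rᵀ-sim : ∀ {σ : Fin m → Fin m′} {t t′ : T n m′} {M} → Rᵀ σ t M → t ⟶ᵀ t′ → ∃[ M′ ] M ⇛ M′ × Rᵀ σ t′ M′
  Rᵀ-sim (app (lam r) s) β = _ , ↦⇒⇛ (β-λ (Rᵂ-Value s)) ◅◅ ↦⇒⇛ (β-where (Rᵂ-Value s)) , Rᵀ-sub (λ _ → refl) (Rᵂ-/0 s) r
  Rᵀ-sim {σ = σ} (eta (tail r)) (η {t}) with Rᵀ-unrenᵗ {θ = id} {σ = σ} (λ i j e → j , refl , sym (suc-injective e)) t r
  ... | M , refl , r′ = M , ≡⇒⇛ (ren-id (λ _ → refl) (λ _ → refl) M) , r′
  Rᵀ-sim {σ = σ} (mu zero (tail r)) (η {t}) with Rᵀ-unrenᵗ {θ = suc} {σ = σ} (λ { i zero () ; i (suc j) e → j , refl , sym (suc-injective e) }) t r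
  ... | M , refl , r′ = M , ↦⇒⇛ η-μ , r′
  Rᵀ-sim {σ = σ} (eta r) (ξ-ƛ st) with Rᑫ-sim r st
  ... | stay a r′   = _ , a , eta r′
  -- The tail is the λ-bound continuation itself, so nothing remains to be jumped to: the μ reached
  -- by `a` becomes the reading of this λ.
  ... | jump j a r′ = _ , a , mu j (Rᑫ-≗ e (e j) r′)
    where
    e : ∀ j → lift 1 σ j ≡ (suc ∘ σ ▹ zero) j
    e zero    = refl
    e (suc j) = refl
  Rᵀ-sim (mu j r) (ξ-ƛ st) = Simᑫ-μ j (Rᑫ-sim r st)
  Rᵀ-sim (app r s) (ξ-ˡ st) with Rᵂ-sim r st
  ... | _ , a , r′ = _ , ·-⇛ a ε , app r′ s
  Rᵀ-sim (app r s) (ξ-ʳ st) with Rᵂ-sim s st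
  ... | _ , a , s′ = _ , ·-⇛ ε a , app r s′

  Rᑫ-sim : ∀ {σ : Fin m → Fin m′} {k} {q q′ : Q n m′} {M} → Rᑫ σ k q M → q ⟶ᑫ q′ → Simᑫ σ k q′ M
  Rᑫ-sim (bind r s) βᵂ = stay (↦⇒⇛ (β-where (Rᵂ-Value s))) (Rᑫ-sub (λ _ → refl) (Rᵂ-/0 s) r)
  Rᑫ-sim (tail (eta r)) βᴷ with Rᑫ-tail (λ _ → refl) (λ _ → refl) hole r
  ... | _ , a , r′ = stay (≈⇒⇛ a) r′
  Rᑫ-sim {σ = σ} {k} (tail (mu j r)) βᴷ with Rᑫ-tail {σ′ = σ ▹ k} (λ _ → refl) e (subst (λ z → Rᴷ _ _ z hole) (sym (e j)) hole) r
    where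
    e : ∀ j → (varᴷ k /0ᴷ) (lift 1 σ j) ≡ varᴷ ((σ ▹ k) j)
    e zero    = refl
    e (suc j) = refl
  ... | _ , a , r′ = jump j (≈⇒⇛ (μ-cong ([]-cong a))) r′
  Rᑫ-sim (call r (eta s)) βᴷ with Rᑫ-tail (λ _ → refl) (λ _ → refl) (body r) s
  ... | _ , a , s′ = stay (≈⇒⇛ a) s′
  Rᑫ-sim {σ = σ} {k} (call {L = L} r (mu j s)) βᴷ = plugged j s
    where
    p : PlugRel zero (wkᵏ L) (lift 1 σ) (σ ▹ k) (ƛᴷ _ /0ᴷ)
    p = plugRel (body (Rᑫ-renˢ (λ _ → refl) r)) (λ { zero ¬p → ⊥-elim (¬p refl) ; (suc j) _ → hole })
    -- Whether the leading jump is itself wrapped in `L` depends on `j`; splitting on it lets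
    -- `zero ≟ j` in `plugᴶ` compute.
    plugged : ∀ j {N q} → Rᑫ (lift 1 σ) (lift 1 σ j) q N → Simᑫ σ k (subᑫ varᵂ (ƛᴷ _ /0ᴷ) q) (L where≔ μ ([ j ] N))
    plugged zero s with Rᑫ-plug (λ _ → refl) p (PlugRel.at-i p) s
    ... | _ , a , s′ = jump zero (↦⇒⇛ β-μ ◅◅ ≈⇒⇛ (μ-cong ([]-cong a))) s′
    plugged (suc j) s with Rᑫ-plug (λ _ → refl) p (PlugRel.elsewhere p (suc j) (λ ())) s
    ... | _ , a , s′ = jump (suc j) (↦⇒⇛ β-μ ◅◅ ≈⇒⇛ (μ-cong ([]-cong a))) s′
  Rᑫ-sim (bind r s) (ξ-ᴷˡ (η {κ})) with ηᴷ-R κ r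
  ... | C , a , h = stay (a _) (ret-fill h s)
  Rᑫ-sim (bind r s) (ξ-ᴷˡ (ξ-ƛ st)) = Simᑫ-bind (Rᑫ-sim r st) s
  Rᑫ-sim (ret r) (ξ-ᴷʳ st) with Rᵂ-sim r st
  ... | _ , a , r′ = stay a (ret r′)
  Rᑫ-sim (bind r s) (ξ-ᴷʳ st) with Rᵂ-sim s st
  ... | _ , a , s′ = stay (where-⇛ ε a) (bind r s′)
  Rᑫ-sim (tail r) (ξ-ᵀˡ st) with Rᵀ-sim r st
  ... | _ , a , r′ = stay a (tail r′)
  Rᑫ-sim (call r s) (ξ-ᵀˡ st) with Rᵀ-sim s st
  ... | _ , a , s′ = stay (where-⇛ ε a) (call r s′)
  Rᑫ-sim (call r s) (ξ-ᵀʳ (η {κ})) with ηᴷ-R κ r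
  ... | C , a , h = stay (a _) (call-fill h s)
  Rᑫ-sim (call r s) (ξ-ᵀʳ (ξ-ƛ st)) = Simᑫ-call (Rᑫ-sim r st) s

  Rᵂ-sim : ∀ {σ : Fin m → Fin m′} {w w′ : W n m′} {V} → Rᵂ σ w V → w ⟶ᵂ w′ → ∃[ V′ ] V ⇛ V′ × Rᵂ σ w′ V′
  Rᵂ-sim (lam (app r var)) (η {w}) with Rᵂ-unrenᵗ {θ = id} (λ i j e → j , refl , sym e) w r
  ... | V , refl , r′ = V , ↦⇒⇛ (η-λ (Rᵂ-Value r′)) , r′
  Rᵂ-sim (lam r) (ξ-ƛ st) with Rᵀ-sim r st
  ... | _ , a , r′ = _ , ƛ-⇛ a , lam r′

Rᵀ-sim-↠ : ∀ {σ : Fin m → Fin m′} {t t′ : T n m′} {M} → Rᵀ σ t M → t ↠ᵀ t′ → ∃[ M′ ] M ⇛ M′ × Rᵀ σ t′ M′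
Rᵀ-sim-↠ r ε = _ , ε , r
Rᵀ-sim-↠ r (st ◅ sts) with Rᵀ-sim r st
... | _ , a , r′ with Rᵀ-sim-↠ r′ sts
...   | M′ , b , r″ = M′ , a ◅◅ b , r″

-- Irreducible terms have normal CPS forms

NFᵀ : T n m → Set
NFᵀ = IsNormalForm _⟶ᵀ_

NFᑫ : Q n m → Set
NFᑫ = IsNormalForm _⟶ᑫ_

NFᵂ : W n m → Set
NFᵂ = IsNormalForm _⟶ᵂ_

NFᴷ : K n m → Set
NFᴷ = IsNormalForm _⟶ᴷ_

-- Renamings reflect target redexes.

Covers : (Fin n → Fin n″) → (Fin n′ → Fin n″) → (Fin m → Fin n) → Set
Covers ρ ρ′ ρ₀ = ∀ x y → ρ x ≡ ρ′ y → ∃[ z ] x ≡ ρ₀ z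

Covers-lift : ∀ {ρ : Fin n → Fin n″} {ρ′ : Fin n′ → Fin n″} {ρ₀ : Fin m → Fin n} →
              Covers ρ ρ′ ρ₀ → Covers (lift 1 ρ) (lift 1 ρ′) (lift 1 ρ₀)
Covers-lift p zero    y       e = zero , refl
Covers-lift p (suc x) (suc y) e with p x y (suc-injective e)
... | z , refl = suc z , refl

Covers-suc : ∀ {ρ : Fin n → Fin n′} → Covers (lift 1 ρ) suc suc
Covers-suc (suc x) y e = x , refl

Covers-id : ∀ {ρ : Fin n → Fin n″} {ρ′ : Fin n′ → Fin n″} → Covers ρ ρ′ id
Covers-id x y e = x , refl

ƛᵀ-inj : ∀ {q q′ : Q n (suc m)} → ƛᵀ q ≡ ƛᵀ q′ → q ≡ q′
ƛᵀ-inj refl = refl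

ƛᵂ-inj : ∀ {t t′ : T (suc n) m} → ƛᵂ t ≡ ƛᵂ t′ → t ≡ t′
ƛᵂ-inj refl = refl

ƛᴷ-inj : ∀ {q q′ : Q (suc n) m} → ƛᴷ q ≡ ƛᴷ q′ → q ≡ q′
ƛᴷ-inj refl = refl

varᵂ-inj : ∀ {x y : Fin n} → varᵂ {n} {m} x ≡ varᵂ y → x ≡ y
varᵂ-inj refl = refl

varᴷ-inj : ∀ {k l : Fin m} → varᴷ {n} {m} k ≡ varᴷ l → k ≡ l
varᴷ-inj refl = refl

·ᵀ-inj : ∀ {v v′ w w′ : W n m} → v ·ᵀ w ≡ v′ ·ᵀ w′ → v ≡ v′ × w ≡ w′
·ᵀ-inj refl = refl , refl

·ᴷ-inj : ∀ {k k′ : K n m} {w w′} → k ·ᴷ w ≡ k′ ·ᴷ w′ → k ≡ k′ × w ≡ w′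
·ᴷ-inj refl = refl , refl

·ᑫ-inj : ∀ {t t′ : T n m} {k k′} → t ·ᑫ k ≡ t′ ·ᑫ k′ → t ≡ t′ × k ≡ k′
·ᑫ-inj refl = refl , refl

mutual
  -- With `Covers-suc` in one scope and `Covers-id` in the other: if a renaming of `t` is a
  -- weakening, then so is `t`. This reflects the freshness condition of an η-redex.
  imageᵀ : ∀ {ρ : Fin n → Fin n″} {ρ′ : Fin n′ → Fin n″} {φ : Fin m → Fin m″} {φ′ : Fin m′ → Fin m″} {i j} {ρ₀ : Fin i → Fin n} {φ₀ : Fin j → Fin m} →
           Covers ρ ρ′ ρ₀ → Covers φ φ′ φ₀ → ∀ t u → renᵀ ρ φ t ≡ renᵀ ρ′ φ′ u → ∃[ t₀ ] t ≡ renᵀ ρ₀ φ₀ t₀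
  imageᵀ p r (ƛᵀ q) (ƛᵀ q′) e with imageᑫ p (Covers-lift r) q q′ (ƛᵀ-inj e)
  ... | q₀ , refl = ƛᵀ q₀ , refl
  imageᵀ p r (v ·ᵀ w) (v′ ·ᵀ w′) e with imageᵂ p r v v′ (proj₁ (·ᵀ-inj e)) | imageᵂ p r w w′ (proj₂ (·ᵀ-inj e))
  ... | v₀ , refl | w₀ , refl = v₀ ·ᵀ w₀ , refl

  imageᑫ : ∀ {ρ : Fin n → Fin n″} {ρ′ : Fin n′ → Fin n″} {φ : Fin m → Fin m″} {φ′ : Fin m′ → Fin m″} {i j} {ρ₀ : Fin i → Fin n} {φ₀ : Fin j → Fin m} →
           Covers ρ ρ′ ρ₀ → Covers φ φ′ φ₀ → ∀ q u → renᑫ ρ φ q ≡ renᑫ ρ′ φ′ u → ∃[ q₀ ] q ≡ renᑫ ρ₀ φ₀ q₀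
  imageᑫ p r (k ·ᴷ w) (k′ ·ᴷ w′) e with imageᴷ p r k k′ (proj₁ (·ᴷ-inj e)) | imageᵂ p r w w′ (proj₂ (·ᴷ-inj e))
  ... | k₀ , refl | w₀ , refl = k₀ ·ᴷ w₀ , refl
  imageᑫ p r (t ·ᑫ k) (t′ ·ᑫ k′) e with imageᵀ p r t t′ (proj₁ (·ᑫ-inj e)) | imageᴷ p r k k′ (proj₂ (·ᑫ-inj e))
  ... | t₀ , refl | k₀ , refl = t₀ ·ᑫ k₀ , refl

  imageᵂ : ∀ {ρ : Fin n → Fin n″} {ρ′ : Fin n′ → Fin n″} {φ : Fin m → Fin m″} {φ′ : Fin m′ → Fin m″} {i j} {ρ₀ : Fin i → Fin n} {φ₀ : Fin j → Fin m} →
           Covers ρ ρ′ ρ₀ → Covers φ φ′ φ₀ → ∀ w u → renᵂ ρ φ w ≡ renᵂ ρ′ φ′ u → ∃[ w₀ ] w ≡ renᵂ ρ₀ φ₀ w₀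
  imageᵂ p r (varᵂ x) (varᵂ y) e with p x y (varᵂ-inj e)
  ... | z , refl = varᵂ z , refl
  imageᵂ p r (ƛᵂ t) (ƛᵂ t′) e with imageᵀ (Covers-lift p) r t t′ (ƛᵂ-inj e)
  ... | t₀ , refl = ƛᵂ t₀ , refl

  imageᴷ : ∀ {ρ : Fin n → Fin n″} {ρ′ : Fin n′ → Fin n″} {φ : Fin m → Fin m″} {φ′ : Fin m′ → Fin m″} {i j} {ρ₀ : Fin i → Fin n} {φ₀ : Fin j → Fin m} →
           Covers ρ ρ′ ρ₀ → Covers φ φ′ φ₀ → ∀ k u → renᴷ ρ φ k ≡ renᴷ ρ′ φ′ u → ∃[ k₀ ] k ≡ renᴷ ρ₀ φ₀ k₀
  imageᴷ p r (varᴷ k) (varᴷ l) e with r k l (varᴷ-inj e)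
  ... | z , refl = varᴷ z , refl
  imageᴷ p r (ƛᴷ q) (ƛᴷ q′) e with imageᑫ (Covers-lift p) r q q′ (ƛᴷ-inj e)
  ... | q₀ , refl = ƛᴷ q₀ , refl

mutual
  -- Normal continuations are weakened when they pass under binders, and they have to stay normal.
  -- The renamed term enters through an equation, because `renᵀ ρ φ t` cannot be unified with a
  -- redex.
  unrenᵀ-step : ∀ {ρ : Fin n → Fin n′} {φ : Fin m → Fin m′} t {u u′} → renᵀ ρ φ t ≡ u → u ⟶ᵀ u′ → ∃[ t′ ] t ⟶ᵀ t′
  unrenᵀ-step (ƛᵂ t ·ᵀ w) e β = _ , β
  unrenᵀ-step (ƛᵀ (t ·ᑫ varᴷ zero)) e (η {u}) with imageᵀ Covers-id Covers-suc t u (proj₁ (·ᑫ-inj (ƛᵀ-inj e)))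
  ... | t₀ , refl = t₀ , η
  unrenᵀ-step (ƛᵀ q) refl (ξ-ƛ r) with unrenᑫ-step q refl r
  ... | _ , r′ = _ , ξ-ƛ r′
  unrenᵀ-step (v ·ᵀ w) refl (ξ-ˡ r) with unrenᵂ-step v refl r
  ... | _ , r′ = _ , ξ-ˡ r′
  unrenᵀ-step (v ·ᵀ w) refl (ξ-ʳ r) with unrenᵂ-step w refl r
  ... | _ , r′ = _ , ξ-ʳ r′

  unrenᑫ-step : ∀ {ρ : Fin n → Fin n′} {φ : Fin m → Fin m′} q {u u′} → renᑫ ρ φ q ≡ u → u ⟶ᑫ u′ → ∃[ q′ ] q ⟶ᑫ q′
  unrenᑫ-step (ƛᴷ q ·ᴷ w) e βᵂ = _ , βᵂ
  unrenᑫ-step (ƛᵀ q ·ᑫ k) e βᴷ = _ , βᴷ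
  unrenᑫ-step (k ·ᴷ w) refl (ξ-ᴷˡ r) with unrenᴷ-step k refl r
  ... | _ , r′ = _ , ξ-ᴷˡ r′
  unrenᑫ-step (k ·ᴷ w) refl (ξ-ᴷʳ r) with unrenᵂ-step w refl r
  ... | _ , r′ = _ , ξ-ᴷʳ r′
  unrenᑫ-step (t ·ᑫ k) refl (ξ-ᵀˡ r) with unrenᵀ-step t refl r
  ... | _ , r′ = _ , ξ-ᵀˡ r′
  unrenᑫ-step (t ·ᑫ k) refl (ξ-ᵀʳ r) with unrenᴷ-step k refl r
  ... | _ , r′ = _ , ξ-ᵀʳ r′

  unrenᵂ-step : ∀ {ρ : Fin n → Fin n′} {φ : Fin m → Fin m′} w {u u′} → renᵂ ρ φ w ≡ u → u ⟶ᵂ u′ → ∃[ w′ ] w ⟶ᵂ w′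
  unrenᵂ-step (ƛᵂ (w ·ᵀ varᵂ zero)) e (η {u}) with imageᵂ Covers-suc Covers-id w u (proj₁ (·ᵀ-inj (ƛᵂ-inj e)))
  ... | w₀ , refl = w₀ , η
  unrenᵂ-step (ƛᵂ t) refl (ξ-ƛ r) with unrenᵀ-step t refl r
  ... | _ , r′ = _ , ξ-ƛ r′

  unrenᴷ-step : ∀ {ρ : Fin n → Fin n′} {φ : Fin m → Fin m′} k {u u′} → renᴷ ρ φ k ≡ u → u ⟶ᴷ u′ → ∃[ k′ ] k ⟶ᴷ k′
  unrenᴷ-step (ƛᴷ (k ·ᴷ varᵂ zero)) e (η {u}) with imageᴷ Covers-suc Covers-id k u (proj₁ (·ᴷ-inj (ƛᴷ-inj e)))
  ... | k₀ , refl = k₀ , η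
  unrenᴷ-step (ƛᴷ q) refl (ξ-ƛ r) with unrenᑫ-step q refl r
  ... | _ , r′ = _ , ξ-ƛ r′

mutual
  -- Normality of `t` excludes the readings of `βᵂ` and `βᴷ` redexes, which are the ones that `ev`
  -- contracts. The only genuine step is η in the `app` case, where `⟦_⟧ᶜ` produces `λk.VUk` for an
  -- application that is read as `VU`.
  Rᵀ-ev : ∀ {σ : Fin m → Fin m′} {t : T n m′} {M τ κ} → (∀ x → τ x ≡ varᵂ x) → (∀ j → κ j ≡ varᴷ (σ j)) →
          Rᵀ σ t M → NFᵀ t → ƛᵀ (ev (renᵂ id suc ∘ τ) (renᴷ id suc ∘ κ) M (varᴷ zero)) ↠ᵀ t
  Rᵀ-ev {τ = τ} {κ} e f (app r s) nf =
    subst (λ z → ƛᵀ z ↠ᵀ _) (sym (trans (ev-·ᵛ _ _ (Rᵂ-Value r) (Rᵂ-Value s) (varᴷ zero))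
        (cong₂ (λ a b → a ·ᵀ b ·ᑫ varᴷ zero) (sym (ren-evᵂ id suc τ κ (Rᵂ-Value r))) (sym (ren-evᵂ id suc τ κ (Rᵂ-Value s))))))
      (η ◅ ·ᵀ-↠ (Rᵂ-ev e f r (λ (_ , a) → nf (_ , ξ-ˡ a))) (Rᵂ-ev e f s (λ (_ , a) → nf (_ , ξ-ʳ a))))
  Rᵀ-ev e f (eta r) nf =
    ƛᵀ-↠ (Rᑫ-ev (cong (renᵂ id suc) ∘ e) (cong (renᴷ id suc) ∘ f) refl r (λ (_ , a) → nf (_ , ξ-ƛ a)))
  Rᵀ-ev {σ = σ} {κ = κ} e f (mu j r) nf =
    ƛᵀ-↠ (Rᑫ-ev (cong (renᵂ id suc) ∘ e) g (g j) r (λ (_ , a) → nf (_ , ξ-ƛ a)))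
    where
    g : ∀ j → (renᴷ id suc ∘ κ ,ᴷ varᴷ zero) j ≡ varᴷ (lift 1 σ j)
    g zero    = refl
    g (suc j) = cong (renᴷ id suc) (f j)

  Rᑫ-ev : ∀ {σ : Fin m → Fin m′} {k} {q : Q n m′} {M τ κ k′} → (∀ x → τ x ≡ varᵂ x) → (∀ j → κ j ≡ varᴷ (σ j)) →
          k′ ≡ varᴷ k → Rᑫ σ k q M → NFᑫ q → ev τ κ M k′ ↠ᑫ q
  Rᑫ-ev {k = k} e f refl (ret r) nf =
    ≡⇒↠ᑫ (ev-value _ _ (Rᵂ-Value r) (varᴷ k)) ◅◅ ·ᴷ-↠ ε (Rᵂ-ev e f r (λ (_ , a) → nf (_ , ξ-ᴷʳ a)))
  Rᑫ-ev e f refl (bind r s) nf = ⊥-elim (nf (_ , βᵂ))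
  Rᑫ-ev e f refl (tail (app r s)) nf = ≡⇒↠ᑫ (ev-·ᵛ _ _ (Rᵂ-Value r) (Rᵂ-Value s) _)
    ◅◅ ·ᑫ-↠ (·ᵀ-↠ (Rᵂ-ev e f r (λ (_ , a) → nf (_ , ξ-ᵀˡ (ξ-ˡ a)))) (Rᵂ-ev e f s (λ (_ , a) → nf (_ , ξ-ᵀˡ (ξ-ʳ a))))) ε
  Rᑫ-ev e f refl (tail (eta r)) nf = ⊥-elim (nf (_ , βᴷ))
  Rᑫ-ev e f refl (tail (mu j r)) nf = ⊥-elim (nf (_ , βᴷ))
  Rᑫ-ev e f refl (call q (app r s)) nf = ≡⇒↠ᑫ (ev-·ᵛ _ _ (Rᵂ-Value r) (Rᵂ-Value s) _)
    ◅◅ ·ᑫ-↠ (·ᵀ-↠ (Rᵂ-ev e f r (λ (_ , a) → nf (_ , ξ-ᵀˡ (ξ-ˡ a)))) (Rᵂ-ev e f s (λ (_ , a) → nf (_ , ξ-ᵀˡ (ξ-ʳ a)))))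
             (ƛᴷ-↠ (Rᑫ-ev (extsᵂ-id e) (cong (renᴷ suc id) ∘ f) refl q (λ (_ , a) → nf (_ , ξ-ᵀʳ (ξ-ƛ a)))))
  Rᑫ-ev e f refl (call q (eta r)) nf = ⊥-elim (nf (_ , βᴷ))
  Rᑫ-ev e f refl (call q (mu j r)) nf = ⊥-elim (nf (_ , βᴷ))

  Rᵂ-ev : ∀ {σ : Fin m → Fin m′} {w : W n m′} {V τ κ} → (∀ x → τ x ≡ varᵂ x) → (∀ j → κ j ≡ varᴷ (σ j)) →
          (r : Rᵂ σ w V) → NFᵂ w → evᵂ τ κ V (Rᵂ-Value r) ↠ᵂ w
  Rᵂ-ev e f (var {x}) nf = subst (_↠ᵂ varᵂ x) (sym (e x)) ε
  Rᵂ-ev e f (lam r) nf = ƛᵂ-↠ (Rᵀ-ev (extsᵂ-id e) (cong (renᴷ suc id) ∘ f) r (λ (_ , a) → nf (_ , ξ-ƛ a)))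

⟦⟧ᶜ-nf : ∀ {t : T n m} {M} → Rᵀ id t M → NFᵀ t → ⟦ M ⟧ᶜ ↠ᵀ t
⟦⟧ᶜ-nf = Rᵀ-ev (λ _ → refl) (λ _ → refl)

-- Normal readings of irreducible terms.

Irr : Term n m → Set
Irr = IsNormalForm _⟶_

Irrᴶ : Jump n m → Set
Irrᴶ J = ¬ (∃[ I ] ∃[ I′ ] J ≈ᴶ I × I ↦ᴶ I′)

⟶-intro : ∀ {M L L′ : Term n m} → M ≈ L → L ↦ L′ → M ⟶ L′
⟶-intro e r = _ , _ , e , r , ≈-refl

ren-wk : ∀ (ρ : Fin n → Fin n′) (θ : Fin m → Fin m′) L →
         ren (lift 1 suc) id (ren (lift 1 ρ) θ L) ≡ ren (lift 1 (lift 1 ρ)) θ (ren (lift 1 suc) id L)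
ren-wk ρ θ L = trans (ren-ren {ρ″ = lift 1 (suc ∘ ρ)} (lift-∘ (λ _ → refl)) (λ _ → refl) L)
                     (sym (ren-ren (lift-∘ (λ _ → refl)) (λ _ → refl) L))

renᴶ-wk : ∀ (ρ : Fin n → Fin n′) (θ : Fin m → Fin m′) J →
          renᴶ (lift 1 suc) id (renᴶ (lift 1 ρ) θ J) ≡ renᴶ (lift 1 (lift 1 ρ)) θ (renᴶ (lift 1 suc) id J)
renᴶ-wk ρ θ J = trans (renᴶ-renᴶ {ρ″ = lift 1 (suc ∘ ρ)} (lift-∘ (λ _ → refl)) (λ _ → refl) J)
                      (sym (renᴶ-renᴶ (lift-∘ (λ _ → refl)) (λ _ → refl) J))

ren-wkᵏ : ∀ (ρ : Fin n → Fin n′) (θ : Fin m → Fin m′) M → wkᵏ (ren ρ θ M) ≡ ren ρ (lift 1 θ) (wkᵏ M)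
ren-wkᵏ ρ θ M = trans (ren-ren (λ _ → refl) (λ _ → refl) M) (sym (ren-ren (λ _ → refl) (λ _ → refl) M))

mutual
  ren-≈ : ∀ (ρ : Fin n → Fin n′) (θ : Fin m → Fin m′) {M M′} → M ≈ M′ → ren ρ θ M ≈ ren ρ θ M′
  ren-≈ ρ θ (E1 L M N)       = subst (λ z → ren ρ θ (L where≔ (M where≔ N)) ≈ (z where≔ _ where≔ _)) (ren-wk ρ θ L) (E1 _ _ _)
  ren-≈ ρ θ (E2 J M)         = subst (λ z → ren ρ θ (μ J where≔ M) ≈ μ (_ where≔ᴶ z)) (ren-wkᵏ ρ θ M) (E2 _ _)
  ren-≈ ρ θ ≈-refl           = ≈-refl
  ren-≈ ρ θ (≈-sym e)        = ≈-sym (ren-≈ ρ θ e)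
  ren-≈ ρ θ (≈-trans e f)    = ≈-trans (ren-≈ ρ θ e) (ren-≈ ρ θ f)
  ren-≈ ρ θ (ƛ-cong e)       = ƛ-cong (ren-≈ _ θ e)
  ren-≈ ρ θ (·-cong e f)     = ·-cong (ren-≈ ρ θ e) (ren-≈ ρ θ f)
  ren-≈ ρ θ (where-cong e f) = where-cong (ren-≈ _ θ e) (ren-≈ ρ θ f)
  ren-≈ ρ θ (μ-cong e)       = μ-cong (renᴶ-≈ ρ _ e)

  renᴶ-≈ : ∀ (ρ : Fin n → Fin n′) (θ : Fin m → Fin m′) {J J′} → J ≈ᴶ J′ → renᴶ ρ θ J ≈ᴶ renᴶ ρ θ J′
  renᴶ-≈ ρ θ (E1ᴶ L M N)       = subst (λ z → renᴶ ρ θ (L where≔ᴶ (M where≔ N)) ≈ᴶ (z where≔ᴶ _ where≔ᴶ _)) (renᴶ-wk ρ θ L) (E1ᴶ _ _ _)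
  renᴶ-≈ ρ θ (E3 k L M)        = E3 _ _ _
  renᴶ-≈ ρ θ ≈ᴶ-refl           = ≈ᴶ-refl
  renᴶ-≈ ρ θ (≈ᴶ-sym e)        = ≈ᴶ-sym (renᴶ-≈ ρ θ e)
  renᴶ-≈ ρ θ (≈ᴶ-trans e f)    = ≈ᴶ-trans (renᴶ-≈ ρ θ e) (renᴶ-≈ ρ θ f)
  renᴶ-≈ ρ θ ([]-cong e)       = []-cong (ren-≈ ρ θ e)
  renᴶ-≈ ρ θ (whereᴶ-cong e f) = whereᴶ-cong (renᴶ-≈ _ θ e) (ren-≈ ρ θ f)

-- `σ` and `k` are universally quantified because the tail is fixed only by the surroundings of `M`:
-- a jump, a λ or an enclosing binding.
CPSNormal : Term n m → Set
CPSNormal {n} {m} M = ∀ {m′} (σ : Fin m → Fin m′) k → ∃[ q ] ∃[ M₀ ] M ≈ M₀ × Rᑫ {n} σ k q M₀ × NFᑫ q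

-- An application may receive any normal continuation without creating a redex. The renamings are
-- built in because the term is used below further binders. The result is displayed as `t ·ᑫ κ′` so
-- that abstracting a variable over it cannot give an η-redex, which has the form `k ·ᴷ w` inside.
AppNormal : Term n m → Set
AppNormal {n} {m} M = ∀ {n′ m₁ m′} (ρ : Fin n → Fin n′) (θ : Fin m → Fin m₁) {σ : Fin m₁ → Fin m′} {k κ C} →
  Rᴷ σ k κ C → NFᴷ κ → ∃[ t ] ∃[ κ′ ] ∃[ M₀ ] fill C (ren ρ θ M) ≈ M₀ × Rᑫ σ k (t ·ᑫ κ′) M₀ × NFᑫ (t ·ᑫ κ′)

AppNormal-ren : ∀ (ρ : Fin n → Fin n′) (θ : Fin m → Fin m′) {M} → AppNormal M → AppNormal (ren ρ θ M)
AppNormal-ren ρ θ {M} f ρ′ θ′ {C = C} h nk with f (ρ′ ∘ ρ) (θ′ ∘ θ) h nk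
... | t , κ , M₀ , a , r , nf = t , κ , M₀ ,
  subst (λ z → fill C z ≈ M₀) (sym (ren-ren (λ _ → refl) (λ _ → refl) M)) a , r , nf

-- The three constructors distinguish what remains of an irreducible M after
-- its where-bindings are stripped: a value, an application, or μJ.
data View {n m} (M : Term n m) : Set where
  val : (∀ L → ∃[ N ] (L where≔ M) ⟶ N) → CPSNormal M → View M
  app : AppNormal M → View M
  mu  : ∀ j N → M ≈ μ ([ j ] N) → CPSNormal N → View M

varᴷ-NF : ∀ {k : Fin m} → NFᴷ {n} (varᴷ k)
varᴷ-NF (_ , ())

-- With a normal body only η at the root is possible, and such an η-redex reads as a source η-redex:
-- here that of `η-where`, in `ƛᵀ-step` that of `η-μ`, in `ƛᵂ-step` that of `η-λ`.
ƛᴷ-step : ∀ {σ : Fin m → Fin m′} {k} {q : Q (suc n) m′} {κ L} → ƛᴷ q ⟶ᴷ κ → Rᑫ σ k q L → NFᑫ q → L ≡ ` zero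
ƛᴷ-step (η {varᴷ _}) (ret var) nf = refl
ƛᴷ-step (η {ƛᴷ _})   r         nf = ⊥-elim (nf (_ , βᵂ))
ƛᴷ-step (ξ-ƛ a)      r         nf = ⊥-elim (nf (_ , a))

ƛᵀ-step : ∀ {σ : Fin m → Fin m′} {q : Q n (suc m′)} {t M} j → ƛᵀ q ⟶ᵀ t → Rᑫ (lift 1 σ) (lift 1 σ j) q M → NFᑫ q →
          ∃[ N ] j ≡ zero × M ≡ wkᵏ N
ƛᵀ-step j (ξ-ƛ a) r nf = ⊥-elim (nf (_ , a))
ƛᵀ-step {σ = σ} zero (η {t}) (tail r) nf
  with Rᵀ-unrenᵗ {θ = suc} {σ = σ} (λ { i zero () ; i (suc j) e → j , refl , sym (suc-injective e) }) t r
... | N , e , _ = N , refl , e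

ƛᵂ-step : ∀ {σ : Fin m → Fin m′} {t : T (suc n) m′} {w M} → ƛᵂ t ⟶ᵂ w → Rᵀ σ t M → NFᵀ t →
          ∃[ V ] Value V × M ≡ wk V · (` zero)
ƛᵂ-step (ξ-ƛ a) r nf = ⊥-elim (nf (_ , a))
ƛᵂ-step (η {w}) (app r var) nf with Rᵂ-unrenᵗ {θ = id} (λ i j e → j , refl , sym e) w r
... | V , refl , r′ = V , Rᵂ-Value r′ , refl

·ᑫ-NF : ∀ {x : Fin n} {w : W n m} {κ} → NFᵂ w → NFᴷ κ → NFᑫ (varᵂ x ·ᵀ w ·ᑫ κ)
·ᑫ-NF nw nk (_ , ξ-ᵀˡ (ξ-ʳ a)) = nw (_ , a)
·ᑫ-NF nw nk (_ , ξ-ᵀʳ a)       = nk (_ , a)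

CPSNormal-where : ∀ {L : Term (suc n) m} {N : Term n m} → CPSNormal L → ¬ L ≈ ` zero → AppNormal N → CPSNormal (L where≔ N)
CPSNormal-where {N = N} g ¬z f σ k with g σ k
... | q , L₀ , a , r , nf with f id id (body r) (λ (_ , b) → ¬z (subst (_ ≈_) (ƛᴷ-step b r nf) a))
...   | t , κ , M₀ , b , s , nf′ = _ , M₀ , ≈-trans (where-cong a ≈-refl)
          (subst (λ z → (L₀ where≔ z) ≈ M₀) (ren-id (λ _ → refl) (λ _ → refl) N) b) , s , nf′

AppNormal⇒CPSNormal : ∀ {M : Term n m} → AppNormal M → CPSNormal M
AppNormal⇒CPSNormal {M = M} f σ k with f id id {σ = σ} {k} hole varᴷ-NF
... | t , κ , M₀ , a , r , nf = _ , M₀ , subst (_≈ M₀) (ren-id (λ _ → refl) (λ _ → refl) M) a , r , nf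

AppNormal-where : ∀ {L : Term (suc n) m} {N : Term n m} → AppNormal L → AppNormal N → AppNormal (L where≔ N)
AppNormal-where g f ρ θ {C = C} h nk with g (lift 1 ρ) θ (Rᴷ-wk h) (λ (_ , a) → nk (unrenᴷ-step _ refl a))
... | t , κ , L₀ , a , r , nf with f ρ θ (body r) (λ { (_ , ξ-ƛ b) → nf (_ , b) })
...   | t′ , κ′ , M₀ , b , s , nf′ =
  t′ , κ′ , M₀ , ≈-trans (fill-where C _ _) (≈-trans (where-cong a ≈-refl) b) , s , nf′

AppNormal-· : ∀ {x : Fin n} {N : Term n m} →
              (∀ {m′} (σ : Fin m → Fin m′) → ∃[ w ] ∃[ V₀ ] N ≈ V₀ × Rᵂ σ w V₀ × NFᵂ w) → AppNormal (` x · N)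
AppNormal-· f ρ θ {σ} {C = C} h nk with f (σ ∘ θ)
... | w , V , a , r , nf = _ , _ , fill C (_ · ren ρ θ V) , fill-≈ C (·-cong ≈-refl (ren-≈ ρ θ a)) ,
  call-fill h (app var (Rᵂ-ren (λ _ → refl) r)) , ·ᑫ-NF (λ (_ , b) → nf (unrenᵂ-step {φ = id} w refl b)) nk

-- `λk.q` is normal unless `q` is `tk`; then `t` itself is taken as the normal form. That `k` is not
-- free in `t` follows from reading `M` along `suc ∘ σ`, which leaves index zero to the tail.
etaᵀ : ∀ {σ : Fin m → Fin m′} {q : Q n (suc m′)} {M} → Rᑫ (suc ∘ σ) zero q M → NFᑫ q → ∃[ t ] Rᵀ σ t M × NFᵀ t
etaᵀ r@(ret _)    nf = _ , eta r , λ { (_ , ξ-ƛ a) → nf (_ , a) }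
etaᵀ r@(bind _ _) nf = ⊥-elim (nf (_ , βᵂ))
etaᵀ r@(call _ _) nf = _ , eta r , λ { (_ , ξ-ƛ a) → nf (_ , a) }
etaᵀ {σ = σ} {M = M} (tail r) nf with Rᵀ-unrenˢ {ρ = id} {θ = id} suc σ (λ _ → refl) M r (sym (ren-id (λ _ → refl) (λ _ → refl) M))
... | t , refl , r′ = t , r′ , λ { (_ , a) → nf (_ , ξ-ᵀˡ (renᵀ-step id suc a)) }

normalᵀ : ∀ {M : Term n m} → Irr M → View M → ∀ {m′} (σ : Fin m → Fin m′) → ∃[ t ] ∃[ M₀ ] M ≈ M₀ × Rᵀ σ t M₀ × NFᵀ t
normalᵀ irr (val _ g) σ with g (suc ∘ σ) zero
... | q , M₀ , a , r , nf with etaᵀ r nf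
...   | t , s , nf′ = t , M₀ , a , s , nf′
normalᵀ irr (app f) σ with AppNormal⇒CPSNormal f (suc ∘ σ) zero
... | q , M₀ , a , r , nf with etaᵀ r nf
...   | t , s , nf′ = t , M₀ , a , s , nf′
normalᵀ irr (mu j N e g) σ with g (lift 1 σ) (lift 1 σ j)
... | q , N₀ , a , r , nf = ƛᵀ q , μ ([ j ] N₀) , e′ , mu j r ,
    λ (_ , b) → contra (ƛᵀ-step j b r nf)
  where
  e′ = ≈-trans e (μ-cong ([]-cong a))
  contra : ¬ (∃[ P ] j ≡ zero × N₀ ≡ wkᵏ P)
  contra (P , refl , refl) = irr (_ , ⟶-intro e′ η-μ)

mutual
  normalᵂ : ∀ {V : Term n m} → Value V → Irr V → ∀ {m′} (σ : Fin m → Fin m′) → ∃[ w ] ∃[ V₀ ] V ≈ V₀ × Rᵂ σ w V₀ × NFᵂ w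
  normalᵂ (var {x}) irr σ = varᵂ x , ` x , ≈-refl , var , λ ()
  normalᵂ (lam {M}) irr σ = lam-case (normalᵀ irrM (view M irrM) σ)
    where
    irrM : Irr M
    irrM (_ , L , L′ , a , r , b) = irr (_ , ⟶-intro (ƛ-cong a) (ξ-ƛ r))
    lam-case : (∃[ t ] ∃[ M₀ ] M ≈ M₀ × Rᵀ σ t M₀ × NFᵀ t) → ∃[ w ] ∃[ V₀ ] ƛ M ≈ V₀ × Rᵂ σ w V₀ × NFᵂ w
    lam-case (t , M₀ , a , r , nf) = ƛᵂ t , ƛ M₀ , ƛ-cong a , lam r , λ (_ , b) → contra (ƛᵂ-step b r nf)
      where
      contra : ¬ (∃[ V ] Value V × M₀ ≡ wk V · (` zero))
      contra (V , v , refl) = irr (_ , ⟶-intro (ƛ-cong a) (η-λ v))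

  -- A shape outside `View` is refuted by a redex in some tree of the class. Subterms inherit
  -- irreducibility because both ≈ and ↦ are congruences.
  view : ∀ (M : Term n m) → Irr M → View M
  view (` x) irr = val (λ L → _ , ⟶-intro ≈-refl (β-where var)) (λ σ k → _ , _ , ≈-refl , ret var , λ { (_ , ξ-ᴷʳ ()) })
  view (ƛ M) irr = val (λ L → _ , ⟶-intro ≈-refl (β-where lam)) λ σ k → ret-case (normalᵂ lam irr σ)
    where
    ret-case : ∀ {m′} {σ : Fin _ → Fin m′} {k} → (∃[ w ] ∃[ V₀ ] ƛ M ≈ V₀ × Rᵂ σ w V₀ × NFᵂ w) →
               ∃[ q ] ∃[ M₀ ] ƛ M ≈ M₀ × Rᑫ σ k q M₀ × NFᑫ q
    ret-case (w , V , a , r , nf) = _ , V , a , ret r , λ { (_ , ξ-ᴷʳ b) → nf (_ , b) }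
  view (M · N) irr with value? M | value? N
  ... | no ¬v | _       = ⊥-elim (irr (_ , ⟶-intro ≈-refl (name-fun ¬v)))
  ... | yes v | no ¬w   = ⊥-elim (irr (_ , ⟶-intro ≈-refl (name-arg v ¬w)))
  ... | yes lam | yes w = ⊥-elim (irr (_ , ⟶-intro ≈-refl (β-λ w)))
  ... | yes var | yes w = app (AppNormal-· (normalᵂ w (λ (_ , L , L′ , a , r , b) → irr (_ , ⟶-intro (·-cong ≈-refl a) (ξ-·ʳ r)))))
  view (L where≔ N) irr with view N (λ (_ , _ , _ , a , r , _) → irr (_ , ⟶-intro (where-cong ≈-refl a) (ξ-whereʳ r)))
  ... | val red _  = ⊥-elim (irr (red L))
  ... | mu j P e _ = ⊥-elim (irr (_ , ⟶-intro (where-cong ≈-refl e) β-μ))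
  ... | app f with view L (λ (_ , _ , _ , a , r , _) → irr (_ , ⟶-intro (where-cong a ≈-refl) (ξ-whereˡ r)))
  ...   | val red g = val red′ (CPSNormal-where g (λ z → irr (_ , ⟶-intro (where-cong z ≈-refl) η-where)) f)
    where
    -- E1 moves `L′` next to the value at the core of `L`, where the redex supplied for `L` becomes
    -- available.
    red′ : ∀ L′ → ∃[ P ] (L′ where≔ (L where≔ N)) ⟶ P
    red′ L′ with red (ren (lift 1 suc) id L′)
    ... | _ , _ , _ , a , r , _ = _ , ⟶-intro (≈-trans (E1 L′ L N) (where-cong a ≈-refl)) (ξ-whereˡ r)
  ...   | mu j P e g = mu j (P where≔ wkᵏ N) (≈-trans (where-cong e ≈-refl) (≈-trans (E2 _ _) (μ-cong (≈ᴶ-sym (E3 _ _ _)))))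
            (CPSNormal-where g
              -- If the jump argument were the bound variable, the `η-where` redex would show only
              -- after E2 and E3 have moved the binding of `N` inside the jump.
              (λ z → irr (_ , ⟶-intro (≈-trans (where-cong (≈-trans e (μ-cong ([]-cong z))) ≈-refl)
                                        (≈-trans (E2 _ _) (μ-cong (≈ᴶ-sym (E3 _ _ _))))) (ξ-μ (ξ-[] η-where))))
              (AppNormal-ren id suc f))
  ...   | app g = app (AppNormal-where g f)
  view (μ J) irr with viewᴶ J (λ (_ , _ , a , r) → irr (_ , ⟶-intro (μ-cong a) (ξ-μ r)))
  ... | j , N , e , g = mu j N (μ-cong e) g

  viewᴶ : ∀ (J : Jump n m) → Irrᴶ J → ∃[ j ] ∃[ N ] J ≈ᴶ ([ j ] N) × CPSNormal N
  viewᴶ ([ k ] M) irr with view M (λ (_ , _ , _ , a , r , _) → irr (_ , _ , []-cong a , ξ-[] r))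
  ... | val _ g    = k , M , ≈ᴶ-refl , g
  ... | app f      = k , M , ≈ᴶ-refl , AppNormal⇒CPSNormal f
  ... | mu j N e _ = ⊥-elim (irr (_ , _ , []-cong e , β-jump))
  viewᴶ (J where≔ᴶ N) irr with view N (λ (_ , _ , _ , a , r , _) → irr (_ , _ , whereᴶ-cong ≈ᴶ-refl a , ξ-whereᴶʳ r))
  ... | v with viewᴶ J (λ (_ , _ , a , r) → irr (_ , _ , whereᴶ-cong a ≈-refl , ξ-whereᴶˡ r))
  ...   | j , L , e , g = j , (L where≔ N) , e′ , cn v
    where
    e′ : (J where≔ᴶ N) ≈ᴶ ([ j ] (L where≔ N))
    e′ = ≈ᴶ-trans (whereᴶ-cong e ≈-refl) (≈ᴶ-sym (E3 j L N))
    cn : View N → CPSNormal (L where≔ N)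
    cn (val red _)  = let (_ , _ , _ , a , r , _) = red L in ⊥-elim (irr (_ , _ , ≈ᴶ-trans e′ ([]-cong a) , ξ-[] r))
    cn (mu _ _ a _) = ⊥-elim (irr (_ , _ , ≈ᴶ-trans e′ ([]-cong (where-cong ≈-refl a)) , ξ-[] β-μ))
    cn (app f)      = CPSNormal-where g (λ z → irr (_ , _ , ≈ᴶ-trans e′ ([]-cong (where-cong z ≈-refl)) , ξ-[] η-where)) f

Irr⇒NF : ∀ {M : Term n m} → Irr M → HasNormalForm _⟶ᵀ_ ⟦ M ⟧ᶜ
Irr⇒NF irr with normalᵀ irr (view _ irr) id
... | t , M₀ , a , r , nf = t , nf , subst (_↠ᵀ t) (sym (cong ƛᵀ (ev-≈ _ _ a _))) (⟦⟧ᶜ-nf r nf)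

normalizable⇒⟦⟧ᶜ-NF : ∀ {M M′ : Term n m} → Star _⟶_ M M′ → Irr M′ → HasNormalForm _⟶ᵀ_ ⟦ M ⟧ᶜ
normalizable⇒⟦⟧ᶜ-NF ε        irr = Irr⇒NF irr
normalizable⇒⟦⟧ᶜ-NF (r ◅ rs) irr with normalizable⇒⟦⟧ᶜ-NF rs irr
... | t , nf , a = t , nf , ⟦⟧ᶜ-step r ◅◅ a

-- Normal forms of the source calculus

_⁺ : (Fin n → Set) → Fin (suc n) → Set
(P ⁺) zero    = ⊤
(P ⁺) (suc x) = P x

mutual
  -- Freshness is expressed by recursion on the tree, not as `M ≡ wk M₀`: in this form it is
  -- decidable and can be transported along ≈.
  All : (Fin n → Set) → (Fin m → Set) → Term n m → Set
  All P R (` x)        = P x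
  All P R (ƛ M)        = All (P ⁺) R M
  All P R (M · N)      = All P R M × All P R N
  All P R (L where≔ M) = All (P ⁺) R L × All P R M
  All P R (μ J)        = Allᴶ P (R ⁺) J

  Allᴶ : (Fin n → Set) → (Fin m → Set) → Jump n m → Set
  Allᴶ P R ([ k ] M)     = R k × All P R M
  Allᴶ P R (J where≔ᴶ M) = Allᴶ (P ⁺) R J × All P R M

⁺-lift⁺ : ∀ {P : Fin n → Set} {P′ : Fin n′ → Set} {ρ} → (∀ x → P x → P′ (ρ x)) → ∀ x → (P ⁺) x → (P′ ⁺) (lift 1 ρ x)
⁺-lift⁺ f zero    p = tt
⁺-lift⁺ f (suc x) p = f x p

⁺-lift⁻ : ∀ {P : Fin n → Set} {P′ : Fin n′ → Set} {ρ} → (∀ x → P′ (ρ x) → P x) → ∀ x → (P′ ⁺) (lift 1 ρ x) → (P ⁺) x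
⁺-lift⁻ f zero    p = tt
⁺-lift⁻ f (suc x) p = f x p

mutual
  All-ren⁺ : ∀ {P : Fin n → Set} {P′ : Fin n′ → Set} {R : Fin m → Set} {R′ : Fin m′ → Set} {ρ θ} →
             (∀ x → P x → P′ (ρ x)) → (∀ k → R k → R′ (θ k)) → ∀ M → All P R M → All P′ R′ (ren ρ θ M)
  All-ren⁺ f g (` x)        a       = f x a
  All-ren⁺ f g (ƛ M)        a       = All-ren⁺ (⁺-lift⁺ f) g M a
  All-ren⁺ f g (M · N)      (a , b) = All-ren⁺ f g M a , All-ren⁺ f g N b
  All-ren⁺ f g (L where≔ M) (a , b) = All-ren⁺ (⁺-lift⁺ f) g L a , All-ren⁺ f g M b
  All-ren⁺ f g (μ J)        a       = Allᴶ-ren⁺ f (⁺-lift⁺ g) J a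

  Allᴶ-ren⁺ : ∀ {P : Fin n → Set} {P′ : Fin n′ → Set} {R : Fin m → Set} {R′ : Fin m′ → Set} {ρ θ} →
              (∀ x → P x → P′ (ρ x)) → (∀ k → R k → R′ (θ k)) → ∀ J → Allᴶ P R J → Allᴶ P′ R′ (renᴶ ρ θ J)
  Allᴶ-ren⁺ f g ([ k ] M)     (a , b) = g k a , All-ren⁺ f g M b
  Allᴶ-ren⁺ f g (J where≔ᴶ M) (a , b) = Allᴶ-ren⁺ (⁺-lift⁺ f) g J a , All-ren⁺ f g M b

mutual
  All-ren⁻ : ∀ {P : Fin n → Set} {P′ : Fin n′ → Set} {R : Fin m → Set} {R′ : Fin m′ → Set} {ρ θ} →
             (∀ x → P′ (ρ x) → P x) → (∀ k → R′ (θ k) → R k) → ∀ M → All P′ R′ (ren ρ θ M) → All P R M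
  All-ren⁻ f g (` x)        a       = f x a
  All-ren⁻ f g (ƛ M)        a       = All-ren⁻ (⁺-lift⁻ f) g M a
  All-ren⁻ f g (M · N)      (a , b) = All-ren⁻ f g M a , All-ren⁻ f g N b
  All-ren⁻ f g (L where≔ M) (a , b) = All-ren⁻ (⁺-lift⁻ f) g L a , All-ren⁻ f g M b
  All-ren⁻ f g (μ J)        a       = Allᴶ-ren⁻ f (⁺-lift⁻ g) J a

  Allᴶ-ren⁻ : ∀ {P : Fin n → Set} {P′ : Fin n′ → Set} {R : Fin m → Set} {R′ : Fin m′ → Set} {ρ θ} →
              (∀ x → P′ (ρ x) → P x) → (∀ k → R′ (θ k) → R k) → ∀ J → Allᴶ P′ R′ (renᴶ ρ θ J) → Allᴶ P R J
  Allᴶ-ren⁻ f g ([ k ] M)     (a , b) = g k a , All-ren⁻ f g M b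
  Allᴶ-ren⁻ f g (J where≔ᴶ M) (a , b) = Allᴶ-ren⁻ (⁺-lift⁻ f) g J a , All-ren⁻ f g M b

⁺? : ∀ {P : Fin n → Set} → (∀ x → Dec (P x)) → ∀ x → Dec ((P ⁺) x)
⁺? d zero    = yes tt
⁺? d (suc x) = d x

mutual
  all? : ∀ {P : Fin n → Set} {R : Fin m → Set} → (∀ x → Dec (P x)) → (∀ k → Dec (R k)) → ∀ M → Dec (All P R M)
  all? d e (` x)        = d x
  all? d e (ƛ M)        = all? (⁺? d) e M
  all? d e (M · N)      = all? d e M ×-dec all? d e N
  all? d e (L where≔ M) = all? (⁺? d) e L ×-dec all? d e M
  all? d e (μ J)        = allᴶ? d (⁺? e) J

  allᴶ? : ∀ {P : Fin n → Set} {R : Fin m → Set} → (∀ x → Dec (P x)) → (∀ k → Dec (R k)) → ∀ J → Dec (Allᴶ P R J)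
  allᴶ? d e ([ k ] M)     = e k ×-dec all? d e M
  allᴶ? d e (J where≔ᴶ M) = allᴶ? (⁺? d) e J ×-dec all? d e M

⁺-image : ∀ {P : Fin n → Set} {ρ : Fin n′ → Fin n} → (∀ x → P x → ∃[ y ] x ≡ ρ y) → ∀ x → (P ⁺) x → ∃[ y ] x ≡ lift 1 ρ y
⁺-image f zero    p = zero , refl
⁺-image f (suc x) p with f x p
... | y , refl = suc y , refl

mutual
  -- Turns freshness back into an actual weakening, the form in which the η-rules state it.
  All-image : ∀ {P : Fin n → Set} {R : Fin m → Set} {ρ : Fin n′ → Fin n} {θ : Fin m′ → Fin m} →
              (∀ x → P x → ∃[ y ] x ≡ ρ y) → (∀ k → R k → ∃[ l ] k ≡ θ l) → ∀ M → All P R M → ∃[ M₀ ] M ≡ ren ρ θ M₀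
  All-image f g (` x) a with f x a
  ... | y , refl = ` y , refl
  All-image f g (ƛ M) a with All-image (⁺-image f) g M a
  ... | M₀ , refl = ƛ M₀ , refl
  All-image f g (M · N) (a , b) with All-image f g M a | All-image f g N b
  ... | M₀ , refl | N₀ , refl = M₀ · N₀ , refl
  All-image f g (L where≔ M) (a , b) with All-image (⁺-image f) g L a | All-image f g M b
  ... | L₀ , refl | M₀ , refl = (L₀ where≔ M₀) , refl
  All-image f g (μ J) a with Allᴶ-image f (⁺-image g) J a
  ... | J₀ , refl = μ J₀ , refl

  Allᴶ-image : ∀ {P : Fin n → Set} {R : Fin m → Set} {ρ : Fin n′ → Fin n} {θ : Fin m′ → Fin m} →
               (∀ x → P x → ∃[ y ] x ≡ ρ y) → (∀ k → R k → ∃[ l ] k ≡ θ l) → ∀ J → Allᴶ P R J → ∃[ J₀ ] J ≡ renᴶ ρ θ J₀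
  Allᴶ-image f g ([ k ] M) (a , b) with g k a | All-image f g M b
  ... | l , refl | M₀ , refl = ([ l ] M₀) , refl
  Allᴶ-image f g (J where≔ᴶ M) (a , b) with Allᴶ-image (⁺-image f) g J a | All-image f g M b
  ... | J₀ , refl | M₀ , refl = (J₀ where≔ᴶ M₀) , refl

infix 1 _↔_

-- Symmetry is a constructor of `_≈_`, so each invariance lemma must prove both directions in one
-- induction.
_↔_ : Set → Set → Set
A ↔ B = (A → B) × (B → A)

↔-refl : ∀ {A} → A ↔ A
↔-refl = id , id

↔-sym : ∀ {A B} → A ↔ B → B ↔ A
↔-sym (f , g) = g , f

↔-trans : ∀ {A B C} → A ↔ B → B ↔ C → A ↔ C
↔-trans (f , g) (h , i) = h ∘ f , g ∘ i

×-↔ : ∀ {A A′ B B′} → A ↔ A′ → B ↔ B′ → A × B ↔ A′ × B′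
×-↔ (f , g) (h , i) = (λ (a , b) → f a , h b) , (λ (a , b) → g a , i b)

All-wk : ∀ {P : Fin (suc n) → Set} {P′ : Fin (suc (suc n)) → Set} {R : Fin m → Set} → (∀ x → P x ↔ P′ (lift 1 suc x)) → ∀ L →
         All P R L ↔ All P′ R (ren (lift 1 suc) id L)
All-wk f L = All-ren⁺ (proj₁ ∘ f) (λ _ → id) L , All-ren⁻ (proj₂ ∘ f) (λ _ → id) L

⁺-wk : ∀ {P : Fin n → Set} x → (P ⁺) x ↔ ((P ⁺) ⁺) (lift 1 suc x)
⁺-wk zero    = ↔-refl
⁺-wk (suc x) = ↔-refl

mutual
  All-≈ : ∀ {P : Fin n → Set} {R : Fin m → Set} {M M′} → M ≈ M′ → All P R M ↔ All P R M′
  All-≈ (E1 L M N) with All-wk ⁺-wk L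
  ... | f , g = (λ (a , b , c) → (f a , b) , c) , (λ ((a , b) , c) → g a , b , c)
  All-≈ (E2 J M)         = ×-↔ ↔-refl (All-ren⁺ (λ _ → id) (λ _ → id) M , All-ren⁻ (λ _ → id) (λ _ → id) M)
  All-≈ ≈-refl           = ↔-refl
  All-≈ (≈-sym e)        = ↔-sym (All-≈ e)
  All-≈ (≈-trans e f)    = ↔-trans (All-≈ e) (All-≈ f)
  All-≈ (ƛ-cong e)       = All-≈ e
  All-≈ (·-cong e f)     = ×-↔ (All-≈ e) (All-≈ f)
  All-≈ (where-cong e f) = ×-↔ (All-≈ e) (All-≈ f)
  All-≈ (μ-cong e)       = Allᴶ-≈ e

  Allᴶ-≈ : ∀ {P : Fin n → Set} {R : Fin m → Set} {J J′} → J ≈ᴶ J′ → Allᴶ P R J ↔ Allᴶ P R J′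
  Allᴶ-≈ (E1ᴶ L M N) =
    (λ (a , b , c) → (Allᴶ-ren⁺ (proj₁ ∘ ⁺-wk) (λ _ → id) L a , b) , c) ,
    (λ ((a , b) , c) → Allᴶ-ren⁻ (proj₂ ∘ ⁺-wk) (λ _ → id) L a , b , c)
  Allᴶ-≈ (E3 k L M)        = (λ (a , b , c) → (a , b) , c) , (λ ((a , b) , c) → a , b , c)
  Allᴶ-≈ ≈ᴶ-refl           = ↔-refl
  Allᴶ-≈ (≈ᴶ-sym e)        = ↔-sym (Allᴶ-≈ e)
  Allᴶ-≈ (≈ᴶ-trans e f)    = ↔-trans (Allᴶ-≈ e) (Allᴶ-≈ f)
  Allᴶ-≈ ([]-cong e)       = ×-↔ ↔-refl (All-≈ e)
  Allᴶ-≈ (whereᴶ-cong e f) = ×-↔ (Allᴶ-≈ e) (All-≈ f)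

Positive : Fin (suc n) → Set
Positive zero    = ⊥
Positive (suc x) = ⊤

positive? : ∀ (x : Fin (suc n)) → Dec (Positive x)
positive? zero    = no id
positive? (suc x) = yes tt

positive⇒suc : ∀ (x : Fin (suc n)) → Positive x → ∃[ y ] x ≡ suc y
positive⇒suc (suc x) _ = x , refl

lift-positive : ∀ {ρ : Fin n → Fin n′} x → Positive x ↔ Positive (lift 1 ρ x)
lift-positive zero    = ↔-refl
lift-positive (suc x) = ↔-refl

Freshˣ : Term (suc n) m → Set
Freshˣ = All Positive (λ _ → ⊤)

Freshᵏ : Term n (suc m) → Set
Freshᵏ = All (λ _ → ⊤) Positive

Freshˣ-ren : ∀ {ρ : Fin n → Fin n′} {θ : Fin m → Fin m′} M → Freshˣ M ↔ Freshˣ (ren (lift 1 ρ) θ M)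
Freshˣ-ren M = All-ren⁺ (proj₁ ∘ lift-positive) (λ _ → id) M , All-ren⁻ (proj₂ ∘ lift-positive) (λ _ → id) M

mutual
  All-⊤ : ∀ {P : Fin n → Set} {R : Fin m → Set} → (∀ x → P x) → (∀ k → R k) → ∀ M → All P R M
  All-⊤ f g (` x)        = f x
  All-⊤ f g (ƛ M)        = All-⊤ (λ { zero → tt ; (suc x) → f x }) g M
  All-⊤ f g (M · N)      = All-⊤ f g M , All-⊤ f g N
  All-⊤ f g (L where≔ M) = All-⊤ (λ { zero → tt ; (suc x) → f x }) g L , All-⊤ f g M
  All-⊤ f g (μ J)        = Allᴶ-⊤ f (λ { zero → tt ; (suc k) → g k }) J

  Allᴶ-⊤ : ∀ {P : Fin n → Set} {R : Fin m → Set} → (∀ x → P x) → (∀ k → R k) → ∀ J → Allᴶ P R J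
  Allᴶ-⊤ f g ([ k ] M)     = g k , All-⊤ f g M
  Allᴶ-⊤ f g (J where≔ᴶ M) = Allᴶ-⊤ (λ { zero → tt ; (suc x) → f x }) g J , All-⊤ f g M

mutual
  All-map : ∀ {P P′ : Fin n → Set} {R R′ : Fin m → Set} → (∀ x → P x → P′ x) → (∀ k → R k → R′ k) → ∀ M → All P R M → All P′ R′ M
  All-map f g (` x)        a       = f x a
  All-map f g (ƛ M)        a       = All-map (λ { zero → id ; (suc x) → f x }) g M a
  All-map f g (M · N)      (a , b) = All-map f g M a , All-map f g N b
  All-map f g (L where≔ M) (a , b) = All-map (λ { zero → id ; (suc x) → f x }) g L a , All-map f g M b
  All-map f g (μ J)        a       = Allᴶ-map f (λ { zero → id ; (suc k) → g k }) J a

  Allᴶ-map : ∀ {P P′ : Fin n → Set} {R R′ : Fin m → Set} → (∀ x → P x → P′ x) → (∀ k → R k → R′ k) → ∀ J → Allᴶ P R J → Allᴶ P′ R′ J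
  Allᴶ-map f g ([ k ] M)     (a , b) = g k a , All-map f g M b
  Allᴶ-map f g (J where≔ᴶ M) (a , b) = Allᴶ-map (λ { zero → id ; (suc x) → f x }) g J a , All-map f g M b

-- Passing a binder turns the trivial predicate into one that agrees with it only pointwise; E1 and
-- E3 move a subterm across such a binder.
⊤⁺ : ∀ {R : Fin m → Set} (M : Term (suc n) m) → All (λ _ → ⊤) R M ↔ All ((λ _ → ⊤) ⁺) R M
⊤⁺ M = All-map (λ { zero _ → tt ; (suc _) _ → tt }) (λ _ → id) M , All-map (λ _ _ → tt) (λ _ → id) M

Freshˣ-wk : ∀ (M : Term n m) → Freshˣ (wk M)
Freshˣ-wk M = All-ren⁺ {P = λ _ → ⊤} {R = λ _ → ⊤} (λ _ → id) (λ _ → id) M (All-⊤ (λ _ → tt) (λ _ → tt) M)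

Freshᵏ-wk : ∀ (M : Term n m) → Freshᵏ (wkᵏ M)
Freshᵏ-wk M = All-ren⁺ {P = λ _ → ⊤} {R = λ _ → ⊤} (λ _ → id) (λ _ → id) M (All-⊤ (λ _ → tt) (λ _ → tt) M)

data Zero {n m} : Term (suc n) m → Set where
  zero : Zero (` zero)

data EtaApp {n m} : Term (suc n) m → Set where
  etaApp : ∀ {V N} → Value V → Freshˣ V → Zero N → EtaApp (V · N)

-- (L where x := N) hides an η-where redex iff L is x or μk.[j]x.
mutual
  data Skip {n m} : Term (suc n) m → Set where
    zero : ∀ {M} → Zero M → Skip M
    mu   : ∀ {J} → Skipᴶ J → Skip (μ J)

  data Skipᴶ {n m} : Jump (suc n) m → Set where
    jmp : ∀ {k M} → Zero M → Skipᴶ ([ k ] M)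

-- Up to ≈, J is [k]M with k = 0 not occurring in M.
Lin : Jump n (suc m) → Set
Lin ([ k ] M)     = k ≡ zero × Freshᵏ M
Lin (J where≔ᴶ M) = Lin J × Freshᵏ M

Value-≈ : ∀ {M M′ : Term n m} → M ≈ M′ → Value M ↔ Value M′
Value-≈ (E1 _ _ _)       = (λ ()) , (λ ())
Value-≈ (E2 _ _)         = (λ ()) , (λ ())
Value-≈ ≈-refl           = ↔-refl
Value-≈ (≈-sym e)        = ↔-sym (Value-≈ e)
Value-≈ (≈-trans e f)    = ↔-trans (Value-≈ e) (Value-≈ f)
Value-≈ (ƛ-cong e)       = (λ _ → lam) , (λ _ → lam)
Value-≈ (·-cong _ _)     = (λ ()) , (λ ())
Value-≈ (where-cong _ _) = (λ ()) , (λ ())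
Value-≈ (μ-cong _)       = (λ ()) , (λ ())

Zero-≈ : ∀ {M M′ : Term (suc n) m} → M ≈ M′ → Zero M ↔ Zero M′
Zero-≈ (E1 _ _ _)       = (λ ()) , (λ ())
Zero-≈ (E2 _ _)         = (λ ()) , (λ ())
Zero-≈ ≈-refl           = ↔-refl
Zero-≈ (≈-sym e)        = ↔-sym (Zero-≈ e)
Zero-≈ (≈-trans e f)    = ↔-trans (Zero-≈ e) (Zero-≈ f)
Zero-≈ (ƛ-cong _)       = (λ ()) , (λ ())
Zero-≈ (·-cong _ _)     = (λ ()) , (λ ())
Zero-≈ (where-cong _ _) = (λ ()) , (λ ())
Zero-≈ (μ-cong _)       = (λ ()) , (λ ())

EtaApp-≈ : ∀ {M M′ : Term (suc n) m} → M ≈ M′ → EtaApp M ↔ EtaApp M′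
EtaApp-≈ (E1 _ _ _)       = (λ ()) , (λ ())
EtaApp-≈ (E2 _ _)         = (λ ()) , (λ ())
EtaApp-≈ ≈-refl           = ↔-refl
EtaApp-≈ (≈-sym e)        = ↔-sym (EtaApp-≈ e)
EtaApp-≈ (≈-trans e f)    = ↔-trans (EtaApp-≈ e) (EtaApp-≈ f)
EtaApp-≈ (ƛ-cong _)       = (λ ()) , (λ ())
EtaApp-≈ (·-cong e f)     =
  (λ { (etaApp v a z) → etaApp (proj₁ (Value-≈ e) v) (proj₁ (All-≈ e) a) (proj₁ (Zero-≈ f) z) }) ,
  (λ { (etaApp v a z) → etaApp (proj₂ (Value-≈ e) v) (proj₂ (All-≈ e) a) (proj₂ (Zero-≈ f) z) })
EtaApp-≈ (where-cong _ _) = (λ ()) , (λ ())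
EtaApp-≈ (μ-cong _)       = (λ ()) , (λ ())

mutual
  Skip-≈ : ∀ {M M′ : Term (suc n) m} → M ≈ M′ → Skip M ↔ Skip M′
  Skip-≈ (E1 _ _ _)       = (λ { (zero ()) }) , (λ { (zero ()) })
  Skip-≈ (E2 (_ where≔ᴶ _) _) = (λ { (zero ()) }) , (λ { (zero ()) ; (mu ()) })
  Skip-≈ (E2 ([ _ ] _) _) = (λ { (zero ()) }) , (λ { (zero ()) ; (mu ()) })
  Skip-≈ ≈-refl           = ↔-refl
  Skip-≈ (≈-sym e)        = ↔-sym (Skip-≈ e)
  Skip-≈ (≈-trans e f)    = ↔-trans (Skip-≈ e) (Skip-≈ f)
  Skip-≈ (ƛ-cong _)       = (λ { (zero ()) }) , (λ { (zero ()) })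
  Skip-≈ (·-cong _ _)     = (λ { (zero ()) }) , (λ { (zero ()) })
  Skip-≈ (where-cong _ _) = (λ { (zero ()) }) , (λ { (zero ()) })
  Skip-≈ (μ-cong e)       = (λ { (mu s) → mu (proj₁ (Skipᴶ-≈ e) s) }) , (λ { (mu s) → mu (proj₂ (Skipᴶ-≈ e) s) })

  Skipᴶ-≈ : ∀ {J J′ : Jump (suc n) m} → J ≈ᴶ J′ → Skipᴶ J ↔ Skipᴶ J′
  Skipᴶ-≈ (E1ᴶ _ _ _)       = (λ ()) , (λ ())
  Skipᴶ-≈ (E3 _ _ _)        = (λ { (jmp ()) }) , (λ ())
  Skipᴶ-≈ ≈ᴶ-refl           = ↔-refl
  Skipᴶ-≈ (≈ᴶ-sym e)        = ↔-sym (Skipᴶ-≈ e)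
  Skipᴶ-≈ (≈ᴶ-trans e f)    = ↔-trans (Skipᴶ-≈ e) (Skipᴶ-≈ f)
  Skipᴶ-≈ ([]-cong e)       = (λ { (jmp z) → jmp (proj₁ (Zero-≈ e) z) }) , (λ { (jmp z) → jmp (proj₂ (Zero-≈ e) z) })
  Skipᴶ-≈ (whereᴶ-cong _ _) = (λ ()) , (λ ())

Lin-ren : ∀ {ρ : Fin n → Fin n′} {θ : Fin (suc m) → Fin (suc m′)} → (∀ k → Positive k ↔ Positive (θ k)) →
          ∀ J → Lin J ↔ Lin (renᴶ ρ θ J)
Lin-ren {θ = θ} f ([ k ] M) = ×-↔ (zero-iff k) (All-ren⁺ (λ _ → id) (proj₁ ∘ f) M , All-ren⁻ (λ _ → id) (proj₂ ∘ f) M)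
  where
  zero-iff : ∀ k → k ≡ zero ↔ θ k ≡ zero
  zero-iff k = (λ { refl → to (θ zero) (proj₂ (f zero)) }) , (λ e → to k (λ p → subst Positive e (proj₁ (f k) p)))
    where
    to : ∀ {m} (k : Fin (suc m)) → ¬ Positive k → k ≡ zero
    to zero    _ = refl
    to (suc k) p = ⊥-elim (p tt)
Lin-ren f (J where≔ᴶ M) = ×-↔ (Lin-ren f J) (All-ren⁺ (λ _ → id) (proj₁ ∘ f) M , All-ren⁻ (λ _ → id) (proj₂ ∘ f) M)

Lin-≈ : ∀ {J J′ : Jump n (suc m)} → J ≈ᴶ J′ → Lin J ↔ Lin J′
Lin-≈ (E1ᴶ L M N) with Lin-ren {ρ = lift 1 suc} {θ = id} (λ _ → ↔-refl) L | ⊤⁺ M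
... | f , g | h , i = (λ (a , b , c) → (f a , i b) , c) , (λ ((a , b) , c) → g a , h b , c)
Lin-≈ (E3 k L M) with ⊤⁺ L
... | h , i = (λ (a , b , c) → (a , i b) , c) , (λ ((a , b) , c) → a , h b , c)
Lin-≈ ≈ᴶ-refl           = ↔-refl
Lin-≈ (≈ᴶ-sym e)        = ↔-sym (Lin-≈ e)
Lin-≈ (≈ᴶ-trans e f)    = ↔-trans (Lin-≈ e) (Lin-≈ f)
Lin-≈ ([]-cong e)       = ×-↔ ↔-refl (All-≈ e)
Lin-≈ (whereᴶ-cong e f) = ×-↔ (Lin-≈ e) (All-≈ f)

lin? : ∀ j (M : Term n (suc m)) → Dec (Lin ([ j ] M))
lin? j M = (j ≟ zero) ×-dec all? (λ _ → yes tt) positive? M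

Zero-ren : ∀ {ρ : Fin n → Fin n′} {θ : Fin m → Fin m′} M → Zero M ↔ Zero (ren (lift 1 ρ) θ M)
Zero-ren (` zero)     = (λ _ → zero) , (λ _ → zero)
Zero-ren (` suc _)    = (λ ()) , (λ ())
Zero-ren (ƛ _)        = (λ ()) , (λ ())
Zero-ren (_ · _)      = (λ ()) , (λ ())
Zero-ren (_ where≔ _) = (λ ()) , (λ ())
Zero-ren (μ _)        = (λ ()) , (λ ())

EtaApp-ren : ∀ {ρ : Fin n → Fin n′} {θ : Fin m → Fin m′} M → EtaApp M ↔ EtaApp (ren (lift 1 ρ) θ M)
EtaApp-ren (` _)        = (λ ()) , (λ ())
EtaApp-ren (ƛ _)        = (λ ()) , (λ ())
EtaApp-ren (V · N)      =
  (λ { (etaApp v a z) → etaApp (renV v) (proj₁ (Freshˣ-ren V) a) (proj₁ (Zero-ren N) z) }) ,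
  (λ { (etaApp v a z) → etaApp (renV⁻ V v) (proj₂ (Freshˣ-ren V) a) (proj₂ (Zero-ren N) z) })
EtaApp-ren (_ where≔ _) = (λ ()) , (λ ())
EtaApp-ren (μ _)        = (λ ()) , (λ ())

Skipᴶ-ren : ∀ {ρ : Fin n → Fin n′} {θ : Fin m → Fin m′} J → Skipᴶ J ↔ Skipᴶ (renᴶ (lift 1 ρ) θ J)
Skipᴶ-ren ([ _ ] M)     = (λ { (jmp z) → jmp (proj₁ (Zero-ren M) z) }) , (λ { (jmp z) → jmp (proj₂ (Zero-ren M) z) })
Skipᴶ-ren (_ where≔ᴶ _) = (λ ()) , (λ ())

Skip-ren : ∀ {ρ : Fin n → Fin n′} {θ : Fin m → Fin m′} M → Skip M ↔ Skip (ren (lift 1 ρ) θ M)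
Skip-ren (` zero)     = (λ _ → zero zero) , (λ _ → zero zero)
Skip-ren (` suc _)    = (λ { (zero ()) }) , (λ { (zero ()) })
Skip-ren (ƛ _)        = (λ { (zero ()) }) , (λ { (zero ()) })
Skip-ren (_ · _)      = (λ { (zero ()) }) , (λ { (zero ()) })
Skip-ren (_ where≔ _) = (λ { (zero ()) }) , (λ { (zero ()) })
Skip-ren (μ J)        = (λ { (mu s) → mu (proj₁ (Skipᴶ-ren J) s) }) , (λ { (mu s) → mu (proj₂ (Skipᴶ-ren J) s) })

-- A syntactic form of irreducibility that is invariant under ≈.

data Core : Set where
  val app mu : Core

-- Indexed by what is left when the where-bindings are stripped.
mutual
  data Nf {n m} : Core → Term n m → Set where
    var : ∀ {x} → Nf val (` x)
    lam : ∀ {c M} → Nf c M → ¬ EtaApp M → Nf val (ƛ M)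
    app : ∀ {x V} → Value V → Nf val V → Nf app (` x · V)
    whr : ∀ {c L N} → Nf c L → Nf app N → ¬ Skip L → Nf c (L where≔ N)
    mu  : ∀ {J} → Nfᴶ J → ¬ Lin J → Nf mu (μ J)

  data Nfᴶ {n m} : Jump n m → Set where
    jmp : ∀ {c k M} → Nf c M → ¬ c ≡ mu → Nfᴶ ([ k ] M)
    whr : ∀ {J N} → Nfᴶ J → Nf app N → ¬ Skipᴶ J → Nfᴶ (J where≔ᴶ N)

mutual
  Nf-ren⁺ : ∀ {ρ : Fin n → Fin n′} {θ : Fin m → Fin m′} {c M} → Nf c M → Nf c (ren ρ θ M)
  Nf-ren⁺ var                 = var
  Nf-ren⁺ (lam {M = M} p ¬e)  = lam (Nf-ren⁺ p) (¬e ∘ proj₂ (EtaApp-ren M))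
  Nf-ren⁺ (app v p)           = app (renV v) (Nf-ren⁺ p)
  Nf-ren⁺ (whr {L = L} p q ¬s) = whr (Nf-ren⁺ p) (Nf-ren⁺ q) (¬s ∘ proj₂ (Skip-ren L))
  Nf-ren⁺ (mu {J} p ¬l)       = mu (Nfᴶ-ren⁺ p) (¬l ∘ proj₂ (Lin-ren lift-positive J))

  Nfᴶ-ren⁺ : ∀ {ρ : Fin n → Fin n′} {θ : Fin m → Fin m′} {J} → Nfᴶ J → Nfᴶ (renᴶ ρ θ J)
  Nfᴶ-ren⁺ (jmp p c)      = jmp (Nf-ren⁺ p) c
  Nfᴶ-ren⁺ (whr {J} p q ¬s) = whr (Nfᴶ-ren⁺ p) (Nf-ren⁺ q) (¬s ∘ proj₂ (Skipᴶ-ren J))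

mutual
  Nf-ren⁻ : ∀ {ρ : Fin n → Fin n′} {θ : Fin m → Fin m′} {c} M → Nf c (ren ρ θ M) → Nf c M
  Nf-ren⁻ (` _)        var          = var
  Nf-ren⁻ (ƛ M)        (lam p ¬e)   = lam (Nf-ren⁻ M p) (¬e ∘ proj₁ (EtaApp-ren M))
  Nf-ren⁻ (` _ · V)    (app v p)    = app (renV⁻ V v) (Nf-ren⁻ V p)
  Nf-ren⁻ (L where≔ N) (whr p q ¬s) = whr (Nf-ren⁻ L p) (Nf-ren⁻ N q) (¬s ∘ proj₁ (Skip-ren L))
  Nf-ren⁻ (μ J)        (mu p ¬l)    = mu (Nfᴶ-ren⁻ J p) (¬l ∘ proj₁ (Lin-ren lift-positive J))

  Nfᴶ-ren⁻ : ∀ {ρ : Fin n → Fin n′} {θ : Fin m → Fin m′} J → Nfᴶ (renᴶ ρ θ J) → Nfᴶ J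
  Nfᴶ-ren⁻ ([ _ ] M)     (jmp p c)    = jmp (Nf-ren⁻ M p) c
  Nfᴶ-ren⁻ (J where≔ᴶ N) (whr p q ¬s) = whr (Nfᴶ-ren⁻ J p) (Nf-ren⁻ N q) (¬s ∘ proj₁ (Skipᴶ-ren J))

data Var {n m} : Term n m → Set where
  var : ∀ {x} → Var (` x)

Var-≈ : ∀ {M M′ : Term n m} → M ≈ M′ → Var M ↔ Var M′
Var-≈ (E1 _ _ _)       = (λ ()) , (λ ())
Var-≈ (E2 _ _)         = (λ ()) , (λ ())
Var-≈ ≈-refl           = ↔-refl
Var-≈ (≈-sym e)        = ↔-sym (Var-≈ e)
Var-≈ (≈-trans e f)    = ↔-trans (Var-≈ e) (Var-≈ f)
Var-≈ (ƛ-cong _)       = (λ ()) , (λ ())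
Var-≈ (·-cong _ _)     = (λ ()) , (λ ())
Var-≈ (where-cong _ _) = (λ ()) , (λ ())
Var-≈ (μ-cong _)       = (λ ()) , (λ ())

app-var : ∀ {M V : Term n m} → Var M → Value V → Nf val V → Nf app (M · V)
app-var var = app

Nf-app-¬Skip : ∀ {M : Term (suc n) m} → Nf app M → ¬ Skip M
Nf-app-¬Skip (app _ _)   (zero ())
Nf-app-¬Skip (whr _ _ _) (zero ())

Nf-¬mu-¬Skip : ∀ {c} {M : Term (suc n) m} → Nf c M → ¬ c ≡ mu → ¬ Zero M → ¬ Skip M
Nf-¬mu-¬Skip p        ¬mu ¬z (zero z) = ¬z z
Nf-¬mu-¬Skip (mu _ _) ¬mu ¬z (mu _)   = ¬mu refl

mutual
  -- Lifts the absence of redexes from one tree to its whole class. The core index survives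
  -- rearrangement, and `Skip` and `Lin` are chosen so that E2 and E3 preserve them. In E1 from
  -- right to left the inner binding needs a new side condition; it holds because the core of its
  -- body is an application.
  Nf-≈ : ∀ {c} {M M′ : Term n m} → M ≈ M′ → Nf c M ↔ Nf c M′
  Nf-≈ (E1 L M N) =
    (λ { (whr p (whr q r _) ¬s) → whr (whr (Nf-ren⁺ p) q (¬s ∘ proj₂ (Skip-ren L))) r (λ { (zero ()) }) }) ,
    (λ { (whr (whr p q ¬s) r _) → whr (Nf-ren⁻ L p) (whr q r (Nf-app-¬Skip q)) (¬s ∘ proj₁ (Skip-ren L)) })
  Nf-≈ (E2 J M) =
    (λ { (whr (mu p ¬l) q ¬s) → mu (whr p (Nf-ren⁺ q) (¬s ∘ mu)) (¬l ∘ proj₁) }) ,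
    (λ { (mu (whr p q ¬s) ¬l) → whr (mu p (λ l → ¬l (l , Freshᵏ-wk M))) (Nf-ren⁻ M q) (λ { (zero ()) ; (mu s) → ¬s s }) })
  Nf-≈ ≈-refl        = ↔-refl
  Nf-≈ (≈-sym e)     = ↔-sym (Nf-≈ e)
  Nf-≈ (≈-trans e f) = ↔-trans (Nf-≈ e) (Nf-≈ f)
  Nf-≈ (ƛ-cong e) =
    (λ { (lam p ¬e) → lam (proj₁ (Nf-≈ e) p) (¬e ∘ proj₂ (EtaApp-≈ e)) }) ,
    (λ { (lam p ¬e) → lam (proj₂ (Nf-≈ e) p) (¬e ∘ proj₁ (EtaApp-≈ e)) })
  Nf-≈ (·-cong e f) =
    (λ { (app v p) → app-var (proj₁ (Var-≈ e) var) (proj₁ (Value-≈ f) v) (proj₁ (Nf-≈ f) p) }) ,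
    (λ { (app v p) → app-var (proj₂ (Var-≈ e) var) (proj₂ (Value-≈ f) v) (proj₂ (Nf-≈ f) p) })
  Nf-≈ (where-cong e f) =
    (λ { (whr p q ¬s) → whr (proj₁ (Nf-≈ e) p) (proj₁ (Nf-≈ f) q) (¬s ∘ proj₂ (Skip-≈ e)) }) ,
    (λ { (whr p q ¬s) → whr (proj₂ (Nf-≈ e) p) (proj₂ (Nf-≈ f) q) (¬s ∘ proj₁ (Skip-≈ e)) })
  Nf-≈ (μ-cong e) =
    (λ { (mu p ¬l) → mu (proj₁ (Nfᴶ-≈ e) p) (¬l ∘ proj₂ (Lin-≈ e)) }) ,
    (λ { (mu p ¬l) → mu (proj₂ (Nfᴶ-≈ e) p) (¬l ∘ proj₁ (Lin-≈ e)) })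

  Nfᴶ-≈ : ∀ {J J′ : Jump n m} → J ≈ᴶ J′ → Nfᴶ J ↔ Nfᴶ J′
  Nfᴶ-≈ (E1ᴶ L M N) =
    (λ { (whr p (whr q r _) ¬s) → whr (whr (Nfᴶ-ren⁺ p) q (¬s ∘ proj₂ (Skipᴶ-ren L))) r (λ ()) }) ,
    (λ { (whr (whr p q ¬s) r _) → whr (Nfᴶ-ren⁻ L p) (whr q r (Nf-app-¬Skip q)) (¬s ∘ proj₁ (Skipᴶ-ren L)) })
  Nfᴶ-≈ (E3 k L M) =
    (λ { (jmp (whr p q ¬s) c) → whr (jmp p c) q (λ { (jmp z) → ¬s (zero z) }) }) ,
    (λ { (whr (jmp p c) q ¬s) → jmp (whr p q (Nf-¬mu-¬Skip p c (¬s ∘ jmp))) c })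
  Nfᴶ-≈ ≈ᴶ-refl        = ↔-refl
  Nfᴶ-≈ (≈ᴶ-sym e)     = ↔-sym (Nfᴶ-≈ e)
  Nfᴶ-≈ (≈ᴶ-trans e f) = ↔-trans (Nfᴶ-≈ e) (Nfᴶ-≈ f)
  Nfᴶ-≈ ([]-cong e) =
    (λ { (jmp p c) → jmp (proj₁ (Nf-≈ e) p) c }) , (λ { (jmp p c) → jmp (proj₂ (Nf-≈ e) p) c })
  Nfᴶ-≈ (whereᴶ-cong e f) =
    (λ { (whr p q ¬s) → whr (proj₁ (Nfᴶ-≈ e) p) (proj₁ (Nf-≈ f) q) (¬s ∘ proj₂ (Skipᴶ-≈ e)) }) ,
    (λ { (whr p q ¬s) → whr (proj₂ (Nfᴶ-≈ e) p) (proj₂ (Nf-≈ f) q) (¬s ∘ proj₁ (Skipᴶ-≈ e)) })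

mutual
  Nf-¬↦ : ∀ {c} {M M′ : Term n m} → Nf c M → ¬ M ↦ M′
  Nf-¬↦ (app _ _) (name-fun ¬v) = ¬v var
  Nf-¬↦ (app v _) (name-arg _ ¬v) = ¬v v
  Nf-¬↦ (whr _ () _) (β-where var)
  Nf-¬↦ (whr _ () _) (β-where lam)
  Nf-¬↦ (whr _ () _) β-μ
  Nf-¬↦ (lam _ ¬e) (η-λ {V} v) = ¬e (etaApp (renV v) (Freshˣ-wk V) zero)
  Nf-¬↦ (whr _ _ ¬s) η-where = ¬s (zero zero)
  Nf-¬↦ (mu _ ¬l) (η-μ {M}) = ¬l (refl , Freshᵏ-wk M)
  Nf-¬↦ (lam p _) (ξ-ƛ r) = Nf-¬↦ p r
  Nf-¬↦ (app _ p) (ξ-·ʳ r) = Nf-¬↦ p r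
  Nf-¬↦ (whr p _ _) (ξ-whereˡ r) = Nf-¬↦ p r
  Nf-¬↦ (whr _ p _) (ξ-whereʳ r) = Nf-¬↦ p r
  Nf-¬↦ (mu p _) (ξ-μ r) = Nfᴶ-¬↦ p r

  Nfᴶ-¬↦ : ∀ {J J′ : Jump n m} → Nfᴶ J → ¬ J ↦ᴶ J′
  Nfᴶ-¬↦ (jmp (mu _ _) c) β-jump = c refl
  Nfᴶ-¬↦ (jmp p _) (ξ-[] r) = Nf-¬↦ p r
  Nfᴶ-¬↦ (whr p _ _) (ξ-whereᴶˡ r) = Nfᴶ-¬↦ p r
  Nfᴶ-¬↦ (whr _ p _) (ξ-whereᴶʳ r) = Nf-¬↦ p r

Nf⇒Irr : ∀ {c} {M : Term n m} → Nf c M → Irr M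
Nf⇒Irr p (_ , _ , _ , e , r , _) = Nf-¬↦ (proj₁ (Nf-≈ e) p) r

-- Normalisation of the readings of target normal forms.

¬Zero : ∀ {σ : Fin m → Fin m′} {k} {q : Q (suc n) m′} {L} → Rᑫ σ k q L → NFᴷ (ƛᴷ q) → ¬ Zero L
¬Zero (ret var)      nf zero = nf (_ , η {k = varᴷ _})
¬Zero (tail (eta _)) nf zero = nf (_ , ξ-ƛ βᴷ)

¬EtaApp : ∀ {σ : Fin m → Fin m′} {t : T (suc n) m′} {M} → Rᵀ σ t M → NFᵂ (ƛᵂ t) → ¬ EtaApp M
¬EtaApp {σ = σ} (app r var) nf (etaApp {V} v a zero) with All-image {θ = id} positive⇒suc (λ k _ → k , refl) V a
... | V₀ , refl with Rᵂ-unrenˢ {θ = id} id σ (λ _ → refl) V₀ r refl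
...   | w , refl , _ = nf (_ , η)
¬EtaApp {σ = σ} (eta (tail r)) nf (etaApp {V} {N} v a zero)
  with Rᵀ-unrenˢ {ρ = id} {θ = id} suc σ (λ _ → refl) (V · N) r (sym (ren-id (λ _ → refl) (λ _ → refl) (V · N)))
... | t , e , _ = nf (_ , ξ-ƛ (ηᵀ≡ e))

mutual
  -- A redex of the reading would show up as a redex of `t`, with one exception: `λk.q` can be read
  -- both as `M` and as `μk.[k]M` with `k` not free in `M`, even when it is no η-redex. `η-μ` passes
  -- from the second reading to the first and leaves `t` unchanged, so normality of `t` stays
  -- available.
  Rᵀ-normal : ∀ {σ : Fin m → Fin m′} {t : T n m′} {M} → Rᵀ σ t M → NFᵀ t → ∃[ c ] ∃[ M′ ] M ⇛ M′ × Rᵀ σ t M′ × Nf c M′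
  Rᵀ-normal (app (lam _) s) nf = ⊥-elim (nf (_ , β))
  Rᵀ-normal (app var s) nf with Rᵂ-normal s (λ (_ , a) → nf (_ , ξ-ʳ a))
  ... | V , a , s′ , p = app , _ , ·-⇛ ε a , app var s′ , app (Rᵂ-Value s′) p
  Rᵀ-normal (eta r) nf with Rᑫ-normal r (λ (_ , a) → nf (_ , ξ-ƛ a))
  ... | c , M , a , r′ , p , _ = c , M , a , eta r′ , p
  Rᵀ-normal {σ = σ} (mu {q} j r) nf with Rᑫ-normal r (λ (_ , a) → nf (_ , ξ-ƛ a))
  ... | c , M , a , r′ , p , ¬mu with lin? j M
  ...   | no ¬l = mu , _ , μ-⇛ ([]-⇛ a) , mu j r′ , mu (jmp p ¬mu) ¬l
  -- `fr` makes the jump argument a weakening, so the same `q` can be reread along `suc ∘ σ`, as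
  -- `eta` requires.
  ...   | yes (refl , fr) with All-image {ρ = id} (λ x _ → x , refl) positive⇒suc M fr
  ...     | M₀ , refl with Rᑫ-unrenˢ {ρ = id} id (suc ∘ σ) (λ _ → refl) refl M₀ r′ refl
  ...       | q₀ , e , r″ = c , M₀ , μ-⇛ ([]-⇛ a) ◅◅ ↦⇒⇛ η-μ ,
    subst (λ z → Rᵀ σ (ƛᵀ z) M₀) (sym (trans e (renᑫ-id (λ _ → refl) (λ _ → refl) q₀))) (eta r″) , Nf-ren⁻ M₀ p

  Rᑫ-normal : ∀ {σ : Fin m → Fin m′} {k} {q : Q n m′} {M} → Rᑫ σ k q M → NFᑫ q →
              ∃[ c ] ∃[ M′ ] M ⇛ M′ × Rᑫ σ k q M′ × Nf c M′ × ¬ c ≡ mu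
  Rᑫ-normal (ret r) nf with Rᵂ-normal r (λ (_ , a) → nf (_ , ξ-ᴷʳ a))
  ... | V , a , r′ , p = val , V , a , ret r′ , p , λ ()
  Rᑫ-normal (bind _ _) nf = ⊥-elim (nf (_ , βᵂ))
  Rᑫ-normal (tail (eta _)) nf = ⊥-elim (nf (_ , βᴷ))
  Rᑫ-normal (tail (mu _ _)) nf = ⊥-elim (nf (_ , βᴷ))
  Rᑫ-normal (tail (app (lam _) _)) nf = ⊥-elim (nf (_ , ξ-ᵀˡ β))
  Rᑫ-normal (tail (app var s)) nf with Rᵂ-normal s (λ (_ , a) → nf (_ , ξ-ᵀˡ (ξ-ʳ a)))
  ... | V , a , s′ , p = app , _ , ·-⇛ ε a , tail (app var s′) , app (Rᵂ-Value s′) p , λ ()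
  Rᑫ-normal (call _ (eta _)) nf = ⊥-elim (nf (_ , βᴷ))
  Rᑫ-normal (call _ (mu _ _)) nf = ⊥-elim (nf (_ , βᴷ))
  Rᑫ-normal (call _ (app (lam _) _)) nf = ⊥-elim (nf (_ , ξ-ᵀˡ β))
  Rᑫ-normal (call {q} r (app var s)) nf
    with Rᑫ-normal r (λ (_ , a) → nf (_ , ξ-ᵀʳ (ξ-ƛ a))) | Rᵂ-normal s (λ (_ , a) → nf (_ , ξ-ᵀˡ (ξ-ʳ a)))
  ... | c , L , a , r′ , p , ¬mu | V , b , s′ , p′ =
    c , _ , where-⇛ a (·-⇛ ε b) , call r′ (app var s′) , whr p (app (Rᵂ-Value s′) p′)
      (Nf-¬mu-¬Skip p ¬mu (¬Zero r′ (λ (_ , a) → nf (_ , ξ-ᵀʳ a)))) , ¬mu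

  Rᵂ-normal : ∀ {σ : Fin m → Fin m′} {w : W n m′} {V} → Rᵂ σ w V → NFᵂ w → ∃[ V′ ] V ⇛ V′ × Rᵂ σ w V′ × Nf val V′
  Rᵂ-normal var nf = _ , ε , var , var
  Rᵂ-normal (lam r) nf with Rᵀ-normal r (λ (_ , a) → nf (_ , ξ-ƛ a))
  ... | c , M , a , r′ , p = ƛ M , ƛ-⇛ a , lam r′ , lam p (¬EtaApp r′ nf)

-- `_⟶_` admits equations around its redex, so each equation is absorbed by the next reduction;
-- those after the last reduction remain as the final ≈.
⇛⇒⟶* : ∀ {M N : Term n m} → M ⇛ N → ∃[ N′ ] Star _⟶_ M N′ × N′ ≈ N
⇛⇒⟶* ε = _ , ε , ≈-refl
⇛⇒⟶* (inj₂ r ◅ rs) with ⇛⇒⟶* rs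
... | N′ , a , e = N′ , (_ , _ , ≈-refl , r , ≈-refl) ◅ a , e
⇛⇒⟶* (inj₁ e ◅ rs) with ⇛⇒⟶* rs
... | N′ , ε , f = _ , ε , ≈-trans e f
... | N′ , (_ , _ , f , r , g) ◅ a , h = N′ , (_ , _ , ≈-trans e f , r , g) ◅ a , h

⟦⟧-NF⇒normalizable : ∀ (M : Term n m) → HasNormalForm _⟶ᵀ_ ⟦ M ⟧ → HasNormalForm _⟶_ M
⟦⟧-NF⇒normalizable M (t , nf , a) with ⟦⟧-R M
... | M₀ , b , r with Rᵀ-sim-↠ r a
...   | M₁ , c , r′ with Rᵀ-normal r′ nf
...     | _ , M₂ , d , _ , p with ⇛⇒⟶* (b ◅◅ c ◅◅ d)
...       | M′ , s , e = M′ , Nf⇒Irr (proj₂ (Nf-≈ e) p) , s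

theorem2p11 : ∀ {n m : ℕ} (M : Term n m) → HasNormalForm _⟶_ M ⇔ HasNormalForm _⟶ᵀ_ ⟦ M ⟧
theorem2p11 M = mk⇔ to (⟦⟧-NF⇒normalizable M)
  where
  to : HasNormalForm _⟶_ M → HasNormalForm _⟶ᵀ_ ⟦ M ⟧
  to (M′ , irr , a) with normalizable⇒⟦⟧ᶜ-NF a irr
  ... | t , nf , b = t , nf , ⟦⟧-↠ M ◅◅ b
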